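{- Let $f(x)=x^2+ax+b$ with $a,b\in\mathbb{Z}$ be a monic quadratic polynomial with discriminant $D(f)=a^2-4b$. (i) Suppose $-D(f)\in\{7,11,19,43,67,163\}$. If the equation $y^q=f(x)$ has a solution in integers $x,y$ with $|y|>1$ and $q>2$ prime, then $q\leqslant q_0$, where $q_0=13$ if $D(f)=-7$; $q_0=7$ if $D(f)=-19$; $q_0=5$ if $D(f)=-11$; and $q_0=4$ if $D(f)\in\{ -43,-67,-163\}$. (ii) If $D(f)\in\{ -3,-8\}$ and $q>3$ is prime, then the equation $y^q=f(x)$ has no integer solutions $x,y$ with $y>1$. -}

module Defs where

open import Data.Integer using (ℤ; +_; -[1+_]; _+_; _*_; _-_; -_)
open import Data.Nat using (ℕ)
import Data.Nat as ℕ

f : ℤ → ℤ → ℤ → ℤ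
f a b x = x * x + a * x + b

disc : ℤ → ℤ → ℤ
disc a b = a * a - (+ 4) * b

_^ℤ_ : ℤ → ℕ → ℤ
y ^ℤ ℕ.zero = + 1
y ^ℤ ℕ.suc q = y * (y ^ℤ q)

data Q₀ : ℤ → ℕ → Set where
  d7   : Q₀ (- (+ 7))   13
  d19  : Q₀ (- (+ 19))  7
  d11  : Q₀ (- (+ 11))  5
  d43  : Q₀ (- (+ 43))  4
  d67  : Q₀ (- (+ 67))  4
  d163 : Q₀ (- (+ 163)) 4

{-# OPTIONS --safe #-}
-- Put X = 2x + a and D = - disc, so that X² + D = 4 yᵠ. The field ℚ(√-D) has class number one (by reduction of
-- binary quadratic forms), hence (X + √-D)/2 = κᵠ with κ of norm y and trace s; comparing the coefficients of √-D
-- shows that s² + D = 4y and that the Lucas number (κᵠ - κ̄ᵠ)/(κ - κ̄) is ± 1.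
--
-- If y is large compared with D², this is impossible for every q ≥ 5 prime to 3. Let A and B be the numerators in
-- the partial fraction decomposition of the coefficients of (1 - αx)^(-i) (1 - βx)^(-j); they are Padé approximants
-- to a q-th power. Substituting αᵠ = βᵠ ± (α - β) gives an element divisible by βᵠ whose norm is too small, so it
-- vanishes; but two neighbouring elements of this kind cannot both vanish.
--
-- For the finitely many remaining s, a prime ℓ is found modulo which the Lucas sequence has a period r divisible
-- by 6 and takes the values ± 1 only at indices congruent to known solutions e (always e = 1, and in three cases
-- one or two more). An ℓ-adic expansion of α^(e + rt) in t shows that e is the only solution in its class.

module Submission where

open import Defs
open import Algebra.Bundles using (CommutativeRing)
open import Algebra.Structures using (IsCommutativeRing)
open import Data.Bool using (Bool; true; false; T; not; _∧_; _∨_)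
open import Data.Bool.ListAction using (all; any)
open import Data.Bool.Properties using (T-∧; T-∨)
open import Data.Empty using (⊥; ⊥-elim)
open import Data.Integer hiding (_⊖_; suc; _≤_; _<_; _≤ᵇ_)
open import Data.Integer.DivMod using (a≡a%ℕn+[a/ℕn]*n; n%ℕd<d)
open import Data.Integer.Properties hiding ([1+m]⊖[1+n]≡m⊖n)
open import Data.List using (List; []; _∷_; upTo)
open import Data.List.Membership.Propositional using (_∈_)
open import Data.List.Membership.Propositional.Properties using (∈-upTo⁺)
open import Data.List.Relation.Unary.All as All using (All; []; _∷_)
open import Data.List.Relation.Unary.All.Properties using (all⁺)
open import Data.List.Relation.Unary.Any as Any using (Any; here; there)
open import Data.List.Relation.Unary.Any.Properties using (any⁻)
open import Data.Maybe.Base using (Maybe; just; nothing)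
open import Data.Nat as ℕ using (ℕ; zero; suc; _≤_; _<_; _≡ᵇ_; _≤ᵇ_)
open import Data.Nat.Coprimality using (Coprime; coprime-divisor; coprime-Bézout)
open import Data.Nat.GCD using (module Bézout)
open import Data.Nat.Induction using (<-wellFounded)
open import Data.Nat.Primality using (Prime; prime?; prime⇒irreducible; prime⇒nonTrivial; euclidsLemma)
open import Data.Product using (_,_; _×_; proj₁; proj₂; ∃; ∃₂)
open import Data.Sum using (_⊎_; inj₁; inj₂; [_,_]′)
open import Data.Unit using (tt)
open import Function.Base using (_∘_)
open import Function.Bundles using (Equivalence)
open import Induction.WellFounded using (Acc; acc)
open import Level using (0ℓ)
open import Relation.Binary.PropositionalEquality hiding (J)
open import Relation.Nullary using (¬_; Dec; yes; no; contradiction)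
open import Relation.Nullary.Decidable using (from-yes)
open import Tactic.RingSolver using (solve-∀)
open import Tactic.RingSolver.Core.AlmostCommutativeRing using (AlmostCommutativeRing; fromCommutativeRing)
import Data.Integer as ℤ
import Data.Integer.Divisibility.Signed as ℤ∣
import Data.Integer.Tactic.RingSolver as ℤ-Solver
import Data.Nat.DivMod as ℕ
import Data.Nat.Divisibility as ℕ∣
import Data.Nat.Properties as ℕ
import Data.Nat.Tactic.RingSolver as ℕ-Solver
open Bézout using (Identity; +-; -+)

-- The obstacle is that q is unbounded and that `U 1 = 1` for every s, so no congruence can exclude
-- the class of 1. The bound on s must therefore be uniform in q. With N = y, the norm of the
-- eliminated element is at least N ^ q unless it vanishes, while the two terms it equals have norms
-- of about D ^ (i + j - 1) c² N ^ n, with a binomial coefficient c, and D K ^ n N ^ (i - 1), with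
-- an absolute constant K. As n + j = q and i ≈ j ≈ 2 n, the first is small once N exceeds a
-- multiple of D², the second once N exceeds a constant and a multiple of D, whatever q is. In the
-- class of a genuine solution e, what isolates e is that the derivative in t of the ℓ-adic
-- expansion is prime to ℓ; this can be seen modulo ℓ². The order of discriminant - D is always
-- written as ℤ[α] for an element α suited to the task: (X + √-D)/2 in the descent, κ in the
-- estimates and the sieve. Powers of α then have Lucas numbers as coordinates, and since no
-- denominators occur, nonzero elements have norm at least 1.

∣i²∣ : ∀ i → + (∣ i ∣ ℕ.* ∣ i ∣) ≡ i * i
∣i²∣ (+ n) = pos-* n n
∣i²∣ -[1+ n ] = refl

∣i∣≡1⇒i≡±1 : ∀ i → ∣ i ∣ ≡ 1 → i ≡ 1ℤ ⊎ i ≡ -1ℤ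
∣i∣≡1⇒i≡±1 (+ 1) refl = inj₁ refl
∣i∣≡1⇒i≡±1 -[1+ 0 ] refl = inj₂ refl

∣i∣≡1⇒i²≡1 : ∀ i → ∣ i ∣ ≡ 1 → i * i ≡ 1ℤ
∣i∣≡1⇒i²≡1 (+ 1) refl = refl
∣i∣≡1⇒i²≡1 -[1+ 0 ] refl = refl

positive≢nonpositive : ∀ {m} n → 0 < m → + m ≢ - (+ n)
positive≢nonpositive {suc m} zero _ ()
positive≢nonpositive {suc m} (suc n) _ ()

T-not⁻ : ∀ {x} → T (not x) → ¬ T x
T-not⁻ {false} _ ()

-- Coefficients of negative binomial series

^-distribʳ-* : ∀ k m n → (m ℕ.* n) ℕ.^ k ≡ m ℕ.^ k ℕ.* n ℕ.^ k
^-distribʳ-* zero m n = refl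
^-distribʳ-* (suc k) m n = trans (cong (m ℕ.* n ℕ.*_) (^-distribʳ-* k m n)) (eq m n (m ℕ.^ k) (n ℕ.^ k))
  where
  eq : ∀ m n u v → m ℕ.* n ℕ.* (u ℕ.* v) ≡ m ℕ.* u ℕ.* (n ℕ.* v)
  eq = ℕ-Solver.solve-∀

-- multichoose k n is the coefficient of x ^ n in (1 - x) ^ (- k).
multichoose : ℕ → ℕ → ℕ
multichoose zero zero = 1
multichoose zero (suc n) = 0
multichoose (suc k) zero = 1
multichoose (suc k) (suc n) = multichoose k (suc n) ℕ.+ multichoose (suc k) n

-- Differentiating (1 - x) ^ (- k) gives k (1 - x) ^ (- k - 1); these are the coefficients of x ^ n.
-- The same derivative lies behind `A-contiguous` and `B-contiguous`.
absorption : ∀ k n → suc n ℕ.* multichoose k (suc n) ≡ k ℕ.* multichoose (suc k) n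
absorption zero n = ℕ.*-zeroʳ n
absorption (suc k) zero = begin
  1 ℕ.* (multichoose k 1 ℕ.+ 1)                ≡⟨ eq₁ (multichoose k 1) ⟩
  1 ℕ.* multichoose k 1 ℕ.+ 1                  ≡⟨ cong (ℕ._+ 1) (absorption k zero) ⟩
  k ℕ.* 1 ℕ.+ 1                                ≡⟨ eq₂ k ⟩
  suc k ℕ.* 1                                  ∎
  where
  open ≡-Reasoning
  eq₁ : ∀ m → 1 ℕ.* (m ℕ.+ 1) ≡ 1 ℕ.* m ℕ.+ 1
  eq₁ = ℕ-Solver.solve-∀
  eq₂ : ∀ k → k ℕ.* 1 ℕ.+ 1 ≡ suc k ℕ.* 1
  eq₂ = ℕ-Solver.solve-∀
absorption (suc k) (suc n) = begin
  suc (suc n) ℕ.* (multichoose k (2 ℕ.+ n) ℕ.+ multichoose (suc k) (suc n))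
    ≡⟨ eq₁ n (multichoose k (2 ℕ.+ n)) (multichoose (suc k) (suc n)) ⟩
  suc (suc n) ℕ.* multichoose k (2 ℕ.+ n) ℕ.+ suc (suc n) ℕ.* multichoose (suc k) (suc n)
    ≡⟨ cong (ℕ._+ suc (suc n) ℕ.* multichoose (suc k) (suc n)) (absorption k (suc n)) ⟩
  k ℕ.* multichoose (suc k) (suc n) ℕ.+ suc (suc n) ℕ.* multichoose (suc k) (suc n)
    ≡⟨ eq₂ k n (multichoose (suc k) (suc n)) ⟩
  suc k ℕ.* multichoose (suc k) (suc n) ℕ.+ suc n ℕ.* multichoose (suc k) (suc n)
    ≡⟨ cong (suc k ℕ.* multichoose (suc k) (suc n) ℕ.+_) (absorption (suc k) n) ⟩
  suc k ℕ.* multichoose (suc k) (suc n) ℕ.+ suc k ℕ.* multichoose (2 ℕ.+ k) n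
    ≡⟨ ℕ.*-distribˡ-+ (suc k) (multichoose (suc k) (suc n)) (multichoose (2 ℕ.+ k) n) ⟨
  suc k ℕ.* (multichoose (suc k) (suc n) ℕ.+ multichoose (2 ℕ.+ k) n) ∎
  where
  open ≡-Reasoning
  eq₁ : ∀ n x y → suc (suc n) ℕ.* (x ℕ.+ y) ≡ suc (suc n) ℕ.* x ℕ.+ suc (suc n) ℕ.* y
  eq₁ = ℕ-Solver.solve-∀
  eq₂ : ∀ k n x → k ℕ.* x ℕ.+ suc (suc n) ℕ.* x ≡ suc k ℕ.* x ℕ.+ suc n ℕ.* x
  eq₂ = ℕ-Solver.solve-∀

-- As `multichoose (suc k) n` is the binomial coefficient (n + k choose k), the left side is a
-- single term of the expansion of the right side.
multichoose-bound : ∀ a b k n → multichoose (suc k) n ℕ.* a ℕ.^ n ℕ.* b ℕ.^ k ≤ (a ℕ.+ b) ℕ.^ (n ℕ.+ k)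
multichoose-bound a b zero zero = ℕ.≤-refl
multichoose-bound a b zero (suc n) = begin
  multichoose 1 n ℕ.* (a ℕ.* a ℕ.^ n) ℕ.* 1      ≡⟨ eq a (multichoose 1 n) (a ℕ.^ n) ⟩
  a ℕ.* (multichoose 1 n ℕ.* a ℕ.^ n ℕ.* 1)      ≤⟨ ℕ.*-mono-≤ (ℕ.m≤m+n a b) (multichoose-bound a b zero n) ⟩
  (a ℕ.+ b) ℕ.* (a ℕ.+ b) ℕ.^ (n ℕ.+ 0)          ∎
  where
  open ℕ.≤-Reasoning
  eq : ∀ a c u → c ℕ.* (a ℕ.* u) ℕ.* 1 ≡ a ℕ.* (c ℕ.* u ℕ.* 1)
  eq = ℕ-Solver.solve-∀
multichoose-bound a b (suc k) zero = begin
  1 ℕ.* 1 ℕ.* b ℕ.^ suc k                        ≡⟨ ℕ.*-identityˡ (b ℕ.^ suc k) ⟩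
  b ℕ.^ suc k                                    ≤⟨ ℕ.^-monoˡ-≤ (suc k) (ℕ.m≤n+m b a) ⟩
  (a ℕ.+ b) ℕ.^ suc k                            ∎
  where open ℕ.≤-Reasoning
multichoose-bound a b (suc k) (suc n) = begin
  (multichoose (suc k) (suc n) ℕ.+ multichoose (2 ℕ.+ k) n) ℕ.* a ℕ.^ suc n ℕ.* b ℕ.^ suc k
    ≡⟨ eq₁ a b (multichoose (suc k) (suc n)) (multichoose (2 ℕ.+ k) n) (a ℕ.^ n) (b ℕ.^ k) ⟩
  b ℕ.* (multichoose (suc k) (suc n) ℕ.* a ℕ.^ suc n ℕ.* b ℕ.^ k) ℕ.+
  a ℕ.* (multichoose (2 ℕ.+ k) n ℕ.* a ℕ.^ n ℕ.* b ℕ.^ suc k)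
    ≤⟨ ℕ.+-mono-≤ (ℕ.*-monoʳ-≤ b (multichoose-bound a b k (suc n))) (ℕ.*-monoʳ-≤ a (multichoose-bound a b (suc k) n)) ⟩
  b ℕ.* (a ℕ.+ b) ℕ.^ suc (n ℕ.+ k) ℕ.+ a ℕ.* (a ℕ.+ b) ℕ.^ (n ℕ.+ suc k)
    ≡⟨ cong (λ m → b ℕ.* (a ℕ.+ b) ℕ.^ m ℕ.+ a ℕ.* (a ℕ.+ b) ℕ.^ (n ℕ.+ suc k)) (ℕ.+-suc n k) ⟨
  b ℕ.* (a ℕ.+ b) ℕ.^ (n ℕ.+ suc k) ℕ.+ a ℕ.* (a ℕ.+ b) ℕ.^ (n ℕ.+ suc k)
    ≡⟨ eq₂ a b ((a ℕ.+ b) ℕ.^ (n ℕ.+ suc k)) ⟩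
  (a ℕ.+ b) ℕ.^ (suc n ℕ.+ suc k) ∎
  where
  open ℕ.≤-Reasoning
  eq₁ : ∀ a b x y u v → (x ℕ.+ y) ℕ.* (a ℕ.* u) ℕ.* (b ℕ.* v) ≡
    b ℕ.* (x ℕ.* (a ℕ.* u) ℕ.* v) ℕ.+ a ℕ.* (y ℕ.* u ℕ.* (b ℕ.* v))
  eq₁ = ℕ-Solver.solve-∀
  eq₂ : ∀ a b u → b ℕ.* u ℕ.+ a ℕ.* u ≡ (a ℕ.+ b) ℕ.* u
  eq₂ = ℕ-Solver.solve-∀

-- Quadratic rings and Padé approximants

-- The ring ℤ[α] with α² = P α - Q.
data Quad (P Q : ℤ) : Set where
  _+α_ : ℤ → ℤ → Quad P Q

infix 5 _+α_

module QuadRing (P Q : ℤ) where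

  infixl 6 _⊕_ _⊖_
  infixl 7 _⊗_
  infix 8 ⊝_

  O : Set
  O = Quad P Q

  _⊕_ _⊗_ _⊖_ : O → O → O
  (a +α b) ⊕ (c +α d) = a + c +α b + d
  (a +α b) ⊗ (c +α d) = a * c - b * d * Q +α a * d + b * c + b * d * P

  ⊝_ conj : O → O
  ⊝ (a +α b) = - a +α - b
  x ⊖ y = x ⊕ ⊝ y
  conj (a +α b) = a + b * P +α - b

  ι : ℤ → O
  ι n = n +α 0ℤ

  α : O
  α = 0ℤ +α 1ℤ

  Nm : O → ℤ
  Nm (a +α b) = a * a + a * b * P + b * b * Q

  ⊗-assoc : ∀ x y z → (x ⊗ y) ⊗ z ≡ x ⊗ (y ⊗ z)
  ⊗-assoc (a +α b) (c +α d) (e +α f) = cong₂ _+α_ (eq₁ P Q a b c d e f) (eq₂ P Q a b c d e f)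
    where
    eq₁ : ∀ P Q a b c d e f →
      (a * c - b * d * Q) * e - (a * d + b * c + b * d * P) * f * Q ≡
      a * (c * e - d * f * Q) - b * (c * f + d * e + d * f * P) * Q
    eq₁ = ℤ-Solver.solve-∀
    eq₂ : ∀ P Q a b c d e f →
      (a * c - b * d * Q) * f + (a * d + b * c + b * d * P) * e + (a * d + b * c + b * d * P) * f * P ≡
      a * (c * f + d * e + d * f * P) + b * (c * e - d * f * Q) + b * (c * f + d * e + d * f * P) * P
    eq₂ = ℤ-Solver.solve-∀

  Nm-⊗ : ∀ x y → Nm (x ⊗ y) ≡ Nm x * Nm y
  Nm-⊗ (a +α b) (c +α d) = eq P Q a b c d
    where
    eq : ∀ P Q a b c d → let e = a * c - b * d * Q ; f = a * d + b * c + b * d * P in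
      e * e + e * f * P + f * f * Q ≡ (a * a + a * b * P + b * b * Q) * (c * c + c * d * P + d * d * Q)
    eq = ℤ-Solver.solve-∀

  isCommutativeRing : IsCommutativeRing _≡_ _⊕_ _⊗_ ⊝_ (ι 0ℤ) (ι 1ℤ)
  isCommutativeRing = record
    { isRing = record
      { +-isAbelianGroup = record
        { isGroup = record
          { isMonoid = record
            { isSemigroup = record
              { isMagma = record { isEquivalence = isEquivalence ; ∙-cong = cong₂ _⊕_ }
              ; assoc = λ { (a +α b) (c +α d) (e +α f) → cong₂ _+α_ (+-assoc a c e) (+-assoc b d f) } }
            ; identity = (λ { (a +α b) → cong₂ _+α_ (+-identityˡ a) (+-identityˡ b) })
                       , (λ { (a +α b) → cong₂ _+α_ (+-identityʳ a) (+-identityʳ b) }) }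
          ; inverse = (λ { (a +α b) → cong₂ _+α_ (+-inverseˡ a) (+-inverseˡ b) })
                    , (λ { (a +α b) → cong₂ _+α_ (+-inverseʳ a) (+-inverseʳ b) })
          ; ⁻¹-cong = cong ⊝_ }
        ; comm = λ { (a +α b) (c +α d) → cong₂ _+α_ (+-comm a c) (+-comm b d) } }
      ; *-cong = cong₂ _⊗_
      ; *-assoc = ⊗-assoc
      ; *-identity = (λ x → trans (⊗-comm (ι 1ℤ) x) (⊗-identityʳ x)) , ⊗-identityʳ
      ; distrib = ⊗-distribˡ , λ x y z →
          trans (⊗-comm (y ⊕ z) x) (trans (⊗-distribˡ x y z) (cong₂ _⊕_ (⊗-comm x y) (⊗-comm x z))) }
    ; *-comm = ⊗-comm }
    where
    ⊗-comm : ∀ x y → x ⊗ y ≡ y ⊗ x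
    ⊗-comm (a +α b) (c +α d) = cong₂ _+α_ (eq₁ Q a b c d) (eq₂ P a b c d)
      where
      eq₁ : ∀ Q a b c d → a * c - b * d * Q ≡ c * a - d * b * Q
      eq₁ = ℤ-Solver.solve-∀
      eq₂ : ∀ P a b c d → a * d + b * c + b * d * P ≡ c * b + d * a + d * b * P
      eq₂ = ℤ-Solver.solve-∀
    ⊗-identityʳ : ∀ x → x ⊗ ι 1ℤ ≡ x
    ⊗-identityʳ (a +α b) = cong₂ _+α_ (eq₁ Q a b) (eq₂ P a b)
      where
      eq₁ : ∀ Q a b → a * 1ℤ - b * 0ℤ * Q ≡ a
      eq₁ = ℤ-Solver.solve-∀
      eq₂ : ∀ P a b → a * 0ℤ + b * 1ℤ + b * 0ℤ * P ≡ b
      eq₂ = ℤ-Solver.solve-∀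
    ⊗-distribˡ : ∀ x y z → x ⊗ (y ⊕ z) ≡ x ⊗ y ⊕ x ⊗ z
    ⊗-distribˡ (a +α b) (c +α d) (e +α f) = cong₂ _+α_ (eq₁ Q a b c d e f) (eq₂ P a b c d e f)
      where
      eq₁ : ∀ Q a b c d e f → a * (c + e) - b * (d + f) * Q ≡ a * c - b * d * Q + (a * e - b * f * Q)
      eq₁ = ℤ-Solver.solve-∀
      eq₂ : ∀ P a b c d e f → a * (d + f) + b * (c + e) + b * (d + f) * P ≡
        a * d + b * c + b * d * P + (a * f + b * e + b * f * P)
      eq₂ = ℤ-Solver.solve-∀

  commutativeRing : CommutativeRing 0ℓ 0ℓ
  commutativeRing = record { isCommutativeRing = isCommutativeRing }

  0≟_ : ∀ x → Maybe (ι 0ℤ ≡ x)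
  0≟ (+ 0 +α + 0) = just refl
  0≟ _ = nothing

  ring : AlmostCommutativeRing 0ℓ 0ℓ
  ring = fromCommutativeRing commutativeRing 0≟_

  ι-* : ∀ m n → ι (m * n) ≡ ι m ⊗ ι n
  ι-* m n = cong₂ _+α_ (eq₁ Q m n) (eq₂ P m n)
    where
    eq₁ : ∀ Q m n → m * n ≡ m * n - 0ℤ * 0ℤ * Q
    eq₁ = ℤ-Solver.solve-∀
    eq₂ : ∀ P m n → 0ℤ ≡ m * 0ℤ + 0ℤ * n + 0ℤ * 0ℤ * P
    eq₂ = ℤ-Solver.solve-∀

  factor : ∀ x y z → x ⊗ z ⊕ y ⊗ z ≡ (x ⊕ y) ⊗ z
  factor = solve-∀ ring

  rotate : ∀ x y z → x ⊗ y ⊗ z ≡ y ⊗ (x ⊗ z)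
  rotate = solve-∀ ring

  cancel : ∀ x y → ⊝ x ⊗ y ⊖ ⊝ y ⊗ x ≡ ι 0ℤ
  cancel = solve-∀ ring

  distrib : ∀ c a x y → c ⊗ (x ⊖ a ⊗ y) ≡ c ⊗ x ⊕ ⊝ (a ⊗ (c ⊗ y))
  distrib = solve-∀ ring

  zeroʳ₂ : ∀ x y → x ⊗ (y ⊗ ι 0ℤ) ≡ ι 0ℤ
  zeroʳ₂ = solve-∀ ring

  infixr 8 _^^_
  _^^_ : O → ℕ → O
  x ^^ zero = ι 1ℤ
  x ^^ suc n = x ⊗ (x ^^ n)

  ^^-+ : ∀ x m n → x ^^ (m ℕ.+ n) ≡ (x ^^ m) ⊗ (x ^^ n)
  ^^-+ x zero n = sym (CommutativeRing.*-identityˡ commutativeRing (x ^^ n))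
  ^^-+ x (suc m) n = trans (cong (x ⊗_) (^^-+ x m n)) (sym (⊗-assoc x (x ^^ m) (x ^^ n)))

  -- `β` is P - α, the other root, and `Δ` is a square root of the discriminant P² - 4 Q.
  β Δ : O
  β = P +α -1ℤ
  Δ = α ⊖ β

  αβ : α ⊗ β ≡ ι Q
  αβ = cong₂ _+α_ (eq₁ P Q) (eq₂ P)
    where
    eq₁ : ∀ P Q → 0ℤ * P - 1ℤ * -1ℤ * Q ≡ Q
    eq₁ = ℤ-Solver.solve-∀
    eq₂ : ∀ P → 0ℤ * -1ℤ + 1ℤ * P + 1ℤ * -1ℤ * P ≡ 0ℤ
    eq₂ = ℤ-Solver.solve-∀

  α⊕β : α ⊕ β ≡ ι P
  α⊕β = cong (_+α 0ℤ) (+-identityˡ P)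

  U : ℕ → ℤ
  U zero = 0ℤ
  U (suc zero) = 1ℤ
  U (suc (suc n)) = P * U (suc n) - Q * U n

  -- The recurrence holds for α ^ n - β ^ n because P and Q are the elementary symmetric functions.
  Binet : ∀ n → α ^^ n ⊖ β ^^ n ≡ ι (U n) ⊗ Δ
  Binet zero = eq Δ
    where
    eq : ∀ x → ι 1ℤ ⊖ ι 1ℤ ≡ ι 0ℤ ⊗ x
    eq = solve-∀ ring
  Binet (suc zero) = eq α β
    where
    eq : ∀ x y → x ⊗ ι 1ℤ ⊖ y ⊗ ι 1ℤ ≡ ι 1ℤ ⊗ (x ⊖ y)
    eq = solve-∀ ring
  Binet (suc (suc n)) = begin
    α ^^ (2 ℕ.+ n) ⊖ β ^^ (2 ℕ.+ n)
      ≡⟨ eq₁ α β (α ^^ n) (β ^^ n) ⟩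
    (α ⊕ β) ⊗ (α ^^ (1 ℕ.+ n) ⊖ β ^^ (1 ℕ.+ n)) ⊖ (α ⊗ β) ⊗ (α ^^ n ⊖ β ^^ n)
      ≡⟨ cong₂ _⊖_ (cong₂ _⊗_ α⊕β (Binet (suc n))) (cong₂ _⊗_ αβ (Binet n)) ⟩
    ι P ⊗ (ι (U (suc n)) ⊗ Δ) ⊖ ι Q ⊗ (ι (U n) ⊗ Δ)
      ≡⟨ eq₂ (ι P) (ι Q) (ι (U (suc n))) (ι (U n)) Δ ⟩
    (ι P ⊗ ι (U (suc n)) ⊕ ⊝ (ι Q ⊗ ι (U n))) ⊗ Δ
      ≡⟨ cong (_⊗ Δ) (cong₂ (λ x y → x ⊕ ⊝ y) (sym (ι-* P (U (suc n)))) (sym (ι-* Q (U n)))) ⟩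
    ι (U (suc (suc n))) ⊗ Δ ∎
    where
    open ≡-Reasoning
    eq₁ : ∀ x y u v → x ⊗ (x ⊗ u) ⊖ y ⊗ (y ⊗ v) ≡ (x ⊕ y) ⊗ (x ⊗ u ⊖ y ⊗ v) ⊖ (x ⊗ y) ⊗ (u ⊖ v)
    eq₁ = solve-∀ ring
    eq₂ : ∀ p q u v x → p ⊗ (u ⊗ x) ⊖ q ⊗ (v ⊗ x) ≡ (p ⊗ u ⊕ ⊝ (q ⊗ v)) ⊗ x
    eq₂ = solve-∀ ring

  ∥_∥ : O → ℕ
  ∥ x ∥ = ∣ Nm x ∣

  ∥∥-⊗ : ∀ x y → ∥ x ⊗ y ∥ ≡ ∥ x ∥ ℕ.* ∥ y ∥
  ∥∥-⊗ x y = trans (cong ∣_∣ (Nm-⊗ x y)) (abs-* (Nm x) (Nm y))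

  ∥∥-^^ : ∀ x n → ∥ x ^^ n ∥ ≡ ∥ x ∥ ℕ.^ n
  ∥∥-^^ x zero = cong ∣_∣ (eq P Q)
    where
    eq : ∀ P Q → 1ℤ * 1ℤ + 1ℤ * 0ℤ * P + 0ℤ * 0ℤ * Q ≡ 1ℤ
    eq = ℤ-Solver.solve-∀
  ∥∥-^^ x (suc n) = trans (∥∥-⊗ x (x ^^ n)) (cong (∥ x ∥ ℕ.*_) (∥∥-^^ x n))

  ∥ι∥ : ∀ n → ∥ ι n ∥ ≡ ∣ n ∣ ℕ.* ∣ n ∣
  ∥ι∥ n = trans (cong ∣_∣ (eq P Q n)) (abs-* n n)
    where
    eq : ∀ P Q n → n * n + n * 0ℤ * P + 0ℤ * 0ℤ * Q ≡ n * n
    eq = ℤ-Solver.solve-∀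

  ∥⊝∥ : ∀ x → ∥ ⊝ x ∥ ≡ ∥ x ∥
  ∥⊝∥ (a +α b) = cong ∣_∣ (eq P Q a b)
    where
    eq : ∀ P Q a b → - a * - a + - a * - b * P + - b * - b * Q ≡ a * a + a * b * P + b * b * Q
    eq = ℤ-Solver.solve-∀

  ∥α∥ : ∥ α ∥ ≡ ∣ Q ∣
  ∥α∥ = cong ∣_∣ (eq P Q)
    where
    eq : ∀ P Q → 0ℤ * 0ℤ + 0ℤ * 1ℤ * P + 1ℤ * 1ℤ * Q ≡ Q
    eq = ℤ-Solver.solve-∀

  ∥β∥ : ∥ β ∥ ≡ ∣ Q ∣
  ∥β∥ = cong ∣_∣ (eq P Q)
    where
    eq : ∀ P Q → P * P + P * -1ℤ * P + -1ℤ * -1ℤ * Q ≡ Q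
    eq = ℤ-Solver.solve-∀

  ιₙ : ℕ → O
  ιₙ n = ι (+ n)

  open CommutativeRing commutativeRing public using () renaming (*-identityˡ to ⊗-identityˡ; *-identityʳ to ⊗-identityʳ; *-comm to ⊗-comm)

  -- L i j n is the coefficient of x ^ n in (1 - α x) ^ (- i) (1 - β x) ^ (- j).
  L : ℕ → ℕ → ℕ → O
  L zero zero zero = ι 1ℤ
  L zero zero (suc n) = ι 0ℤ
  L zero (suc j) zero = ι 1ℤ
  L zero (suc j) (suc n) = L zero j (suc n) ⊕ β ⊗ L zero (suc j) n
  L (suc i) j zero = ι 1ℤ
  L (suc i) j (suc n) = L i j (suc n) ⊕ α ⊗ L (suc i) j n

  L-zero : ∀ i j → L i j zero ≡ ι 1ℤ
  L-zero zero zero = refl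
  L-zero zero (suc j) = refl
  L-zero (suc i) j = refl

  -- `L` recurses on `i` before `j`; removing a factor 1 - β x for every `i` restores the symmetry
  -- between the two roots.
  L-sucʳ : ∀ i j n → L i (suc j) (suc n) ≡ L i j (suc n) ⊕ β ⊗ L i (suc j) n
  L-sucʳ zero j n = refl
  L-sucʳ (suc i) j zero = begin
    L i (suc j) 1 ⊕ α ⊗ ι 1ℤ                     ≡⟨ cong (_⊕ α ⊗ ι 1ℤ) (L-sucʳ i j 0) ⟩
    L i j 1 ⊕ β ⊗ L i (suc j) 0 ⊕ α ⊗ ι 1ℤ       ≡⟨ cong (λ x → L i j 1 ⊕ β ⊗ x ⊕ α ⊗ ι 1ℤ) (L-zero i (suc j)) ⟩
    L i j 1 ⊕ β ⊗ ι 1ℤ ⊕ α ⊗ ι 1ℤ                ≡⟨ eq (L i j 1) (β ⊗ ι 1ℤ) (α ⊗ ι 1ℤ) ⟩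
    L i j 1 ⊕ α ⊗ ι 1ℤ ⊕ β ⊗ ι 1ℤ                ∎
    where
    open ≡-Reasoning
    eq : ∀ x y z → x ⊕ y ⊕ z ≡ x ⊕ z ⊕ y
    eq = solve-∀ ring
  L-sucʳ (suc i) j (suc n) = begin
    L i (suc j) (2 ℕ.+ n) ⊕ α ⊗ L (suc i) (suc j) (suc n)
      ≡⟨ cong₂ (λ x y → x ⊕ α ⊗ y) (L-sucʳ i j (suc n)) (L-sucʳ (suc i) j n) ⟩
    L i j (2 ℕ.+ n) ⊕ β ⊗ L i (suc j) (suc n) ⊕ α ⊗ (L (suc i) j (suc n) ⊕ β ⊗ L (suc i) (suc j) n)
      ≡⟨ eq α β (L i j (2 ℕ.+ n)) (L i (suc j) (suc n)) (L (suc i) j (suc n)) (L (suc i) (suc j) n) ⟩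
    L i j (2 ℕ.+ n) ⊕ α ⊗ L (suc i) j (suc n) ⊕ β ⊗ (L i (suc j) (suc n) ⊕ α ⊗ L (suc i) (suc j) n) ∎
    where
    open ≡-Reasoning
    eq : ∀ a b x y z w → x ⊕ b ⊗ y ⊕ a ⊗ (z ⊕ b ⊗ w) ≡ x ⊕ a ⊗ z ⊕ b ⊗ (y ⊕ a ⊗ w)
    eq = solve-∀ ring

  -- Since (1 - β x) - (1 - α x) = Δ x, multiplication by Δ x splits a product of both kinds of
  -- factors into a difference with one factor fewer in each term.
  Δ-L : ∀ i j n → Δ ⊗ L (suc i) (suc j) n ≡ L (suc i) j (suc n) ⊖ L i (suc j) (suc n)
  Δ-L i j n = begin
    Δ ⊗ L (suc i) (suc j) n
      ≡⟨ eq α β (L i (suc j) (suc n)) (L (suc i) j (suc n)) (L (suc i) (suc j) n) ⟩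
    (L i (suc j) (suc n) ⊕ α ⊗ L (suc i) (suc j) n) ⊖ (L (suc i) j (suc n) ⊕ β ⊗ L (suc i) (suc j) n)
      ⊕ (L (suc i) j (suc n) ⊖ L i (suc j) (suc n))
      ≡⟨ cong (λ x → L (suc i) (suc j) (suc n) ⊖ x ⊕ (L (suc i) j (suc n) ⊖ L i (suc j) (suc n))) (sym (L-sucʳ (suc i) j n)) ⟩
    L (suc i) (suc j) (suc n) ⊖ L (suc i) (suc j) (suc n) ⊕ (L (suc i) j (suc n) ⊖ L i (suc j) (suc n))
      ≡⟨ eq′ (L (suc i) (suc j) (suc n)) (L (suc i) j (suc n) ⊖ L i (suc j) (suc n)) ⟩
    L (suc i) j (suc n) ⊖ L i (suc j) (suc n) ∎
    where
    open ≡-Reasoning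
    eq : ∀ a b x y z → (a ⊖ b) ⊗ z ≡ (x ⊕ a ⊗ z) ⊖ (y ⊕ b ⊗ z) ⊕ (y ⊖ x)
    eq = solve-∀ ring
    eq′ : ∀ x y → x ⊖ x ⊕ y ≡ y
    eq′ = solve-∀ ring

  -- The α- and β-parts left when `Δ-L` is applied until one kind of factor is gone, with α ^ (n +
  -- j) and β ^ (n + i) divided out. Each step raises `n`, so that one part gains a surplus power:
  -- this is the `α` in `A` and the `β` in `B`. Multiplying by Δ instead of dividing keeps both in
  -- ℤ[α].
  A B : ℕ → ℕ → ℕ → O
  A zero j n = ι 0ℤ
  -- The factor `Δ ^^ i` brings the total power of Δ to i + j - 1 on every branch of the recursion.
  A (suc i) zero n = Δ ^^ i ⊗ ιₙ (multichoose (suc i) n)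
  A (suc i) (suc j) n = A (suc i) j (suc n) ⊖ α ⊗ A i (suc j) (suc n)
  B zero zero n = ι 0ℤ
  B zero (suc j) n = Δ ^^ j ⊗ ιₙ (multichoose (suc j) n)
  B (suc i) zero n = ι 0ℤ
  B (suc i) (suc j) n = β ⊗ B (suc i) j (suc n) ⊖ B i (suc j) (suc n)

  L-zeroʳ : ∀ i n → L i 0 n ≡ ιₙ (multichoose i n) ⊗ α ^^ n
  L-zeroʳ zero zero = sym (⊗-identityˡ (ι 1ℤ))
  L-zeroʳ zero (suc n) = sym (eq (α ^^ suc n))
    where
    eq : ∀ x → ι 0ℤ ⊗ x ≡ ι 0ℤ
    eq = solve-∀ ring
  L-zeroʳ (suc i) zero = sym (⊗-identityˡ (ι 1ℤ))
  L-zeroʳ (suc i) (suc n) = begin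
    L i 0 (suc n) ⊕ α ⊗ L (suc i) 0 n
      ≡⟨ cong₂ (λ x y → x ⊕ α ⊗ y) (L-zeroʳ i (suc n)) (L-zeroʳ (suc i) n) ⟩
    ιₙ (multichoose i (suc n)) ⊗ (α ⊗ α ^^ n) ⊕ α ⊗ (ιₙ (multichoose (suc i) n) ⊗ α ^^ n)
      ≡⟨ eq α (ιₙ (multichoose i (suc n))) (ιₙ (multichoose (suc i) n)) (α ^^ n) ⟩
    ιₙ (multichoose (suc i) (suc n)) ⊗ α ^^ suc n ∎
    where
    open ≡-Reasoning
    eq : ∀ a x y u → x ⊗ (a ⊗ u) ⊕ a ⊗ (y ⊗ u) ≡ (x ⊕ y) ⊗ (a ⊗ u)
    eq = solve-∀ ring

  L-zeroˡ : ∀ j n → L 0 j n ≡ ιₙ (multichoose j n) ⊗ β ^^ n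
  L-zeroˡ zero zero = sym (⊗-identityˡ (ι 1ℤ))
  L-zeroˡ zero (suc n) = sym (eq (β ^^ suc n))
    where
    eq : ∀ x → ι 0ℤ ⊗ x ≡ ι 0ℤ
    eq = solve-∀ ring
  L-zeroˡ (suc j) zero = sym (⊗-identityˡ (ι 1ℤ))
  L-zeroˡ (suc j) (suc n) = begin
    L 0 j (suc n) ⊕ β ⊗ L 0 (suc j) n
      ≡⟨ cong₂ (λ x y → x ⊕ β ⊗ y) (L-zeroˡ j (suc n)) (L-zeroˡ (suc j) n) ⟩
    ιₙ (multichoose j (suc n)) ⊗ (β ⊗ β ^^ n) ⊕ β ⊗ (ιₙ (multichoose (suc j) n) ⊗ β ^^ n)
      ≡⟨ eq β (ιₙ (multichoose j (suc n))) (ιₙ (multichoose (suc j) n)) (β ^^ n) ⟩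
    ιₙ (multichoose (suc j) (suc n)) ⊗ β ^^ suc n ∎
    where
    open ≡-Reasoning
    eq : ∀ a x y u → x ⊗ (a ⊗ u) ⊕ a ⊗ (y ⊗ u) ≡ (x ⊕ y) ⊗ (a ⊗ u)
    eq = solve-∀ ring

  partial-fractions : ∀ i j {k} n → i ℕ.+ j ≡ suc k →
    Δ ^^ k ⊗ L i j n ≡ α ^^ (n ℕ.+ j) ⊗ A i j n ⊕ β ^^ (n ℕ.+ i) ⊗ B i j n
  partial-fractions zero (suc j) n refl = begin
    Δ ^^ j ⊗ L 0 (suc j) n
      ≡⟨ cong (Δ ^^ j ⊗_) (L-zeroˡ (suc j) n) ⟩
    Δ ^^ j ⊗ (ιₙ (multichoose (suc j) n) ⊗ β ^^ n)
      ≡⟨ eq (Δ ^^ j) (ιₙ (multichoose (suc j) n)) (β ^^ n) (α ^^ (n ℕ.+ suc j)) ⟩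
    α ^^ (n ℕ.+ suc j) ⊗ ι 0ℤ ⊕ β ^^ n ⊗ (Δ ^^ j ⊗ ιₙ (multichoose (suc j) n))
      ≡⟨ cong (λ m → α ^^ (n ℕ.+ suc j) ⊗ ι 0ℤ ⊕ β ^^ m ⊗ B 0 (suc j) n) (ℕ.+-identityʳ n) ⟨
    α ^^ (n ℕ.+ suc j) ⊗ ι 0ℤ ⊕ β ^^ (n ℕ.+ 0) ⊗ B 0 (suc j) n ∎
    where
    open ≡-Reasoning
    eq : ∀ d c u v → d ⊗ (c ⊗ u) ≡ v ⊗ ι 0ℤ ⊕ u ⊗ (d ⊗ c)
    eq = solve-∀ ring
  partial-fractions (suc i) zero n refl = begin
    Δ ^^ (i ℕ.+ 0) ⊗ L (suc i) 0 n
      ≡⟨ cong₂ (λ k x → Δ ^^ k ⊗ x) (ℕ.+-identityʳ i) (L-zeroʳ (suc i) n) ⟩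
    Δ ^^ i ⊗ (ιₙ (multichoose (suc i) n) ⊗ α ^^ n)
      ≡⟨ eq (Δ ^^ i) (ιₙ (multichoose (suc i) n)) (α ^^ n) (β ^^ (n ℕ.+ suc i)) ⟩
    α ^^ n ⊗ (Δ ^^ i ⊗ ιₙ (multichoose (suc i) n)) ⊕ β ^^ (n ℕ.+ suc i) ⊗ ι 0ℤ
      ≡⟨ cong (λ m → α ^^ m ⊗ A (suc i) 0 n ⊕ β ^^ (n ℕ.+ suc i) ⊗ ι 0ℤ) (ℕ.+-identityʳ n) ⟨
    α ^^ (n ℕ.+ 0) ⊗ A (suc i) 0 n ⊕ β ^^ (n ℕ.+ suc i) ⊗ ι 0ℤ ∎
    where
    open ≡-Reasoning
    eq : ∀ d c u v → d ⊗ (c ⊗ u) ≡ u ⊗ (d ⊗ c) ⊕ v ⊗ ι 0ℤ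
    eq = solve-∀ ring
  partial-fractions (suc i) (suc j) n refl = begin
    Δ ^^ (i ℕ.+ suc j) ⊗ L (suc i) (suc j) n
      ≡⟨ cong (λ k → Δ ^^ k ⊗ L (suc i) (suc j) n) (ℕ.+-suc i j) ⟩
    (Δ ⊗ Δ ^^ (i ℕ.+ j)) ⊗ L (suc i) (suc j) n
      ≡⟨ eq₁ Δ (Δ ^^ (i ℕ.+ j)) (L (suc i) (suc j) n) ⟩
    Δ ^^ (i ℕ.+ j) ⊗ (Δ ⊗ L (suc i) (suc j) n)
      ≡⟨ cong (Δ ^^ (i ℕ.+ j) ⊗_) (Δ-L i j n) ⟩
    Δ ^^ (i ℕ.+ j) ⊗ (L (suc i) j (suc n) ⊖ L i (suc j) (suc n))
      ≡⟨ eq₂ (Δ ^^ (i ℕ.+ j)) (L (suc i) j (suc n)) (L i (suc j) (suc n)) ⟩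
    Δ ^^ (i ℕ.+ j) ⊗ L (suc i) j (suc n) ⊖ Δ ^^ (i ℕ.+ j) ⊗ L i (suc j) (suc n)
      ≡⟨ cong₂ _⊖_ (partial-fractions (suc i) j (suc n) refl) (partial-fractions i (suc j) (suc n) (ℕ.+-suc i j)) ⟩
    (α ^^ (suc n ℕ.+ j) ⊗ A (suc i) j (suc n) ⊕ β ^^ (suc n ℕ.+ suc i) ⊗ B (suc i) j (suc n)) ⊖
    (α ^^ (suc n ℕ.+ suc j) ⊗ A i (suc j) (suc n) ⊕ β ^^ (suc n ℕ.+ i) ⊗ B i (suc j) (suc n))
      ≡⟨ cong₂ (λ k m →
           (α ^^ k ⊗ A (suc i) j (suc n) ⊕ (β ⊗ β ^^ (n ℕ.+ suc i)) ⊗ B (suc i) j (suc n)) ⊖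
           ((α ⊗ α ^^ (n ℕ.+ suc j)) ⊗ A i (suc j) (suc n) ⊕ β ^^ m ⊗ B i (suc j) (suc n)))
           (sym (ℕ.+-suc n j)) (sym (ℕ.+-suc n i)) ⟩
    (α ^^ (n ℕ.+ suc j) ⊗ A (suc i) j (suc n) ⊕ (β ⊗ β ^^ (n ℕ.+ suc i)) ⊗ B (suc i) j (suc n)) ⊖
    ((α ⊗ α ^^ (n ℕ.+ suc j)) ⊗ A i (suc j) (suc n) ⊕ β ^^ (n ℕ.+ suc i) ⊗ B i (suc j) (suc n))
      ≡⟨ eq₃ α β (α ^^ (n ℕ.+ suc j)) (β ^^ (n ℕ.+ suc i))
           (A (suc i) j (suc n)) (A i (suc j) (suc n)) (B (suc i) j (suc n)) (B i (suc j) (suc n)) ⟩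
    α ^^ (n ℕ.+ suc j) ⊗ A (suc i) (suc j) n ⊕ β ^^ (n ℕ.+ suc i) ⊗ B (suc i) (suc j) n ∎
    where
    open ≡-Reasoning
    eq₁ : ∀ d x y → (d ⊗ x) ⊗ y ≡ x ⊗ (d ⊗ y)
    eq₁ = solve-∀ ring
    eq₂ : ∀ d x y → d ⊗ (x ⊖ y) ≡ d ⊗ x ⊖ d ⊗ y
    eq₂ = solve-∀ ring
    eq₃ : ∀ a b u v x y z w → (u ⊗ x ⊕ (b ⊗ v) ⊗ z) ⊖ ((a ⊗ u) ⊗ y ⊕ v ⊗ w) ≡
      u ⊗ (x ⊖ a ⊗ y) ⊕ v ⊗ (b ⊗ z ⊖ w)
    eq₃ = solve-∀ ring

  ιₙ-* : ∀ m n → ιₙ (m ℕ.* n) ≡ ιₙ m ⊗ ιₙ n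
  ιₙ-* m n = trans (cong ι (pos-* m n)) (ι-* (+ m) (+ n))

  private
    ιₙ-absorption : ∀ k n → ιₙ (suc n) ⊗ ιₙ (multichoose k (suc n)) ≡ ιₙ k ⊗ ιₙ (multichoose (suc k) n)
    ιₙ-absorption k n = trans (sym (ιₙ-* (suc n) _)) (trans (cong ιₙ (absorption k n)) (ιₙ-* k _))

  -- Differentiating the series of `L` gives (n + 1) L i j (n + 1) = i α L (i + 1) j n + j β L i (j
  -- + 1) n; this is the α-part of that identity under `partial-fractions`.
  A-contiguous : ∀ i j n →
    Δ ⊗ ιₙ (suc n) ⊗ A i j (suc n) ≡ ιₙ i ⊗ A (suc i) j n ⊕ ιₙ j ⊗ (β ⊗ A i (suc j) n)
  A-contiguous zero j n = eq (Δ ⊗ ιₙ (suc n)) (A 1 j n) (ιₙ j) β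
    where
    eq : ∀ x y z w → x ⊗ ι 0ℤ ≡ ι 0ℤ ⊗ y ⊕ z ⊗ (w ⊗ ι 0ℤ)
    eq = solve-∀ ring
  A-contiguous (suc i) zero n = begin
    Δ ⊗ ιₙ (suc n) ⊗ (Δ ^^ i ⊗ ιₙ (multichoose (suc i) (suc n)))
      ≡⟨ eq₁ Δ (ιₙ (suc n)) (Δ ^^ i) (ιₙ (multichoose (suc i) (suc n))) ⟩
    Δ ⊗ Δ ^^ i ⊗ (ιₙ (suc n) ⊗ ιₙ (multichoose (suc i) (suc n)))
      ≡⟨ cong (Δ ⊗ Δ ^^ i ⊗_) (ιₙ-absorption (suc i) n) ⟩
    Δ ⊗ Δ ^^ i ⊗ (ιₙ (suc i) ⊗ ιₙ (multichoose (2 ℕ.+ i) n))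
      ≡⟨ eq₂ (Δ ⊗ Δ ^^ i) (ιₙ (suc i)) (ιₙ (multichoose (2 ℕ.+ i) n)) (β ⊗ A (suc i) 1 n) ⟩
    ιₙ (suc i) ⊗ A (2 ℕ.+ i) 0 n ⊕ ι 0ℤ ⊗ (β ⊗ A (suc i) 1 n) ∎
    where
    open ≡-Reasoning
    eq₁ : ∀ d m e c → d ⊗ m ⊗ (e ⊗ c) ≡ d ⊗ e ⊗ (m ⊗ c)
    eq₁ = solve-∀ ring
    eq₂ : ∀ d m c x → d ⊗ (m ⊗ c) ≡ m ⊗ (d ⊗ c) ⊕ ι 0ℤ ⊗ x
    eq₂ = solve-∀ ring
  A-contiguous (suc i) (suc j) n = begin
    Δ ⊗ ιₙ (suc n) ⊗ (X ⊖ α ⊗ Y)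
      ≡⟨ eq₁ α β (ιₙ n) X Y ⟩
    Δ ⊗ (ι 1ℤ ⊕ ιₙ (suc n)) ⊗ X ⊖ α ⊗ (Δ ⊗ (ι 1ℤ ⊕ ιₙ (suc n)) ⊗ Y) ⊖ Δ ⊗ (X ⊖ α ⊗ Y)
      ≡⟨ cong₂ (λ u v → u ⊖ α ⊗ v ⊖ Δ ⊗ (X ⊖ α ⊗ Y)) (A-contiguous (suc i) j (suc n)) (A-contiguous i (suc j) (suc n)) ⟩
    ιₙ (suc i) ⊗ A (2 ℕ.+ i) j (suc n) ⊕ ιₙ j ⊗ (β ⊗ (X ⊖ α ⊗ Y))
      ⊖ α ⊗ (ιₙ i ⊗ (X ⊖ α ⊗ Y) ⊕ ιₙ (suc j) ⊗ (β ⊗ A i (2 ℕ.+ j) (suc n))) ⊖ Δ ⊗ (X ⊖ α ⊗ Y)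
      ≡⟨ eq₂ α β (ιₙ i) (ιₙ j) (X ⊖ α ⊗ Y) (A (2 ℕ.+ i) j (suc n)) (A i (2 ℕ.+ j) (suc n)) ⟩
    ιₙ (suc i) ⊗ A (2 ℕ.+ i) (suc j) n ⊕ ιₙ (suc j) ⊗ (β ⊗ A (suc i) (2 ℕ.+ j) n) ∎
    where
    open ≡-Reasoning
    X = A (suc i) j (2 ℕ.+ n)
    Y = A i (suc j) (2 ℕ.+ n)
    eq₁ : ∀ a b n x y → (a ⊖ b) ⊗ (ι 1ℤ ⊕ n) ⊗ (x ⊖ a ⊗ y) ≡
      (a ⊖ b) ⊗ (ι 1ℤ ⊕ (ι 1ℤ ⊕ n)) ⊗ x ⊖ a ⊗ ((a ⊖ b) ⊗ (ι 1ℤ ⊕ (ι 1ℤ ⊕ n)) ⊗ y) ⊖ (a ⊖ b) ⊗ (x ⊖ a ⊗ y)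
    eq₁ = solve-∀ ring
    eq₂ : ∀ a b i j z u v →
      (ι 1ℤ ⊕ i) ⊗ u ⊕ j ⊗ (b ⊗ z) ⊖ a ⊗ (i ⊗ z ⊕ (ι 1ℤ ⊕ j) ⊗ (b ⊗ v)) ⊖ (a ⊖ b) ⊗ z ≡
      (ι 1ℤ ⊕ i) ⊗ (u ⊖ a ⊗ z) ⊕ (ι 1ℤ ⊕ j) ⊗ (b ⊗ (z ⊖ a ⊗ v))
    eq₂ = solve-∀ ring

  -- The β-part of the differentiated series, as in `A-contiguous`.
  B-contiguous : ∀ i j n →
    Δ ⊗ ιₙ (suc n) ⊗ B i j (suc n) ≡ ιₙ i ⊗ (α ⊗ B (suc i) j n) ⊕ ιₙ j ⊗ B i (suc j) n
  B-contiguous zero zero n = eq (Δ ⊗ ιₙ (suc n)) α (B 0 1 n)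
    where
    eq : ∀ x y z → x ⊗ ι 0ℤ ≡ ι 0ℤ ⊗ (y ⊗ ι 0ℤ) ⊕ ι 0ℤ ⊗ z
    eq = solve-∀ ring
  B-contiguous (suc i) zero n = eq (Δ ⊗ ιₙ (suc n)) (ιₙ (suc i)) α (B (suc i) 1 n)
    where
    eq : ∀ x m y z → x ⊗ ι 0ℤ ≡ m ⊗ (y ⊗ ι 0ℤ) ⊕ ι 0ℤ ⊗ z
    eq = solve-∀ ring
  B-contiguous zero (suc j) n = begin
    Δ ⊗ ιₙ (suc n) ⊗ (Δ ^^ j ⊗ ιₙ (multichoose (suc j) (suc n)))
      ≡⟨ eq₁ Δ (ιₙ (suc n)) (Δ ^^ j) (ιₙ (multichoose (suc j) (suc n))) ⟩
    Δ ⊗ Δ ^^ j ⊗ (ιₙ (suc n) ⊗ ιₙ (multichoose (suc j) (suc n)))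
      ≡⟨ cong (Δ ⊗ Δ ^^ j ⊗_) (ιₙ-absorption (suc j) n) ⟩
    Δ ⊗ Δ ^^ j ⊗ (ιₙ (suc j) ⊗ ιₙ (multichoose (2 ℕ.+ j) n))
      ≡⟨ eq₂ (Δ ⊗ Δ ^^ j) (ιₙ (suc j)) (ιₙ (multichoose (2 ℕ.+ j) n)) (α ⊗ B 1 (suc j) n) ⟩
    ι 0ℤ ⊗ (α ⊗ B 1 (suc j) n) ⊕ ιₙ (suc j) ⊗ B 0 (2 ℕ.+ j) n ∎
    where
    open ≡-Reasoning
    eq₁ : ∀ d m e c → d ⊗ m ⊗ (e ⊗ c) ≡ d ⊗ e ⊗ (m ⊗ c)
    eq₁ = solve-∀ ring
    eq₂ : ∀ d m c x → d ⊗ (m ⊗ c) ≡ ι 0ℤ ⊗ x ⊕ m ⊗ (d ⊗ c)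
    eq₂ = solve-∀ ring
  B-contiguous (suc i) (suc j) n = begin
    Δ ⊗ ιₙ (suc n) ⊗ (β ⊗ X ⊖ Y)
      ≡⟨ eq₁ α β (ιₙ n) X Y ⟩
    β ⊗ (Δ ⊗ (ι 1ℤ ⊕ ιₙ (suc n)) ⊗ X) ⊖ Δ ⊗ (ι 1ℤ ⊕ ιₙ (suc n)) ⊗ Y ⊖ Δ ⊗ (β ⊗ X ⊖ Y)
      ≡⟨ cong₂ (λ u v → β ⊗ u ⊖ v ⊖ Δ ⊗ (β ⊗ X ⊖ Y)) (B-contiguous (suc i) j (suc n)) (B-contiguous i (suc j) (suc n)) ⟩
    β ⊗ (ιₙ (suc i) ⊗ (α ⊗ B (2 ℕ.+ i) j (suc n)) ⊕ ιₙ j ⊗ (β ⊗ X ⊖ Y))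
      ⊖ (ιₙ i ⊗ (α ⊗ (β ⊗ X ⊖ Y)) ⊕ ιₙ (suc j) ⊗ B i (2 ℕ.+ j) (suc n)) ⊖ Δ ⊗ (β ⊗ X ⊖ Y)
      ≡⟨ eq₂ α β (ιₙ i) (ιₙ j) (β ⊗ X ⊖ Y) (B (2 ℕ.+ i) j (suc n)) (B i (2 ℕ.+ j) (suc n)) ⟩
    ιₙ (suc i) ⊗ (α ⊗ B (2 ℕ.+ i) (suc j) n) ⊕ ιₙ (suc j) ⊗ B (suc i) (2 ℕ.+ j) n ∎
    where
    open ≡-Reasoning
    X = B (suc i) j (2 ℕ.+ n)
    Y = B i (suc j) (2 ℕ.+ n)
    eq₁ : ∀ a b n x y → (a ⊖ b) ⊗ (ι 1ℤ ⊕ n) ⊗ (b ⊗ x ⊖ y) ≡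
      b ⊗ ((a ⊖ b) ⊗ (ι 1ℤ ⊕ (ι 1ℤ ⊕ n)) ⊗ x) ⊖ (a ⊖ b) ⊗ (ι 1ℤ ⊕ (ι 1ℤ ⊕ n)) ⊗ y ⊖ (a ⊖ b) ⊗ (b ⊗ x ⊖ y)
    eq₁ = solve-∀ ring
    eq₂ : ∀ a b i j z u v →
      b ⊗ ((ι 1ℤ ⊕ i) ⊗ (a ⊗ u) ⊕ j ⊗ z) ⊖ (i ⊗ (a ⊗ z) ⊕ (ι 1ℤ ⊕ j) ⊗ v) ⊖ (a ⊖ b) ⊗ z ≡
      (ι 1ℤ ⊕ i) ⊗ (a ⊗ (b ⊗ u ⊖ z)) ⊕ (ι 1ℤ ⊕ j) ⊗ (b ⊗ z ⊖ v)
    eq₂ = solve-∀ ring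

  -- This determinant never vanishes, so two neighbouring approximants cannot both degenerate.
  W : ℕ → ℕ → ℕ → O
  W i j n = A (suc i) j n ⊗ B i (suc j) n ⊖ α ⊗ β ⊗ A i (suc j) n ⊗ B (suc i) j n

  -- The recursions of `A` and `B` bring in the indices (i + 1, j + 1, n) and (i + 1, j, n + 1), the
  -- neighbours compared in `G-nonvanishing`.
  W-diagonal : ∀ i j n → W i j (suc n) ≡
    A (suc i) (suc j) n ⊗ (β ⊗ B (suc i) j (suc n)) ⊖ A (suc i) j (suc n) ⊗ B (suc i) (suc j) n
  W-diagonal i j n = eq α β (A (suc i) j (suc n)) (A i (suc j) (suc n)) (B (suc i) j (suc n)) (B i (suc j) (suc n))
    where
    eq : ∀ a b x y z w → x ⊗ w ⊖ a ⊗ b ⊗ y ⊗ z ≡ (x ⊖ a ⊗ y) ⊗ (b ⊗ z) ⊖ x ⊗ (b ⊗ z ⊖ w)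
    eq = solve-∀ ring

  -- The contiguous relations act on the determinant as row operations: they replace one of its two
  -- approximants by one at n + 1, and `W-diagonal` recognises the result. Repetition leads down to
  -- `W 0 0`, which is 1.
  W-sucˡ : ∀ i j n → ιₙ (suc i) ⊗ W (suc i) j n ≡ ⊝ (Δ ⊗ ιₙ (suc n) ⊗ W i j (suc n))
  W-sucˡ i j n = begin
    I ⊗ (A₂₀ ⊗ B₁₁ ⊖ α ⊗ β ⊗ A₁₁ ⊗ B₂₀)
      ≡⟨ eq₁ α β I J A₂₀ A₁₁ B₂₀ B₁₁ ⟩
    (I ⊗ A₂₀ ⊕ J ⊗ (β ⊗ A₁₁)) ⊗ B₁₁ ⊖ β ⊗ A₁₁ ⊗ (I ⊗ (α ⊗ B₂₀) ⊕ J ⊗ B₁₁)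
      ≡⟨ cong₂ (λ x y → x ⊗ B₁₁ ⊖ β ⊗ A₁₁ ⊗ y) (A-contiguous (suc i) j n) (B-contiguous (suc i) j n) ⟨
    (Δ ⊗ ιₙ (suc n) ⊗ A (suc i) j (suc n)) ⊗ B₁₁ ⊖ β ⊗ A₁₁ ⊗ (Δ ⊗ ιₙ (suc n) ⊗ B (suc i) j (suc n))
      ≡⟨ eq₂ (Δ ⊗ ιₙ (suc n)) β (A (suc i) j (suc n)) A₁₁ (B (suc i) j (suc n)) B₁₁ ⟩
    ⊝ (Δ ⊗ ιₙ (suc n) ⊗ (A₁₁ ⊗ (β ⊗ B (suc i) j (suc n)) ⊖ A (suc i) j (suc n) ⊗ B₁₁))
      ≡⟨ cong (λ x → ⊝ (Δ ⊗ ιₙ (suc n) ⊗ x)) (W-diagonal i j n) ⟨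
    ⊝ (Δ ⊗ ιₙ (suc n) ⊗ W i j (suc n)) ∎
    where
    open ≡-Reasoning
    I = ιₙ (suc i)
    J = ιₙ j
    A₂₀ = A (2 ℕ.+ i) j n
    A₁₁ = A (suc i) (suc j) n
    B₂₀ = B (2 ℕ.+ i) j n
    B₁₁ = B (suc i) (suc j) n
    eq₁ : ∀ a b i j x y z w → i ⊗ (x ⊗ w ⊖ a ⊗ b ⊗ y ⊗ z) ≡
      (i ⊗ x ⊕ j ⊗ (b ⊗ y)) ⊗ w ⊖ b ⊗ y ⊗ (i ⊗ (a ⊗ z) ⊕ j ⊗ w)
    eq₁ = solve-∀ ring
    eq₂ : ∀ d b x y z w → (d ⊗ x) ⊗ w ⊖ b ⊗ y ⊗ (d ⊗ z) ≡ ⊝ (d ⊗ (y ⊗ (b ⊗ z) ⊖ x ⊗ w))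
    eq₂ = solve-∀ ring

  W-sucʳ : ∀ i j n → ιₙ (suc j) ⊗ W i (suc j) n ≡ Δ ⊗ ιₙ (suc n) ⊗ W i j (suc n)
  W-sucʳ i j n = begin
    J ⊗ (A₁₁ ⊗ B₀₂ ⊖ α ⊗ β ⊗ A₀₂ ⊗ B₁₁)
      ≡⟨ eq₁ α β I J A₁₁ A₀₂ B₁₁ B₀₂ ⟩
    A₁₁ ⊗ (I ⊗ (α ⊗ B₁₁) ⊕ J ⊗ B₀₂) ⊖ α ⊗ (I ⊗ A₁₁ ⊕ J ⊗ (β ⊗ A₀₂)) ⊗ B₁₁
      ≡⟨ cong₂ (λ x y → A₁₁ ⊗ x ⊖ α ⊗ y ⊗ B₁₁) (B-contiguous i (suc j) n) (A-contiguous i (suc j) n) ⟨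
    A₁₁ ⊗ (Δ ⊗ ιₙ (suc n) ⊗ B₀₁) ⊖ α ⊗ (Δ ⊗ ιₙ (suc n) ⊗ A₀₁) ⊗ B₁₁
      ≡⟨ eq₂ α β (Δ ⊗ ιₙ (suc n)) (A (suc i) j (suc n)) A₀₁ (B (suc i) j (suc n)) B₀₁ ⟩
    Δ ⊗ ιₙ (suc n) ⊗ W i j (suc n) ∎
    where
    open ≡-Reasoning
    I = ιₙ i
    J = ιₙ (suc j)
    A₁₁ = A (suc i) (suc j) n
    A₀₂ = A i (2 ℕ.+ j) n
    A₀₁ = A i (suc j) (suc n)
    B₁₁ = B (suc i) (suc j) n
    B₀₂ = B i (2 ℕ.+ j) n
    B₀₁ = B i (suc j) (suc n)
    eq₁ : ∀ a b i j x y z w → j ⊗ (x ⊗ w ⊖ a ⊗ b ⊗ y ⊗ z) ≡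
      x ⊗ (i ⊗ (a ⊗ z) ⊕ j ⊗ w) ⊖ a ⊗ (i ⊗ x ⊕ j ⊗ (b ⊗ y)) ⊗ z
    eq₁ = solve-∀ ring
    eq₂ : ∀ a b d x y z w → (x ⊖ a ⊗ y) ⊗ (d ⊗ w) ⊖ a ⊗ (d ⊗ y) ⊗ (b ⊗ z ⊖ w) ≡ d ⊗ (x ⊗ w ⊖ a ⊗ b ⊗ y ⊗ z)
    eq₂ = solve-∀ ring

  W-zero : ∀ n → W 0 0 n ≡ ι 1ℤ
  W-zero n = begin
    (ι 1ℤ ⊗ ιₙ (multichoose 1 n)) ⊗ (ι 1ℤ ⊗ ιₙ (multichoose 1 n)) ⊖ α ⊗ β ⊗ ι 0ℤ ⊗ ι 0ℤ
      ≡⟨ cong (λ c → (ι 1ℤ ⊗ ιₙ c) ⊗ (ι 1ℤ ⊗ ιₙ c) ⊖ α ⊗ β ⊗ ι 0ℤ ⊗ ι 0ℤ) (multichoose-1 n) ⟩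
    (ι 1ℤ ⊗ ι 1ℤ) ⊗ (ι 1ℤ ⊗ ι 1ℤ) ⊖ α ⊗ β ⊗ ι 0ℤ ⊗ ι 0ℤ
      ≡⟨ eq (α ⊗ β) ⟩
    ι 1ℤ ∎
    where
    open ≡-Reasoning
    eq : ∀ x → (ι 1ℤ ⊗ ι 1ℤ) ⊗ (ι 1ℤ ⊗ ι 1ℤ) ⊖ x ⊗ ι 0ℤ ⊗ ι 0ℤ ≡ ι 1ℤ
    eq = solve-∀ ring
    multichoose-1 : ∀ n → multichoose 1 n ≡ 1
    multichoose-1 zero = refl
    multichoose-1 (suc n) = multichoose-1 n

  -- The left-hand side has norm at least Q ^ q unless it vanishes, while the right-hand side turns out to be small.
  eliminate : ∀ {q} ε i j {k} n δ → n ℕ.+ j ≡ q → n ℕ.+ i ≡ q ℕ.+ δ → i ℕ.+ j ≡ suc k → U q ≡ ε →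
    β ^^ q ⊗ (A i j n ⊕ β ^^ δ ⊗ B i j n) ≡ Δ ^^ k ⊗ L i j n ⊖ ι ε ⊗ Δ ⊗ A i j n
  eliminate {q} ε i j {k} n δ refl n+i≡q+δ i+j≡1+k refl = begin
    β ^^ q ⊗ (A i j n ⊕ β ^^ δ ⊗ B i j n)
      ≡⟨ eq (α ^^ q) (β ^^ q) (β ^^ δ) (A i j n) (B i j n) ⟩
    α ^^ q ⊗ A i j n ⊕ (β ^^ q ⊗ β ^^ δ) ⊗ B i j n ⊖ (α ^^ q ⊖ β ^^ q) ⊗ A i j n
      ≡⟨ cong₂ (λ x y → α ^^ q ⊗ A i j n ⊕ x ⊗ B i j n ⊖ y ⊗ A i j n) (sym β^[n+i]) (Binet q) ⟩
    α ^^ q ⊗ A i j n ⊕ β ^^ (n ℕ.+ i) ⊗ B i j n ⊖ ι (U q) ⊗ Δ ⊗ A i j n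
      ≡⟨ cong (_⊖ ι (U q) ⊗ Δ ⊗ A i j n) (partial-fractions i j n i+j≡1+k) ⟨
    Δ ^^ k ⊗ L i j n ⊖ ι (U q) ⊗ Δ ⊗ A i j n ∎
    where
    open ≡-Reasoning
    eq : ∀ u v w x y → v ⊗ (x ⊕ w ⊗ y) ≡ u ⊗ x ⊕ (v ⊗ w) ⊗ y ⊖ (u ⊖ v) ⊗ x
    eq = solve-∀ ring
    β^[n+i] : β ^^ (n ℕ.+ i) ≡ β ^^ q ⊗ β ^^ δ
    β^[n+i] = trans (cong (β ^^_) n+i≡q+δ) (^^-+ β q δ)

  ^^-* : ∀ x m n → x ^^ (m ℕ.* n) ≡ (x ^^ m) ^^ n
  ^^-* x m zero = cong (x ^^_) (ℕ.*-zeroʳ m)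
  ^^-* x m (suc n) = trans (cong (x ^^_) (ℕ.*-suc m n)) (trans (^^-+ x m (m ℕ.* n)) (cong (x ^^ m ⊗_) (^^-* x m n)))

  im : O → ℤ
  im (a +α b) = b

  im-⊕ : ∀ x y → im (x ⊕ y) ≡ im x + im y
  im-⊕ (a +α b) (c +α d) = refl

  im-ι⊗ : ∀ n x → im (ι n ⊗ x) ≡ n * im x
  im-ι⊗ n (a +α b) = eq P n a b
    where
    eq : ∀ P n a b → n * b + 0ℤ * a + 0ℤ * b * P ≡ n * b
    eq = ℤ-Solver.solve-∀

  α^^ : ∀ n → α ^^ suc n ≡ - (Q * U n) +α U (suc n)
  α^^ zero = cong₂ _+α_ (eq₁ Q) (eq₂ P)
    where
    eq₁ : ∀ Q → 0ℤ * 1ℤ - 1ℤ * 0ℤ * Q ≡ - (Q * 0ℤ)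
    eq₁ = ℤ-Solver.solve-∀
    eq₂ : ∀ P → 0ℤ * 0ℤ + 1ℤ * 1ℤ + 1ℤ * 0ℤ * P ≡ 1ℤ
    eq₂ = ℤ-Solver.solve-∀
  α^^ (suc n) = trans (cong (α ⊗_) (α^^ n)) (cong₂ _+α_ (eq₁ Q (U n) (U (suc n))) (eq₂ P Q (U n) (U (suc n))))
    where
    eq₁ : ∀ Q u v → 0ℤ * - (Q * u) - 1ℤ * v * Q ≡ - (Q * v)
    eq₁ = ℤ-Solver.solve-∀
    eq₂ : ∀ P Q u v → 0ℤ * v + 1ℤ * - (Q * u) + 1ℤ * v * P ≡ P * v - Q * u
    eq₂ = ℤ-Solver.solve-∀

  im-α^^ : ∀ n → im (α ^^ n) ≡ U n
  im-α^^ zero = refl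
  im-α^^ (suc n) = cong im (α^^ n)

  -- The binomial coefficient (n choose 2). It is a multiple of n when n is odd, which `lift` needs.
  triangular : ℕ → ℕ
  triangular zero = 0
  triangular (suc n) = triangular n ℕ.+ n

  binomial₁ : ∀ m γ t → ∃ λ w → (ι 1ℤ ⊕ ι m ⊗ γ) ^^ t ≡ ι 1ℤ ⊕ ι m ⊗ (ιₙ t ⊗ γ ⊕ ι m ⊗ w)
  binomial₁ m γ zero = ι 0ℤ , eq (ι m) γ
    where
    eq : ∀ m g → ι 1ℤ ≡ ι 1ℤ ⊕ m ⊗ (ι 0ℤ ⊗ g ⊕ m ⊗ ι 0ℤ)
    eq = solve-∀ ring
  binomial₁ m γ (suc t) with binomial₁ m γ t
  ... | w , IH = w ⊕ γ ⊗ (ιₙ t ⊗ γ ⊕ ι m ⊗ w) ,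
    trans (cong ((ι 1ℤ ⊕ ι m ⊗ γ) ⊗_) IH) (eq (ι m) γ (ιₙ t) w)
    where
    eq : ∀ m g t w → (ι 1ℤ ⊕ m ⊗ g) ⊗ (ι 1ℤ ⊕ m ⊗ (t ⊗ g ⊕ m ⊗ w)) ≡
      ι 1ℤ ⊕ m ⊗ ((ι 1ℤ ⊕ t) ⊗ g ⊕ m ⊗ (w ⊕ g ⊗ (t ⊗ g ⊕ m ⊗ w)))
    eq = solve-∀ ring

  -- `binomial₁` suffices to compare two values of `U`; for an ℓ-th power the quadratic term is
  -- needed exactly, because it has to be seen to gain a factor ℓ.
  binomial₂ : ∀ m γ t → ∃ λ w →
    (ι 1ℤ ⊕ ι m ⊗ γ) ^^ t ≡ ι 1ℤ ⊕ ι m ⊗ (ιₙ t ⊗ γ ⊕ ι m ⊗ (ιₙ (triangular t) ⊗ (γ ⊗ γ) ⊕ ι m ⊗ w))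
  binomial₂ m γ zero = ι 0ℤ , eq (ι m) γ
    where
    eq : ∀ m g → ι 1ℤ ≡ ι 1ℤ ⊕ m ⊗ (ι 0ℤ ⊗ g ⊕ m ⊗ (ι 0ℤ ⊗ (g ⊗ g) ⊕ m ⊗ ι 0ℤ))
    eq = solve-∀ ring
  binomial₂ m γ (suc t) with binomial₂ m γ t
  ... | w , IH = w ⊕ γ ⊗ (ιₙ (triangular t) ⊗ (γ ⊗ γ) ⊕ ι m ⊗ w) ,
    trans (cong ((ι 1ℤ ⊕ ι m ⊗ γ) ⊗_) IH) (eq (ι m) γ (ιₙ t) (ιₙ (triangular t)) w)
    where
    eq : ∀ m g t u w → (ι 1ℤ ⊕ m ⊗ g) ⊗ (ι 1ℤ ⊕ m ⊗ (t ⊗ g ⊕ m ⊗ (u ⊗ (g ⊗ g) ⊕ m ⊗ w))) ≡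
      ι 1ℤ ⊕ m ⊗ ((ι 1ℤ ⊕ t) ⊗ g ⊕ m ⊗ ((u ⊕ t) ⊗ (g ⊗ g) ⊕ m ⊗ (w ⊕ g ⊗ (u ⊗ (g ⊗ g) ⊕ m ⊗ w))))
    eq = solve-∀ ring

  -- The shape of `binomial₂` at t = ℓ: the linear and the quadratic coefficient contain ℓ and the
  -- remainder carries (m₁ ℓ)³, so everything beyond γ has one more factor ℓ.
  lift-factor : ∀ ℓ h m₁ γ w →
    ι 1ℤ ⊕ ι m₁ ⊗ ι ℓ ⊗ (ι ℓ ⊗ γ ⊕ ι m₁ ⊗ ι ℓ ⊗ (ι h ⊗ ι ℓ ⊗ (γ ⊗ γ) ⊕ ι m₁ ⊗ ι ℓ ⊗ w)) ≡
    ι 1ℤ ⊕ ι m₁ ⊗ ι ℓ ⊗ ι ℓ ⊗ (γ ⊕ ι ℓ ⊗ (ι m₁ ⊗ (ι h ⊗ (γ ⊗ γ) ⊕ ι m₁ ⊗ w)))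
  lift-factor ℓ h m₁ γ w = eq (ι ℓ) (ι h) (ι m₁) γ w
    where
    eq : ∀ l h m g w → ι 1ℤ ⊕ m ⊗ l ⊗ (l ⊗ g ⊕ m ⊗ l ⊗ (h ⊗ l ⊗ (g ⊗ g) ⊕ m ⊗ l ⊗ w)) ≡
      ι 1ℤ ⊕ m ⊗ l ⊗ l ⊗ (g ⊕ l ⊗ (m ⊗ (h ⊗ (g ⊗ g) ⊕ m ⊗ w)))
    eq = solve-∀ ring

  expand₁ : ∀ a m x → a ⊗ (ι 1ℤ ⊕ m ⊗ x) ≡ a ⊕ m ⊗ (a ⊗ x)
  expand₁ = solve-∀ ring

  expand₂ : ∀ a t x m w → a ⊗ (t ⊗ x ⊕ m ⊗ w) ≡ t ⊗ (a ⊗ x) ⊕ m ⊗ (a ⊗ w)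
  expand₂ = solve-∀ ring

  expand₃ : ∀ a x l y → a ⊗ (x ⊕ l ⊗ y) ≡ a ⊗ x ⊕ l ⊗ (a ⊗ y)
  expand₃ = solve-∀ ring

  tr : O → ℤ
  tr (a +α b) = + 2 * a + b * P

  conj-⊗ : ∀ x y → conj (x ⊗ y) ≡ conj x ⊗ conj y
  conj-⊗ (a +α b) (c +α d) = cong₂ _+α_ (eq₁ P Q a b c d) (eq₂ P a b c d)
    where
    eq₁ : ∀ P Q a b c d → a * c - b * d * Q + (a * d + b * c + b * d * P) * P ≡
      (a + b * P) * (c + d * P) - - b * - d * Q
    eq₁ = ℤ-Solver.solve-∀
    eq₂ : ∀ P a b c d → - (a * d + b * c + b * d * P) ≡ (a + b * P) * - d + - b * (c + d * P) + - b * - d * P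
    eq₂ = ℤ-Solver.solve-∀

  ⊗-conj : ∀ x → x ⊗ conj x ≡ ι (Nm x)
  ⊗-conj (a +α b) = cong₂ _+α_ (eq₁ P Q a b) (eq₂ P a b)
    where
    eq₁ : ∀ P Q a b → a * (a + b * P) - b * - b * Q ≡ a * a + a * b * P + b * b * Q
    eq₁ = ℤ-Solver.solve-∀
    eq₂ : ∀ P a b → a * - b + b * (a + b * P) + b * - b * P ≡ 0ℤ
    eq₂ = ℤ-Solver.solve-∀

  conj-α : conj α ≡ β
  conj-α = cong (_+α -1ℤ) (eq P)
    where
    eq : ∀ P → 0ℤ + 1ℤ * P ≡ P
    eq = ℤ-Solver.solve-∀

  Nm-α : Nm α ≡ Q
  Nm-α = eq P Q
    where
    eq : ∀ P Q → 0ℤ * 0ℤ + 0ℤ * 1ℤ * P + 1ℤ * 1ℤ * Q ≡ Q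
    eq = ℤ-Solver.solve-∀

  characteristic : ∀ x → x ⊗ x ≡ ι (tr x) ⊗ x ⊖ ι (Nm x)
  characteristic (a +α b) = cong₂ _+α_ (eq₁ P Q a b) (eq₂ P a b)
    where
    eq₁ : ∀ P Q a b → a * a - b * b * Q ≡ (+ 2 * a + b * P) * a - 0ℤ * b * Q + - (a * a + a * b * P + b * b * Q)
    eq₁ = ℤ-Solver.solve-∀
    eq₂ : ∀ P a b → a * b + b * a + b * b * P ≡ (+ 2 * a + b * P) * b + 0ℤ * a + 0ℤ * b * P + 0ℤ
    eq₂ = ℤ-Solver.solve-∀

  power-recurrence : ∀ x u → x ⊗ (x ⊗ u) ≡ ι (tr x) ⊗ (x ⊗ u) ⊖ ι (Nm x) ⊗ u
  power-recurrence x u = trans (sym (⊗-assoc x x u)) (trans (cong (_⊗ u) (characteristic x)) (eq (ι (tr x)) (ι (Nm x)) x u))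
    where
    eq : ∀ t n x u → (t ⊗ x ⊖ n) ⊗ u ≡ t ⊗ (x ⊗ u) ⊖ n ⊗ u
    eq = solve-∀ ring

  ^^-distrib : ∀ x y n → (x ⊗ y) ^^ n ≡ x ^^ n ⊗ y ^^ n
  ^^-distrib x y zero = sym (⊗-identityˡ (ι 1ℤ))
  ^^-distrib x y (suc n) = trans (cong (x ⊗ y ⊗_) (^^-distrib x y n)) (eq x y (x ^^ n) (y ^^ n))
    where
    eq : ∀ x y u v → x ⊗ y ⊗ (u ⊗ v) ≡ x ⊗ u ⊗ (y ⊗ v)
    eq = solve-∀ ring

  1^^ : ∀ n → ι 1ℤ ^^ n ≡ ι 1ℤ
  1^^ zero = refl
  1^^ (suc n) = trans (⊗-identityˡ (ι 1ℤ ^^ n)) (1^^ n)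

  -- Gauss's lemma: g divides a and d′ divides b, so g is coprime to d′.
  coprime-divides : ∀ {a b g d₁ c d d′ w u v} → g ⊗ d₁ ≡ a → c ⊗ d′ ≡ b → a ⊗ u ⊕ b ⊗ u ⊕ a ⊗ b ⊗ v ≡ ι 1ℤ →
    d ⊗ d′ ≡ g ⊗ w → ∃ λ e → d ≡ g ⊗ e
  coprime-divides {g = g} {d₁} {c} {d} {d′} {w} {u} {v} refl refl bezout dd′≡gw =
    d₁ ⊗ u ⊗ d ⊕ c ⊗ (u ⊕ g ⊗ d₁ ⊗ v) ⊗ w , (begin
      d
        ≡⟨ ⊗-identityˡ d ⟨
      ι 1ℤ ⊗ d
        ≡⟨ cong (_⊗ d) bezout ⟨
      (g ⊗ d₁ ⊗ u ⊕ c ⊗ d′ ⊗ u ⊕ g ⊗ d₁ ⊗ (c ⊗ d′) ⊗ v) ⊗ d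
        ≡⟨ eq₁ g d₁ c d d′ u v ⟩
      g ⊗ (d₁ ⊗ u ⊗ d) ⊕ c ⊗ (u ⊕ g ⊗ d₁ ⊗ v) ⊗ (d ⊗ d′)
        ≡⟨ cong (λ z → g ⊗ (d₁ ⊗ u ⊗ d) ⊕ c ⊗ (u ⊕ g ⊗ d₁ ⊗ v) ⊗ z) dd′≡gw ⟩
      g ⊗ (d₁ ⊗ u ⊗ d) ⊕ c ⊗ (u ⊕ g ⊗ d₁ ⊗ v) ⊗ (g ⊗ w)
        ≡⟨ eq₂ g d₁ c d w u v ⟩
      g ⊗ (d₁ ⊗ u ⊗ d ⊕ c ⊗ (u ⊕ g ⊗ d₁ ⊗ v) ⊗ w) ∎)
    where
    open ≡-Reasoning
    eq₁ : ∀ g d₁ c d d′ u v → (g ⊗ d₁ ⊗ u ⊕ c ⊗ d′ ⊗ u ⊕ g ⊗ d₁ ⊗ (c ⊗ d′) ⊗ v) ⊗ d ≡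
      g ⊗ (d₁ ⊗ u ⊗ d) ⊕ c ⊗ (u ⊕ g ⊗ d₁ ⊗ v) ⊗ (d ⊗ d′)
    eq₁ = solve-∀ ring
    eq₂ : ∀ g d₁ c d w u v → g ⊗ (d₁ ⊗ u ⊗ d) ⊕ c ⊗ (u ⊕ g ⊗ d₁ ⊗ v) ⊗ (g ⊗ w) ≡
      g ⊗ (d₁ ⊗ u ⊗ d ⊕ c ⊗ (u ⊕ g ⊗ d₁ ⊗ v) ⊗ w)
    eq₂ = solve-∀ ring

  -- Here x³ = - t, hence x⁶ = t² = 1. With t = ± 1 these are the units of order 6 and 3 that occur
  -- for D = 3.
  sixth-power : ∀ x t → x ⊗ x ≡ t ⊗ x ⊖ ι 1ℤ → t ⊗ t ≡ ι 1ℤ → x ^^ 6 ≡ ι 1ℤ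
  sixth-power x t x²≡ t²≡1 = begin
    x ^^ 6                                              ≡⟨ eq₁ x ⟩
    (x ⊗ (x ⊗ x)) ⊗ (x ⊗ (x ⊗ x))                       ≡⟨ cong₂ _⊗_ cube cube ⟩
    ⊝ t ⊗ ⊝ t                                           ≡⟨ eq₂ t ⟩
    t ⊗ t                                               ≡⟨ t²≡1 ⟩
    ι 1ℤ                                                ∎
    where
    open ≡-Reasoning
    eq₁ : ∀ x → x ⊗ (x ⊗ (x ⊗ (x ⊗ (x ⊗ (x ⊗ ι 1ℤ))))) ≡ (x ⊗ (x ⊗ x)) ⊗ (x ⊗ (x ⊗ x))
    eq₁ = solve-∀ ring
    eq₂ : ∀ t → ⊝ t ⊗ ⊝ t ≡ t ⊗ t
    eq₂ = solve-∀ ring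
    eq₃ : ∀ x t → x ⊗ (t ⊗ x ⊖ ι 1ℤ) ≡ t ⊗ (x ⊗ x) ⊖ x
    eq₃ = solve-∀ ring
    eq₄ : ∀ x t → t ⊗ (t ⊗ x ⊖ ι 1ℤ) ⊖ x ≡ (t ⊗ t) ⊗ x ⊖ t ⊖ x
    eq₄ = solve-∀ ring
    eq₅ : ∀ x t → ι 1ℤ ⊗ x ⊖ t ⊖ x ≡ ⊝ t
    eq₅ = solve-∀ ring
    cube : x ⊗ (x ⊗ x) ≡ ⊝ t
    cube = trans (cong (x ⊗_) x²≡) (trans (eq₃ x t) (trans (cong (λ y → t ⊗ y ⊖ x) x²≡)
      (trans (eq₄ x t) (trans (cong (λ y → y ⊗ x ⊖ t ⊖ x) t²≡1) (eq₅ x t)))))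

  sixth : ∀ x → x ⊗ x ≡ ι 1ℤ → x ^^ 6 ≡ ι 1ℤ
  sixth x x²≡1 = trans (eq₁ x) (trans (cong (λ y → y ⊗ y ⊗ y) x²≡1) eq₂)
    where
    eq₁ : ∀ x → x ⊗ (x ⊗ (x ⊗ (x ⊗ (x ⊗ (x ⊗ ι 1ℤ))))) ≡ (x ⊗ x) ⊗ (x ⊗ x) ⊗ (x ⊗ x)
    eq₁ = solve-∀ ring
    eq₂ : ι 1ℤ ⊗ ι 1ℤ ⊗ ι 1ℤ ≡ ι 1ℤ
    eq₂ = trans (cong (_⊗ ι 1ℤ) (⊗-identityˡ (ι 1ℤ))) (⊗-identityˡ (ι 1ℤ))

-- Numerical inequalities for the two error terms

^-pos : ∀ m n → 0 < m → 0 < m ℕ.^ n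
^-pos m zero _ = ℕ.z<s
^-pos m (suc n) 0<m = ℕ.*-mono-< 0<m (^-pos m n 0<m)

*-cancelʳ-<′ : ∀ o {m n} → m ℕ.* o < n ℕ.* o → m < n
*-cancelʳ-<′ o {m} {n} = ℕ.*-cancelʳ-< o m n

*-monoˡ-<′ : ∀ o {m n} → 0 < o → m < n → o ℕ.* m < o ℕ.* n
*-monoˡ-<′ (suc o) _ = ℕ.*-monoʳ-< (suc o)

-- 3125 = 5⁵ is less than 5120 = 20 · 4⁴, so the inequality passes from one exponent to all later
-- ones.
geometric-< : ∀ {a b} k₀ t → a ℕ.* 3125 ℕ.^ k₀ < b ℕ.* 5120 ℕ.^ k₀ →
  a ℕ.* 3125 ℕ.^ (t ℕ.+ k₀) < b ℕ.* 5120 ℕ.^ (t ℕ.+ k₀)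
geometric-< k₀ zero h = h
geometric-< {a} {b} k₀ (suc t) h = begin-strict
  a ℕ.* (3125 ℕ.* 3125 ℕ.^ (t ℕ.+ k₀))   ≡⟨ eq a 3125 (3125 ℕ.^ (t ℕ.+ k₀)) ⟩
  3125 ℕ.* (a ℕ.* 3125 ℕ.^ (t ℕ.+ k₀))   ≤⟨ ℕ.*-monoˡ-≤ (a ℕ.* 3125 ℕ.^ (t ℕ.+ k₀)) (ℕ.≤ᵇ⇒≤ 3125 5120 tt) ⟩
  5120 ℕ.* (a ℕ.* 3125 ℕ.^ (t ℕ.+ k₀))   <⟨ ℕ.*-monoʳ-< 5120 (geometric-< {a} {b} k₀ t h) ⟩
  5120 ℕ.* (b ℕ.* 5120 ℕ.^ (t ℕ.+ k₀))   ≡⟨ eq b 5120 (5120 ℕ.^ (t ℕ.+ k₀)) ⟨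
  b ℕ.* (5120 ℕ.* 5120 ℕ.^ (t ℕ.+ k₀))   ∎
  where
  open ℕ.≤-Reasoning
  eq : ∀ a x y → a ℕ.* (x ℕ.* y) ≡ x ℕ.* (a ℕ.* y)
  eq = ℕ-Solver.solve-∀

^-linear : ∀ b a k u → b ℕ.^ (a ℕ.* k ℕ.+ u) ≡ (b ℕ.^ a) ℕ.^ k ℕ.* b ℕ.^ u
^-linear b a k u = trans (ℕ.^-distribˡ-+-* b (a ℕ.* k) u) (cong (ℕ._* b ℕ.^ u) (sym (ℕ.^-*-assoc b a k)))

-- The weights 1 and 4 in `multichoose-bound` fit the ratio of `n` to N - 1, which is about 1 : 4,
-- and give the growth (5⁵/4⁴)ᵏ. The parameters u, v and w absorb the deviations.
multichoose-< : ∀ k u v w {N n} → N ≡ suc (4 ℕ.* k ℕ.+ u) → n ℕ.+ (4 ℕ.* k ℕ.+ u) ≡ 5 ℕ.* k ℕ.+ v →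
  2 ℕ.* 5 ℕ.^ v ℕ.* 3125 ℕ.^ k < w ℕ.* 4 ℕ.^ u ℕ.* 5120 ℕ.^ k → 2 ℕ.* multichoose N n < w ℕ.* 20 ℕ.^ k
multichoose-< k u v w {n = n} refl n+K≡5k+v h = *-cancelʳ-<′ (256 ℕ.^ k ℕ.* 4 ℕ.^ u) (begin-strict
  2 ℕ.* c ℕ.* (256 ℕ.^ k ℕ.* 4 ℕ.^ u)
    ≡⟨ cong (2 ℕ.* c ℕ.*_) (^-linear 4 4 k u) ⟨
  2 ℕ.* c ℕ.* 4 ℕ.^ (4 ℕ.* k ℕ.+ u)
    ≡⟨ eq₁ c (4 ℕ.^ (4 ℕ.* k ℕ.+ u)) ⟩
  2 ℕ.* (c ℕ.* 1 ℕ.* 4 ℕ.^ (4 ℕ.* k ℕ.+ u))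
    ≡⟨ cong (λ x → 2 ℕ.* (c ℕ.* x ℕ.* 4 ℕ.^ (4 ℕ.* k ℕ.+ u))) (ℕ.^-zeroˡ n) ⟨
  2 ℕ.* (c ℕ.* 1 ℕ.^ n ℕ.* 4 ℕ.^ (4 ℕ.* k ℕ.+ u))
    ≤⟨ ℕ.*-monoʳ-≤ 2 (multichoose-bound 1 4 (4 ℕ.* k ℕ.+ u) n) ⟩
  2 ℕ.* 5 ℕ.^ (n ℕ.+ (4 ℕ.* k ℕ.+ u))
    ≡⟨ cong (λ m → 2 ℕ.* m) (trans (cong (5 ℕ.^_) n+K≡5k+v) (^-linear 5 5 k v)) ⟩
  2 ℕ.* (3125 ℕ.^ k ℕ.* 5 ℕ.^ v)
    ≡⟨ eq₂ (3125 ℕ.^ k) (5 ℕ.^ v) ⟩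
  2 ℕ.* 5 ℕ.^ v ℕ.* 3125 ℕ.^ k
    <⟨ h ⟩
  w ℕ.* 4 ℕ.^ u ℕ.* 5120 ℕ.^ k
    ≡⟨ cong (w ℕ.* 4 ℕ.^ u ℕ.*_) (^-distribʳ-* k 20 256) ⟩
  w ℕ.* 4 ℕ.^ u ℕ.* (20 ℕ.^ k ℕ.* 256 ℕ.^ k)
    ≡⟨ eq₃ w (4 ℕ.^ u) (20 ℕ.^ k) (256 ℕ.^ k) ⟩
  w ℕ.* 20 ℕ.^ k ℕ.* (256 ℕ.^ k ℕ.* 4 ℕ.^ u) ∎)
  where
  open ℕ.≤-Reasoning
  c = multichoose (suc (4 ℕ.* k ℕ.+ u)) n
  eq₁ : ∀ c x → 2 ℕ.* c ℕ.* x ≡ 2 ℕ.* (c ℕ.* 1 ℕ.* x)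
  eq₁ = ℕ-Solver.solve-∀
  eq₂ : ∀ x y → 2 ℕ.* (x ℕ.* y) ≡ 2 ℕ.* y ℕ.* x
  eq₂ = ℕ-Solver.solve-∀
  eq₃ : ∀ w x y z → w ℕ.* x ℕ.* (y ℕ.* z) ≡ w ℕ.* y ℕ.* (z ℕ.* x)
  eq₃ = ℕ-Solver.solve-∀

square-< : ∀ {c w k E} s → 2 ℕ.* c < w ℕ.* 20 ℕ.^ k → w ℕ.* w ≤ 20 ℕ.^ s → E ≡ 2 ℕ.* k ℕ.+ s →
  4 ℕ.* (c ℕ.* c) < 20 ℕ.^ E
square-< {c} {w} {k} s 2c<w20ᵏ w²≤20ˢ refl = begin-strict
  4 ℕ.* (c ℕ.* c)                            ≡⟨ eq₁ c ⟩
  2 ℕ.* c ℕ.* (2 ℕ.* c)                      <⟨ ℕ.*-mono-< 2c<w20ᵏ 2c<w20ᵏ ⟩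
  w ℕ.* 20 ℕ.^ k ℕ.* (w ℕ.* 20 ℕ.^ k)        ≡⟨ eq₂ w (20 ℕ.^ k) ⟩
  20 ℕ.^ k ℕ.* 20 ℕ.^ k ℕ.* (w ℕ.* w)        ≡⟨ cong (ℕ._* (w ℕ.* w)) (^-distribʳ-* k 20 20) ⟨
  (20 ℕ.^ 2) ℕ.^ k ℕ.* (w ℕ.* w)             ≤⟨ ℕ.*-monoʳ-≤ ((20 ℕ.^ 2) ℕ.^ k) w²≤20ˢ ⟩
  (20 ℕ.^ 2) ℕ.^ k ℕ.* 20 ℕ.^ s              ≡⟨ ^-linear 20 2 k s ⟨
  20 ℕ.^ (2 ℕ.* k ℕ.+ s)                     ∎
  where
  open ℕ.≤-Reasoning
  eq₁ : ∀ c → 4 ℕ.* (c ℕ.* c) ≡ 2 ℕ.* c ℕ.* (2 ℕ.* c)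
  eq₁ = ℕ-Solver.solve-∀
  eq₂ : ∀ w x → w ℕ.* x ℕ.* (w ℕ.* x) ≡ x ℕ.* x ℕ.* (w ℕ.* w)
  eq₂ = ℕ-Solver.solve-∀

-- Each unit of k brings 81⁵ · 4⁴ to the left and 64⁵ · Q to the right; the one remaining Q on the
-- right pays for D and for the offsets t and u.
growth-< : ∀ k t u {D Q X m E} → m ≡ 5 ℕ.* k ℕ.+ t → E ≡ 4 ℕ.* k ℕ.+ u → 832 ≤ Q →
  4 ℕ.* 81 ℕ.^ t ℕ.* 4 ℕ.^ u ℕ.* D < 64 ℕ.^ t ℕ.* Q → 0 < X →
  4 ℕ.* (D ℕ.* ((9 ℕ.^ m ℕ.* 2 ℕ.^ E) ℕ.* (9 ℕ.^ m ℕ.* 2 ℕ.^ E) ℕ.* X)) <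
  8 ℕ.^ m ℕ.* 8 ℕ.^ m ℕ.* (Q ℕ.* Q ℕ.^ k ℕ.* X)
growth-< k t u {D} {Q} {X} {m} {E} refl refl 832≤Q h 0<X = begin-strict
  4 ℕ.* (D ℕ.* ((9 ℕ.^ m ℕ.* 2 ℕ.^ E) ℕ.* (9 ℕ.^ m ℕ.* 2 ℕ.^ E) ℕ.* X))
    ≡⟨ eq₁ D (9 ℕ.^ m) (2 ℕ.^ E) X ⟩
  4 ℕ.* (9 ℕ.^ m ℕ.* 9 ℕ.^ m) ℕ.* (2 ℕ.^ E ℕ.* 2 ℕ.^ E) ℕ.* D ℕ.* X
    ≡⟨ cong₂ (λ x y → 4 ℕ.* x ℕ.* y ℕ.* D ℕ.* X) (trans (sym (^-distribʳ-* m 9 9)) (^-linear 81 5 k t)) (trans (sym (^-distribʳ-* E 2 2)) (^-linear 4 4 k u)) ⟩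
  4 ℕ.* ((81 ℕ.^ 5) ℕ.^ k ℕ.* 81 ℕ.^ t) ℕ.* (256 ℕ.^ k ℕ.* 4 ℕ.^ u) ℕ.* D ℕ.* X
    ≡⟨ eq₂ ((81 ℕ.^ 5) ℕ.^ k) (81 ℕ.^ t) (256 ℕ.^ k) (4 ℕ.^ u) D X ⟩
  ((81 ℕ.^ 5) ℕ.^ k ℕ.* 256 ℕ.^ k) ℕ.* (X ℕ.* (4 ℕ.* 81 ℕ.^ t ℕ.* 4 ℕ.^ u ℕ.* D))
    ≡⟨ cong (ℕ._* (X ℕ.* (4 ℕ.* 81 ℕ.^ t ℕ.* 4 ℕ.^ u ℕ.* D))) (^-distribʳ-* k (81 ℕ.^ 5) 256) ⟨
  (81 ℕ.^ 5 ℕ.* 256) ℕ.^ k ℕ.* (X ℕ.* (4 ℕ.* 81 ℕ.^ t ℕ.* 4 ℕ.^ u ℕ.* D))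
    ≤⟨ ℕ.*-monoˡ-≤ (X ℕ.* (4 ℕ.* 81 ℕ.^ t ℕ.* 4 ℕ.^ u ℕ.* D)) (ℕ.^-monoˡ-≤ k 81⁵4⁴≤64⁵Q) ⟩
  (64 ℕ.^ 5 ℕ.* Q) ℕ.^ k ℕ.* (X ℕ.* (4 ℕ.* 81 ℕ.^ t ℕ.* 4 ℕ.^ u ℕ.* D))
    <⟨ *-monoˡ-<′ _ (^-pos _ k (ℕ.*-mono-< (ℕ.<ᵇ⇒< 0 (64 ℕ.^ 5) tt) (ℕ.≤-trans (ℕ.≤ᵇ⇒≤ 1 832 tt) 832≤Q))) (*-monoˡ-<′ X 0<X h) ⟩
  (64 ℕ.^ 5 ℕ.* Q) ℕ.^ k ℕ.* (X ℕ.* (64 ℕ.^ t ℕ.* Q))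
    ≡⟨ cong (ℕ._* (X ℕ.* (64 ℕ.^ t ℕ.* Q))) (^-distribʳ-* k (64 ℕ.^ 5) Q) ⟩
  ((64 ℕ.^ 5) ℕ.^ k ℕ.* Q ℕ.^ k) ℕ.* (X ℕ.* (64 ℕ.^ t ℕ.* Q))
    ≡⟨ eq₃ ((64 ℕ.^ 5) ℕ.^ k) (Q ℕ.^ k) X (64 ℕ.^ t) Q ⟩
  (64 ℕ.^ 5) ℕ.^ k ℕ.* 64 ℕ.^ t ℕ.* (Q ℕ.* Q ℕ.^ k ℕ.* X)
    ≡⟨ cong (ℕ._* (Q ℕ.* Q ℕ.^ k ℕ.* X)) (trans (sym (^-linear 64 5 k t)) (^-distribʳ-* m 8 8)) ⟩
  8 ℕ.^ m ℕ.* 8 ℕ.^ m ℕ.* (Q ℕ.* Q ℕ.^ k ℕ.* X) ∎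
  where
  open ℕ.≤-Reasoning
  -- (81/64)⁵ · 4⁴ is about 831.3, whence the bound 832.
  81⁵4⁴≤64⁵Q : 81 ℕ.^ 5 ℕ.* 256 ≤ 64 ℕ.^ 5 ℕ.* Q
  81⁵4⁴≤64⁵Q = ℕ.≤-trans (ℕ.≤ᵇ⇒≤ (81 ℕ.^ 5 ℕ.* 256) (64 ℕ.^ 5 ℕ.* 832) tt) (ℕ.*-monoʳ-≤ (64 ℕ.^ 5) 832≤Q)
  eq₁ : ∀ D x y X → 4 ℕ.* (D ℕ.* ((x ℕ.* y) ℕ.* (x ℕ.* y) ℕ.* X)) ≡ 4 ℕ.* (x ℕ.* x) ℕ.* (y ℕ.* y) ℕ.* D ℕ.* X
  eq₁ = ℕ-Solver.solve-∀
  eq₂ : ∀ a b c d D X → 4 ℕ.* (a ℕ.* b) ℕ.* (c ℕ.* d) ℕ.* D ℕ.* X ≡ (a ℕ.* c) ℕ.* (X ℕ.* (4 ℕ.* b ℕ.* d ℕ.* D))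
  eq₂ = ℕ-Solver.solve-∀
  eq₃ : ∀ a b X c Q → (a ℕ.* b) ℕ.* (X ℕ.* (c ℕ.* Q)) ≡ a ℕ.* c ℕ.* (Q ℕ.* b ℕ.* X)
  eq₃ = ℕ-Solver.solve-∀

-- Norm estimates in imaginary quadratic rings

module Imaginary (P : ℤ) (Q D : ℕ) (0<D : 0 < D) (P²+D≡4Q : P * P + + D ≡ + 4 * + Q) where

  open QuadRing P (+ Q) public

  private
    D≡ : + D ≡ + 4 * + Q - P * P
    D≡ = trans (eq P (+ D)) (cong (_- P * P) P²+D≡4Q)
      where
      eq : ∀ P D → D ≡ P * P + D - P * P
      eq = ℤ-Solver.solve-∀

  square-nonneg : ∀ i → 0ℤ ℤ.≤ i * i
  square-nonneg (+ n) = subst (0ℤ ℤ.≤_) (pos-* n n) (+≤+ ℕ.z≤n)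
  square-nonneg -[1+ n ] = +≤+ ℕ.z≤n

  -- Completing the square exhibits the discriminant - D; with D positive, the norm form is positive
  -- definite.
  4Nm : ∀ a b → + 4 * Nm (a +α b) ≡ (+ 2 * a + b * P) * (+ 2 * a + b * P) + + D * (b * b)
  4Nm a b = trans (eq P (+ Q) a b) (cong (λ D → (+ 2 * a + b * P) * (+ 2 * a + b * P) + D * (b * b)) (sym D≡))
    where
    eq : ∀ P Q a b → + 4 * (a * a + a * b * P + b * b * Q) ≡
      (+ 2 * a + b * P) * (+ 2 * a + b * P) + (+ 4 * Q - P * P) * (b * b)
    eq = ℤ-Solver.solve-∀

  Nm-nonneg : ∀ x → 0ℤ ℤ.≤ Nm x
  Nm-nonneg (a +α b) = *-cancelˡ-≤-pos 0ℤ (Nm (a +α b)) (+ 4)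
    (subst (0ℤ ℤ.≤_) (sym (4Nm a b))
      (+-mono-≤ (square-nonneg (+ 2 * a + b * P)) (subst (ℤ._≤ + D * (b * b)) (*-zeroʳ (+ D)) (*-monoˡ-≤-nonNeg (+ D) (square-nonneg b)))))

  +∥∥ : ∀ x → + ∥ x ∥ ≡ Nm x
  +∥∥ x = 0≤i⇒+∣i∣≡i (Nm-nonneg x)

  ∥Δ∥ : ∥ Δ ∥ ≡ D
  ∥Δ∥ = cong ∣_∣ (trans (eq P (+ Q)) (sym D≡))
    where
    eq : ∀ P Q → (0ℤ + - P) * (0ℤ + - P) + (0ℤ + - P) * + 2 * P + + 2 * + 2 * Q ≡ + 4 * Q - P * P
    eq = ℤ-Solver.solve-∀

  private
    *-cancel-≡0 : ∀ i j → i ≢ 0ℤ → i * j ≡ 0ℤ → j ≡ 0ℤ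
    *-cancel-≡0 i j i≢0 ij≡0 = [ (λ i≡0 → contradiction i≡0 i≢0) , (λ j≡0 → j≡0) ]′ (i*j≡0⇒i≡0∨j≡0 i ij≡0)

    square≡0 : ∀ i → i * i ≡ 0ℤ → i ≡ 0ℤ
    square≡0 i i²≡0 = [ (λ i≡0 → i≡0) , (λ i≡0 → i≡0) ]′ (i*j≡0⇒i≡0∨j≡0 i i²≡0)

    nonneg-sum≡0 : ∀ {i j} → 0ℤ ℤ.≤ i → 0ℤ ℤ.≤ j → i + j ≡ 0ℤ → i ≡ 0ℤ × j ≡ 0ℤ
    nonneg-sum≡0 {+ m} {+ n} _ _ i+j≡0 =
      cong +_ (ℕ.m+n≡0⇒m≡0 m (+-injective i+j≡0)) , cong +_ (ℕ.m+n≡0⇒n≡0 m (+-injective i+j≡0))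

  ∥x∥≡0⇒x≡0 : ∀ x → ∥ x ∥ ≡ 0 → x ≡ ι 0ℤ
  ∥x∥≡0⇒x≡0 (a +α b) ∥x∥≡0 = cong₂ _+α_ a≡0 b≡0
    where
    sum≡0 : (+ 2 * a + b * P) * (+ 2 * a + b * P) + + D * (b * b) ≡ 0ℤ
    sum≡0 = trans (sym (4Nm a b)) (cong (+ 4 *_) (∣i∣≡0⇒i≡0 ∥x∥≡0))
    0≤Db² : 0ℤ ℤ.≤ + D * (b * b)
    0≤Db² = subst (ℤ._≤ + D * (b * b)) (*-zeroʳ (+ D)) (*-monoˡ-≤-nonNeg (+ D) (square-nonneg b))
    both : _ × _
    both = nonneg-sum≡0 (square-nonneg (+ 2 * a + b * P)) 0≤Db² sum≡0
    b≡0 : b ≡ 0ℤ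
    b≡0 = square≡0 b (*-cancel-≡0 (+ D) (b * b) (λ D≡0 → ℕ.<⇒≢ 0<D (sym (+-injective D≡0))) (proj₂ both))
    eq : ∀ a P → + 2 * a + 0ℤ * P ≡ + 2 * a
    eq = ℤ-Solver.solve-∀
    a≡0 : a ≡ 0ℤ
    a≡0 = *-cancel-≡0 (+ 2) a (λ ()) (trans (sym (eq a P))
      (trans (cong (λ b → + 2 * a + b * P) (sym b≡0)) (square≡0 (+ 2 * a + b * P) (proj₁ both))))

  -- The norms of difference and sum add up to the right side, and that of the sum is not negative.
  parallelogram : ∀ x y → ∥ x ⊖ y ∥ ≤ 2 ℕ.* ∥ x ∥ ℕ.+ 2 ℕ.* ∥ y ∥
  parallelogram x@(a +α b) y@(c +α d) = drop‿+≤+ (begin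
    + ∥ x ⊖ y ∥                                  ≡⟨ +∥∥ (x ⊖ y) ⟩
    Nm (x ⊖ y)                                   ≡⟨ +-identityʳ _ ⟨
    Nm (x ⊖ y) + 0ℤ                              ≤⟨ +-monoʳ-≤ (Nm (x ⊖ y)) (Nm-nonneg (x ⊕ y)) ⟩
    Nm (x ⊖ y) + Nm (x ⊕ y)                      ≡⟨ eq P (+ Q) a b c d ⟩
    + 2 * Nm x + + 2 * Nm y                      ≡⟨ cong₂ (λ u v → + 2 * u + + 2 * v) (+∥∥ x) (+∥∥ y) ⟨
    + 2 * + ∥ x ∥ + + 2 * + ∥ y ∥                ≡⟨ cong₂ _+_ (pos-* 2 ∥ x ∥) (pos-* 2 ∥ y ∥) ⟨
    + (2 ℕ.* ∥ x ∥ ℕ.+ 2 ℕ.* ∥ y ∥)              ∎)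
    where
    open ≤-Reasoning
    eq : ∀ P Q a b c d →
      (a + - c) * (a + - c) + (a + - c) * (b + - d) * P + (b + - d) * (b + - d) * Q +
      ((a + c) * (a + c) + (a + c) * (b + d) * P + (b + d) * (b + d) * Q) ≡
      + 2 * (a * a + a * b * P + b * b * Q) + + 2 * (c * c + c * d * P + d * d * Q)
    eq = ℤ-Solver.solve-∀

  -- Cauchy–Schwarz: the trace form τ = Tr (x * conj y) satisfies τ² ≤ 4 Nm x Nm y.
  triangle : ∀ x y m n k → ∥ x ∥ ≤ m ℕ.* m ℕ.* k → ∥ y ∥ ≤ n ℕ.* n ℕ.* k →
    ∥ x ⊕ y ∥ ≤ (m ℕ.+ n) ℕ.* (m ℕ.+ n) ℕ.* k
  triangle x@(a +α b) y@(c +α d) m n k ∥x∥≤ ∥y∥≤ = begin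
    ∥ x ⊕ y ∥                                    ≡⟨ cong ∣_∣ (trans (eq₁ P (+ Q) a b c d) (cong₂ (λ u v → u + v + τ) (sym (+∥∥ x)) (sym (+∥∥ y)))) ⟩
    ∣ + ∥ x ∥ + + ∥ y ∥ + τ ∣                    ≤⟨ ∣i+j∣≤∣i∣+∣j∣ (+ ∥ x ∥ + + ∥ y ∥) τ ⟩
    ∥ x ∥ ℕ.+ ∥ y ∥ ℕ.+ ∣ τ ∣                    ≤⟨ ℕ.+-mono-≤ (ℕ.+-mono-≤ ∥x∥≤ ∥y∥≤) τ≤ ⟩
    m ℕ.* m ℕ.* k ℕ.+ n ℕ.* n ℕ.* k ℕ.+ 2 ℕ.* (m ℕ.* n ℕ.* k) ≡⟨ eq₃ m n k ⟩
    (m ℕ.+ n) ℕ.* (m ℕ.+ n) ℕ.* k                ∎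
    where
    open ℕ.≤-Reasoning
    τ = + 2 * (a * c) + (a * d + b * c) * P + + 2 * (b * d * + Q)
    κ = a * d - b * c
    eq₁ : ∀ P Q a b c d → (a + c) * (a + c) + (a + c) * (b + d) * P + (b + d) * (b + d) * Q ≡
      a * a + a * b * P + b * b * Q + (c * c + c * d * P + d * d * Q) +
      (+ 2 * (a * c) + (a * d + b * c) * P + + 2 * (b * d * Q))
    eq₁ = ℤ-Solver.solve-∀
    eq₂ : ∀ P Q a b c d → let τ = + 2 * (a * c) + (a * d + b * c) * P + + 2 * (b * d * Q) ; κ = a * d - b * c in
      τ * τ + (+ 4 * Q - P * P) * (κ * κ) ≡ + 4 * ((a * a + a * b * P + b * b * Q) * (c * c + c * d * P + d * d * Q))
    eq₂ = ℤ-Solver.solve-∀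
    eq₃ : ∀ m n k → m ℕ.* m ℕ.* k ℕ.+ n ℕ.* n ℕ.* k ℕ.+ 2 ℕ.* (m ℕ.* n ℕ.* k) ≡ (m ℕ.+ n) ℕ.* (m ℕ.+ n) ℕ.* k
    eq₃ = ℕ-Solver.solve-∀
    eq₄ : ∀ m n k → 4 ℕ.* (m ℕ.* m ℕ.* k ℕ.* (n ℕ.* n ℕ.* k)) ≡ 2 ℕ.* (m ℕ.* n ℕ.* k) ℕ.* (2 ℕ.* (m ℕ.* n ℕ.* k))
    eq₄ = ℕ-Solver.solve-∀
    0≤Dκ² : 0ℤ ℤ.≤ + D * (κ * κ)
    0≤Dκ² = subst (ℤ._≤ + D * (κ * κ)) (*-zeroʳ (+ D)) (*-monoˡ-≤-nonNeg (+ D) (square-nonneg κ))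
    τ²≤ : τ * τ ℤ.≤ + (4 ℕ.* (∥ x ∥ ℕ.* ∥ y ∥))
    τ²≤ = ≤-trans (≤-reflexive (sym (+-identityʳ (τ * τ)))) (≤-trans (+-monoʳ-≤ (τ * τ) 0≤Dκ²) (≤-reflexive
      (trans (cong (λ D → τ * τ + D * (κ * κ)) D≡) (trans (eq₂ P (+ Q) a b c d)
      (trans (cong₂ (λ u v → + 4 * (u * v)) (sym (+∥∥ x)) (sym (+∥∥ y)))
      (trans (cong (+ 4 *_) (sym (pos-* ∥ x ∥ ∥ y ∥))) (sym (pos-* 4 (∥ x ∥ ℕ.* ∥ y ∥)))))))))
    τ≤ : ∣ τ ∣ ≤ 2 ℕ.* (m ℕ.* n ℕ.* k)
    τ≤ with ∣ τ ∣ ℕ.≤? 2 ℕ.* (m ℕ.* n ℕ.* k)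
    ... | yes τ≤ = τ≤
    ... | no τ≰ = contradiction (begin-strict
      2 ℕ.* (m ℕ.* n ℕ.* k) ℕ.* (2 ℕ.* (m ℕ.* n ℕ.* k))  <⟨ ℕ.*-mono-< (ℕ.≰⇒> τ≰) (ℕ.≰⇒> τ≰) ⟩
      ∣ τ ∣ ℕ.* ∣ τ ∣                                    ≡⟨ abs-* τ τ ⟨
      ∣ τ * τ ∣                                          ≤⟨ drop‿+≤+ (≤-trans (≤-reflexive (0≤i⇒+∣i∣≡i (square-nonneg τ))) τ²≤) ⟩
      4 ℕ.* (∥ x ∥ ℕ.* ∥ y ∥)                            ≤⟨ ℕ.*-monoʳ-≤ 4 (ℕ.*-mono-≤ ∥x∥≤ ∥y∥≤) ⟩
      4 ℕ.* (m ℕ.* m ℕ.* k ℕ.* (n ℕ.* n ℕ.* k))          ≡⟨ eq₄ m n k ⟩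
      2 ℕ.* (m ℕ.* n ℕ.* k) ℕ.* (2 ℕ.* (m ℕ.* n ℕ.* k))  ∎) (ℕ.<-irrefl refl)

  private
    ∥⊗∥≢0 : ∀ x y → ∥ x ∥ ≢ 0 → ∥ y ∥ ≢ 0 → ∥ x ⊗ y ∥ ≢ 0
    ∥⊗∥≢0 x y ∥x∥≢0 ∥y∥≢0 xy≡0 = [ ∥x∥≢0 , ∥y∥≢0 ]′ (ℕ.m*n≡0⇒m≡0∨n≡0 ∥ x ∥ (trans (sym (∥∥-⊗ x y)) xy≡0))

    ∥Δ∥≢0 : ∥ Δ ∥ ≢ 0
    ∥Δ∥≢0 ≡0 = ℕ.<⇒≢ 0<D (sym (trans (sym ∥Δ∥) ≡0))

    ∥ι[1+n]∥≢0 : ∀ n → ∥ ιₙ (suc n) ∥ ≢ 0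
    ∥ι[1+n]∥≢0 n ≡0 = ℕ.1+n≢0 (trans (sym (∥ι∥ (+ suc n))) ≡0)

    scaled≢0 : ∀ n x → ∥ x ∥ ≢ 0 → ∥ Δ ⊗ ιₙ (suc n) ⊗ x ∥ ≢ 0
    scaled≢0 n x ∥x∥≢0 = ∥⊗∥≢0 (Δ ⊗ ιₙ (suc n)) x (∥⊗∥≢0 Δ (ιₙ (suc n)) ∥Δ∥≢0 (∥ι[1+n]∥≢0 n)) ∥x∥≢0

    factor≢0 : ∀ x y z → ∥ z ∥ ≢ 0 → ∥ x ⊗ y ∥ ≡ ∥ z ∥ → ∥ y ∥ ≢ 0
    factor≢0 x y z ∥z∥≢0 xy≡z ∥y∥≡0 = ∥z∥≢0 (begin
      ∥ z ∥           ≡⟨ xy≡z ⟨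
      ∥ x ⊗ y ∥       ≡⟨ ∥∥-⊗ x y ⟩
      ∥ x ∥ ℕ.* ∥ y ∥ ≡⟨ cong (∥ x ∥ ℕ.*_) ∥y∥≡0 ⟩
      ∥ x ∥ ℕ.* 0     ≡⟨ ℕ.*-zeroʳ ∥ x ∥ ⟩
      0               ∎)
      where open ≡-Reasoning

  -- `W-sucˡ` and `W-sucʳ` lower i + j at the price of nonzero factors only, and `W 0 0 n` is 1.
  ∥W∥≢0 : ∀ i j n → ∥ W i j n ∥ ≢ 0
  ∥W∥≢0 zero zero n = subst (λ x → ∥ x ∥ ≢ 0) (sym (W-zero n)) (λ ≡0 → ℕ.1+n≢0 (trans (sym (∥ι∥ 1ℤ)) ≡0))
  ∥W∥≢0 (suc i) zero n = factor≢0 (ιₙ (suc i)) (W (suc i) 0 n) (Δ ⊗ ιₙ (suc n) ⊗ W i 0 (suc n))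
    (scaled≢0 n (W i 0 (suc n)) (∥W∥≢0 i 0 (suc n)))
    (trans (cong ∥_∥ (W-sucˡ i 0 n)) (∥⊝∥ (Δ ⊗ ιₙ (suc n) ⊗ W i 0 (suc n))))
  ∥W∥≢0 i (suc j) n = factor≢0 (ιₙ (suc j)) (W i (suc j) n) (Δ ⊗ ιₙ (suc n) ⊗ W i j (suc n))
    (scaled≢0 n (W i j (suc n)) (∥W∥≢0 i j (suc n)))
    (cong ∥_∥ (W-sucʳ i j n))

  private
    -- The cofactor of β ^ q in `eliminate`.
    G : ℕ → ℕ → ℕ → ℕ → O
    G δ i j n = A i j n ⊕ β ^^ δ ⊗ B i j n

    x≡⊝y : ∀ x y → x ⊕ y ≡ ι 0ℤ → x ≡ ⊝ y
    x≡⊝y (a +α b) (c +α d) x+y≡0 = cong₂ _+α_ (i≡-j a c (cong re x+y≡0)) (i≡-j b d (cong im x+y≡0))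
      where
      re : O → ℤ
      re (a +α b) = a
      i≡-j : ∀ i j → i + j ≡ 0ℤ → i ≡ - j
      i≡-j i j i+j≡0 = trans (eq i j) (trans (cong (_- j) i+j≡0) (+-identityˡ (- j)))
        where
        eq : ∀ i j → i ≡ i + j - j
        eq = ℤ-Solver.solve-∀

  -- If both vanish, then A = - B for the first approximant and A = - β B for the second, which
  -- makes the determinant in `W-diagonal` zero.
  G-nonvanishing : ∀ e n → ∥ G 0 (suc e) (suc e) n ∥ ≡ 0 → ∥ G 1 (suc e) e (suc n) ∥ ≢ 0
  G-nonvanishing e n ∥G₀∥≡0 ∥G₁∥≡0 = ∥W∥≢0 e e (suc n) (begin
    ∥ W e e (suc n) ∥
      ≡⟨ cong ∥_∥ (W-diagonal e e n) ⟩
    ∥ A₁₁ ⊗ (β ⊗ B₁₀) ⊖ A₁₀ ⊗ B₁₁ ∥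
      ≡⟨ cong₂ (λ x y → ∥ x ⊗ (β ⊗ B₁₀) ⊖ y ⊗ B₁₁ ∥)
           (trans (x≡⊝y A₁₁ (ι 1ℤ ⊗ B₁₁) (∥x∥≡0⇒x≡0 (G 0 (suc e) (suc e) n) ∥G₀∥≡0)) (cong ⊝_ (⊗-identityˡ B₁₁)))
           (trans (x≡⊝y A₁₀ ((β ⊗ ι 1ℤ) ⊗ B₁₀) (∥x∥≡0⇒x≡0 (G 1 (suc e) e (suc n)) ∥G₁∥≡0)) (cong (λ b → ⊝ (b ⊗ B₁₀)) (⊗-identityʳ β))) ⟩
    ∥ ⊝ B₁₁ ⊗ (β ⊗ B₁₀) ⊖ ⊝ (β ⊗ B₁₀) ⊗ B₁₁ ∥
      ≡⟨ cong ∥_∥ (cancel B₁₁ (β ⊗ B₁₀)) ⟩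
    ∥ ι 0ℤ ∥
      ≡⟨ ∥ι∥ 0ℤ ⟩
    0 ∎)
    where
    open ≡-Reasoning
    A₁₁ = A (suc e) (suc e) n
    A₁₀ = A (suc e) e (suc n)
    B₁₁ = B (suc e) (suc e) n
    B₁₀ = B (suc e) e (suc n)

  private
    L-step : ∀ x γ y m k n → ∥ γ ∥ ≡ Q → ∥ x ∥ ≤ m ℕ.* m ℕ.* Q ℕ.^ suc n → ∥ y ∥ ≤ k ℕ.* k ℕ.* Q ℕ.^ n →
      ∥ x ⊕ γ ⊗ y ∥ ≤ (m ℕ.+ k) ℕ.* (m ℕ.+ k) ℕ.* Q ℕ.^ suc n
    L-step x γ y m k n ∥γ∥≡Q ∥x∥≤ ∥y∥≤ = triangle x (γ ⊗ y) m k (Q ℕ.^ suc n) ∥x∥≤ (begin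
      ∥ γ ⊗ y ∥                        ≡⟨ trans (∥∥-⊗ γ y) (cong (ℕ._* ∥ y ∥) ∥γ∥≡Q) ⟩
      Q ℕ.* ∥ y ∥                      ≤⟨ ℕ.*-monoʳ-≤ Q ∥y∥≤ ⟩
      Q ℕ.* (k ℕ.* k ℕ.* Q ℕ.^ n)      ≡⟨ eq Q (k ℕ.* k) (Q ℕ.^ n) ⟩
      k ℕ.* k ℕ.* Q ℕ.^ suc n          ∎)
      where
      open ℕ.≤-Reasoning
      eq : ∀ q x u → q ℕ.* (x ℕ.* u) ≡ x ℕ.* (q ℕ.* u)
      eq = ℕ-Solver.solve-∀

  -- Both α and β have absolute value √Q, so the coefficients are dominated by those of (1 - √Q x) ^
  -- (- i - j). A norm is the square of an absolute value, hence the squares.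
  L-bound : ∀ i j n → ∥ L i j n ∥ ≤ multichoose (i ℕ.+ j) n ℕ.* multichoose (i ℕ.+ j) n ℕ.* Q ℕ.^ n
  L-bound zero zero zero = ℕ.≤-reflexive (∥ι∥ 1ℤ)
  L-bound zero zero (suc n) = ℕ.≤-reflexive (∥ι∥ 0ℤ)
  L-bound zero (suc j) zero = ℕ.≤-reflexive (∥ι∥ 1ℤ)
  L-bound zero (suc j) (suc n) = L-step (L 0 j (suc n)) β (L 0 (suc j) n) (multichoose j (suc n)) (multichoose (suc j) n) n ∥β∥ (L-bound 0 j (suc n)) (L-bound 0 (suc j) n)
  L-bound (suc i) j zero = ℕ.≤-reflexive (∥ι∥ 1ℤ)
  L-bound (suc i) j (suc n) = L-step (L i j (suc n)) α (L (suc i) j n) (multichoose (i ℕ.+ j) (suc n)) (multichoose (suc i ℕ.+ j) n) n ∥α∥ (L-bound i j (suc n)) (L-bound (suc i) j n)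

  -- The recursion keeps n + i + j fixed and doubles the bound on the absolute value at each of at
  -- most i + j levels. At the bottom, the weights 8 and 1 in `multichoose-bound` give a binomial
  -- coefficient of at most 9 ^ m / 8 ^ n, and 16 D ≤ Q turns 64 ^ i D ^ i into 4 ^ i Q ^ i. The
  -- factor 8 ^ m clears the denominators.
  A-bound : 16 ℕ.* D ≤ Q → ∀ i j n {m} → n ℕ.+ i ℕ.+ j ≡ m →
    ∥ ιₙ (8 ℕ.^ m) ⊗ A (suc i) j n ∥ ≤ (9 ℕ.^ m ℕ.* 2 ℕ.^ (i ℕ.+ j)) ℕ.* (9 ℕ.^ m ℕ.* 2 ℕ.^ (i ℕ.+ j)) ℕ.* Q ℕ.^ i
  A-bound 16D≤Q i zero n {m} n+i+0≡m = begin
    ∥ ιₙ (8 ℕ.^ m) ⊗ (Δ ^^ i ⊗ ιₙ c) ∥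
      ≡⟨ trans (∥∥-⊗ (ιₙ (8 ℕ.^ m)) (Δ ^^ i ⊗ ιₙ c)) (cong₂ ℕ._*_ (∥ι∥ (+ (8 ℕ.^ m)))
           (trans (∥∥-⊗ (Δ ^^ i) (ιₙ c)) (cong₂ ℕ._*_ (trans (∥∥-^^ Δ i) (cong (ℕ._^ i) ∥Δ∥)) (∥ι∥ (+ c))))) ⟩
    8 ℕ.^ m ℕ.* 8 ℕ.^ m ℕ.* (D ℕ.^ i ℕ.* (c ℕ.* c))
      ≡⟨ cong (λ x → x ℕ.* x ℕ.* (D ℕ.^ i ℕ.* (c ℕ.* c))) (trans (cong (8 ℕ.^_) (sym n+i≡m)) (ℕ.^-distribˡ-+-* 8 n i)) ⟩
    8 ℕ.^ n ℕ.* 8 ℕ.^ i ℕ.* (8 ℕ.^ n ℕ.* 8 ℕ.^ i) ℕ.* (D ℕ.^ i ℕ.* (c ℕ.* c))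
      ≡⟨ eq₁ (8 ℕ.^ n) (8 ℕ.^ i) (D ℕ.^ i) c ⟩
    (c ℕ.* 8 ℕ.^ n) ℕ.* (c ℕ.* 8 ℕ.^ n) ℕ.* (8 ℕ.^ i ℕ.* 8 ℕ.^ i ℕ.* D ℕ.^ i)
      ≤⟨ ℕ.*-mono-≤ (ℕ.*-mono-≤ c8ⁿ≤9ᵐ c8ⁿ≤9ᵐ) 8²ⁱDⁱ≤ ⟩
    9 ℕ.^ m ℕ.* 9 ℕ.^ m ℕ.* (2 ℕ.^ i ℕ.* 2 ℕ.^ i ℕ.* Q ℕ.^ i)
      ≡⟨ eq₂ (9 ℕ.^ m) (2 ℕ.^ i) (Q ℕ.^ i) ⟩
    (9 ℕ.^ m ℕ.* 2 ℕ.^ i) ℕ.* (9 ℕ.^ m ℕ.* 2 ℕ.^ i) ℕ.* Q ℕ.^ i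
      ≡⟨ cong (λ k → (9 ℕ.^ m ℕ.* 2 ℕ.^ k) ℕ.* (9 ℕ.^ m ℕ.* 2 ℕ.^ k) ℕ.* Q ℕ.^ i) (ℕ.+-identityʳ i) ⟨
    (9 ℕ.^ m ℕ.* 2 ℕ.^ (i ℕ.+ 0)) ℕ.* (9 ℕ.^ m ℕ.* 2 ℕ.^ (i ℕ.+ 0)) ℕ.* Q ℕ.^ i ∎
    where
    open ℕ.≤-Reasoning
    c = multichoose (suc i) n
    n+i≡m : n ℕ.+ i ≡ m
    n+i≡m = trans (sym (ℕ.+-identityʳ (n ℕ.+ i))) n+i+0≡m
    c8ⁿ≤9ᵐ : c ℕ.* 8 ℕ.^ n ≤ 9 ℕ.^ m
    c8ⁿ≤9ᵐ = subst₂ _≤_ (trans (cong (c ℕ.* 8 ℕ.^ n ℕ.*_) (ℕ.^-zeroˡ i)) (ℕ.*-identityʳ (c ℕ.* 8 ℕ.^ n)))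
      (cong (9 ℕ.^_) n+i≡m) (multichoose-bound 8 1 i n)
    8²ⁱDⁱ≤ : 8 ℕ.^ i ℕ.* 8 ℕ.^ i ℕ.* D ℕ.^ i ≤ 2 ℕ.^ i ℕ.* 2 ℕ.^ i ℕ.* Q ℕ.^ i
    8²ⁱDⁱ≤ = subst₂ _≤_ (^-distrib-*₃ 8 D i) (^-distrib-*₃ 2 Q i) (ℕ.^-monoˡ-≤ i
      (subst (_≤ 4 ℕ.* Q) (eq D) (ℕ.*-monoʳ-≤ 4 16D≤Q)))
      where
      eq : ∀ D → 4 ℕ.* (16 ℕ.* D) ≡ 64 ℕ.* D
      eq = ℕ-Solver.solve-∀
      ^-distrib-*₃ : ∀ a b i → (a ℕ.* a ℕ.* b) ℕ.^ i ≡ a ℕ.^ i ℕ.* a ℕ.^ i ℕ.* b ℕ.^ i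
      ^-distrib-*₃ a b i = trans (^-distribʳ-* i (a ℕ.* a) b) (cong (ℕ._* b ℕ.^ i) (^-distribʳ-* i a a))
    eq₁ : ∀ u v d c → u ℕ.* v ℕ.* (u ℕ.* v) ℕ.* (d ℕ.* (c ℕ.* c)) ≡ (c ℕ.* u) ℕ.* (c ℕ.* u) ℕ.* (v ℕ.* v ℕ.* d)
    eq₁ = ℕ-Solver.solve-∀
    eq₂ : ∀ u v d → u ℕ.* u ℕ.* (v ℕ.* v ℕ.* d) ≡ (u ℕ.* v) ℕ.* (u ℕ.* v) ℕ.* d
    eq₂ = ℕ-Solver.solve-∀
  A-bound 16D≤Q i (suc j) n {m} n+i+1+j≡m = begin
    ∥ ιₙ (8 ℕ.^ m) ⊗ (A (suc i) j (suc n) ⊖ α ⊗ A i (suc j) (suc n)) ∥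
      ≡⟨ cong ∥_∥ (distrib (ιₙ (8 ℕ.^ m)) α (A (suc i) j (suc n)) (A i (suc j) (suc n))) ⟩
    ∥ ιₙ (8 ℕ.^ m) ⊗ A (suc i) j (suc n) ⊕ ⊝ (α ⊗ (ιₙ (8 ℕ.^ m) ⊗ A i (suc j) (suc n))) ∥
      ≤⟨ triangle (ιₙ (8 ℕ.^ m) ⊗ A (suc i) j (suc n)) (⊝ (α ⊗ (ιₙ (8 ℕ.^ m) ⊗ A i (suc j) (suc n)))) X X (Q ℕ.^ i) (A-bound 16D≤Q i j (suc n) (trans (sym (ℕ.+-suc (n ℕ.+ i) j)) n+i+1+j≡m)) (second i n+i+1+j≡m) ⟩
    (X ℕ.+ X) ℕ.* (X ℕ.+ X) ℕ.* Q ℕ.^ i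
      ≡⟨ cong (λ x → x ℕ.* x ℕ.* Q ℕ.^ i) (trans (eq₁ (9 ℕ.^ m) (2 ℕ.^ (i ℕ.+ j))) (cong (λ k → 9 ℕ.^ m ℕ.* 2 ℕ.^ k) (sym (ℕ.+-suc i j)))) ⟩
    (9 ℕ.^ m ℕ.* 2 ℕ.^ (i ℕ.+ suc j)) ℕ.* (9 ℕ.^ m ℕ.* 2 ℕ.^ (i ℕ.+ suc j)) ℕ.* Q ℕ.^ i ∎
    where
    open ℕ.≤-Reasoning
    X = 9 ℕ.^ m ℕ.* 2 ℕ.^ (i ℕ.+ j)
    eq₁ : ∀ u v → u ℕ.* v ℕ.+ u ℕ.* v ≡ u ℕ.* (2 ℕ.* v)
    eq₁ = ℕ-Solver.solve-∀
    eq₂ : ∀ x q u → q ℕ.* (x ℕ.* x ℕ.* u) ≡ x ℕ.* x ℕ.* (q ℕ.* u)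
    eq₂ = ℕ-Solver.solve-∀
    second : ∀ i → n ℕ.+ i ℕ.+ suc j ≡ m → ∥ ⊝ (α ⊗ (ιₙ (8 ℕ.^ m) ⊗ A i (suc j) (suc n))) ∥ ≤
      (9 ℕ.^ m ℕ.* 2 ℕ.^ (i ℕ.+ j)) ℕ.* (9 ℕ.^ m ℕ.* 2 ℕ.^ (i ℕ.+ j)) ℕ.* Q ℕ.^ i
    second zero _ = subst (_≤ _) (sym (trans (∥⊝∥ (α ⊗ (ιₙ (8 ℕ.^ m) ⊗ ι 0ℤ))) (trans (cong ∥_∥ (zeroʳ₂ α (ιₙ (8 ℕ.^ m)))) (∥ι∥ 0ℤ)))) ℕ.z≤n
    second (suc i) n+1+i+1+j≡m = begin
      ∥ ⊝ (α ⊗ (ιₙ (8 ℕ.^ m) ⊗ A (suc i) (suc j) (suc n))) ∥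
        ≡⟨ trans (∥⊝∥ (α ⊗ (ιₙ (8 ℕ.^ m) ⊗ A (suc i) (suc j) (suc n)))) (trans (∥∥-⊗ α (ιₙ (8 ℕ.^ m) ⊗ A (suc i) (suc j) (suc n))) (cong (ℕ._* ∥ ιₙ (8 ℕ.^ m) ⊗ A (suc i) (suc j) (suc n) ∥) ∥α∥)) ⟩
      Q ℕ.* ∥ ιₙ (8 ℕ.^ m) ⊗ A (suc i) (suc j) (suc n) ∥
        ≤⟨ ℕ.*-monoʳ-≤ Q (A-bound 16D≤Q i (suc j) (suc n) (trans (cong (ℕ._+ suc j) (sym (ℕ.+-suc n i))) n+1+i+1+j≡m)) ⟩
      Q ℕ.* ((9 ℕ.^ m ℕ.* 2 ℕ.^ (i ℕ.+ suc j)) ℕ.* (9 ℕ.^ m ℕ.* 2 ℕ.^ (i ℕ.+ suc j)) ℕ.* Q ℕ.^ i)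
        ≡⟨ eq₂ (9 ℕ.^ m ℕ.* 2 ℕ.^ (i ℕ.+ suc j)) Q (Q ℕ.^ i) ⟩
      (9 ℕ.^ m ℕ.* 2 ℕ.^ (i ℕ.+ suc j)) ℕ.* (9 ℕ.^ m ℕ.* 2 ℕ.^ (i ℕ.+ suc j)) ℕ.* Q ℕ.^ suc i
        ≡⟨ cong (λ k → (9 ℕ.^ m ℕ.* 2 ℕ.^ k) ℕ.* (9 ℕ.^ m ℕ.* 2 ℕ.^ k) ℕ.* Q ℕ.^ suc i) (ℕ.+-suc i j) ⟩
      (9 ℕ.^ m ℕ.* 2 ℕ.^ (suc i ℕ.+ j)) ℕ.* (9 ℕ.^ m ℕ.* 2 ℕ.^ (suc i ℕ.+ j)) ℕ.* Q ℕ.^ suc i ∎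

  -- `20D²≤Q` controls the term with `L` through 20 ^ i D ^ (2 i) ≤ Q ^ i. The other two control the
  -- term with `A`: in `growth-<`, `832≤Q` absorbs the growth in k and `520D≤Q` the remaining
  -- constant factors.
  module LargeNorm (20D²≤Q : 20 ℕ.* (D ℕ.* D) ≤ Q) (520D≤Q : 520 ℕ.* D ≤ Q) (832≤Q : 832 ≤ Q) where

    private
      0<Q : 0 < Q
      0<Q = ℕ.≤-trans (ℕ.≤ᵇ⇒≤ 1 832 tt) 832≤Q

      16D≤Q : 16 ℕ.* D ≤ Q
      16D≤Q = ℕ.≤-trans (ℕ.*-monoˡ-≤ D (ℕ.≤ᵇ⇒≤ 16 520 tt)) 520D≤Q

      halves : ∀ {x a b} → x ≤ 2 ℕ.* a ℕ.+ 2 ℕ.* b → 4 ℕ.* a < x → 4 ℕ.* b < x → ⊥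
      halves {x} {a} {b} x≤ 4a<x 4b<x = ℕ.<-irrefl refl (begin-strict
        4 ℕ.* a ℕ.+ 4 ℕ.* b                <⟨ ℕ.+-mono-< 4a<x 4b<x ⟩
        x ℕ.+ x                            ≤⟨ ℕ.+-mono-≤ x≤ x≤ ⟩
        (2 ℕ.* a ℕ.+ 2 ℕ.* b) ℕ.+ (2 ℕ.* a ℕ.+ 2 ℕ.* b) ≡⟨ eq a b ⟩
        4 ℕ.* a ℕ.+ 4 ℕ.* b                ∎)
        where
        open ℕ.≤-Reasoning
        eq : ∀ a b → (2 ℕ.* a ℕ.+ 2 ℕ.* b) ℕ.+ (2 ℕ.* a ℕ.+ 2 ℕ.* b) ≡ 4 ℕ.* a ℕ.+ 4 ℕ.* b
        eq = ℕ-Solver.solve-∀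

    -- A nonzero `G` has norm at least 1, and then `eliminate` and `parallelogram` give Q ^ q ≤ 2 a
    -- + 2 b, although 4 a and 4 b are both below Q ^ q.
    gap : ∀ {q} e j n δ {m} → n ℕ.+ j ≡ q → n ℕ.+ suc e ≡ q ℕ.+ δ → n ℕ.+ e ℕ.+ j ≡ m → ∣ U q ∣ ≡ 1 →
      let c = multichoose (suc e ℕ.+ j) n in
      4 ℕ.* (D ℕ.^ (e ℕ.+ j) ℕ.* (c ℕ.* c)) < Q ℕ.^ j →
      4 ℕ.* (D ℕ.* ((9 ℕ.^ m ℕ.* 2 ℕ.^ (e ℕ.+ j)) ℕ.* (9 ℕ.^ m ℕ.* 2 ℕ.^ (e ℕ.+ j)) ℕ.* Q ℕ.^ e)) <
        8 ℕ.^ m ℕ.* 8 ℕ.^ m ℕ.* Q ℕ.^ q →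
      ∥ G δ (suc e) j n ∥ ≡ 0
    gap {q} e j n δ {m} n+j≡q n+1+e≡q+δ n+e+j≡m ∣Uq∣≡1 hL hA with ∥ G δ (suc e) j n ∥ ℕ.≟ 0
    ... | yes ∥G∥≡0 = ∥G∥≡0
    ... | no ∥G∥≢0 = ⊥-elim (halves {a = a} {b} bound 4a< 4b<)
      where
      open ℕ.≤-Reasoning
      c = multichoose (suc e ℕ.+ j) n
      a = D ℕ.^ (e ℕ.+ j) ℕ.* (c ℕ.* c ℕ.* Q ℕ.^ n)
      b = D ℕ.* ∥ A (suc e) j n ∥
      ε = U q
      bound : Q ℕ.^ q ≤ 2 ℕ.* a ℕ.+ 2 ℕ.* b
      bound = begin
        Q ℕ.^ q
          ≤⟨ ℕ.m≤m*n (Q ℕ.^ q) ∥ G δ (suc e) j n ∥ {{ℕ.≢-nonZero ∥G∥≢0}} ⟩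
        Q ℕ.^ q ℕ.* ∥ G δ (suc e) j n ∥
          ≡⟨ cong (ℕ._* ∥ G δ (suc e) j n ∥) (trans (∥∥-^^ β q) (cong (ℕ._^ q) ∥β∥)) ⟨
        ∥ β ^^ q ∥ ℕ.* ∥ G δ (suc e) j n ∥
          ≡⟨ ∥∥-⊗ (β ^^ q) (G δ (suc e) j n) ⟨
        ∥ β ^^ q ⊗ G δ (suc e) j n ∥
          ≡⟨ cong ∥_∥ (eliminate ε (suc e) j n δ n+j≡q n+1+e≡q+δ refl refl) ⟩
        ∥ Δ ^^ (e ℕ.+ j) ⊗ L (suc e) j n ⊖ ι ε ⊗ Δ ⊗ A (suc e) j n ∥
          ≤⟨ parallelogram (Δ ^^ (e ℕ.+ j) ⊗ L (suc e) j n) (ι ε ⊗ Δ ⊗ A (suc e) j n) ⟩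
        2 ℕ.* ∥ Δ ^^ (e ℕ.+ j) ⊗ L (suc e) j n ∥ ℕ.+ 2 ℕ.* ∥ ι ε ⊗ Δ ⊗ A (suc e) j n ∥
          ≤⟨ ℕ.+-mono-≤ (ℕ.*-monoʳ-≤ 2 ∥ΔL∥≤a) (ℕ.*-monoʳ-≤ 2 (ℕ.≤-reflexive ∥ΔA∥≡b)) ⟩
        2 ℕ.* a ℕ.+ 2 ℕ.* b ∎
        where
        ∥ΔL∥≤a : ∥ Δ ^^ (e ℕ.+ j) ⊗ L (suc e) j n ∥ ≤ a
        ∥ΔL∥≤a = subst (_≤ a) (sym (trans (∥∥-⊗ (Δ ^^ (e ℕ.+ j)) (L (suc e) j n))
          (cong (ℕ._* ∥ L (suc e) j n ∥) (trans (∥∥-^^ Δ (e ℕ.+ j)) (cong (ℕ._^ (e ℕ.+ j)) ∥Δ∥)))))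
          (ℕ.*-monoʳ-≤ (D ℕ.^ (e ℕ.+ j)) (L-bound (suc e) j n))
        ∥ΔA∥≡b : ∥ ι ε ⊗ Δ ⊗ A (suc e) j n ∥ ≡ b
        ∥ΔA∥≡b = trans (∥∥-⊗ (ι ε ⊗ Δ) (A (suc e) j n)) (cong (ℕ._* ∥ A (suc e) j n ∥)
          (trans (∥∥-⊗ (ι ε) Δ) (trans (cong₂ ℕ._*_ (trans (∥ι∥ ε) (cong₂ ℕ._*_ ∣Uq∣≡1 ∣Uq∣≡1)) ∥Δ∥) (ℕ.*-identityˡ D))))
      4a< : 4 ℕ.* a < Q ℕ.^ q
      4a< = begin-strict
        4 ℕ.* (D ℕ.^ (e ℕ.+ j) ℕ.* (c ℕ.* c ℕ.* Q ℕ.^ n))   ≡⟨ eq (D ℕ.^ (e ℕ.+ j)) (c ℕ.* c) (Q ℕ.^ n) ⟩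
        Q ℕ.^ n ℕ.* (4 ℕ.* (D ℕ.^ (e ℕ.+ j) ℕ.* (c ℕ.* c))) <⟨ *-monoˡ-<′ (Q ℕ.^ n) (^-pos Q n 0<Q) hL ⟩
        Q ℕ.^ n ℕ.* Q ℕ.^ j                                 ≡⟨ ℕ.^-distribˡ-+-* Q n j ⟨
        Q ℕ.^ (n ℕ.+ j)                                     ≡⟨ cong (Q ℕ.^_) n+j≡q ⟩
        Q ℕ.^ q                                             ∎
        where
        eq : ∀ x y z → 4 ℕ.* (x ℕ.* (y ℕ.* z)) ≡ z ℕ.* (4 ℕ.* (x ℕ.* y))
        eq = ℕ-Solver.solve-∀
      Y = (9 ℕ.^ m ℕ.* 2 ℕ.^ (e ℕ.+ j)) ℕ.* (9 ℕ.^ m ℕ.* 2 ℕ.^ (e ℕ.+ j)) ℕ.* Q ℕ.^ e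
      4b< : 4 ℕ.* b < Q ℕ.^ q
      4b< = *-cancelʳ-<′ (8 ℕ.^ m ℕ.* 8 ℕ.^ m) (begin-strict
        4 ℕ.* (D ℕ.* ∥ A (suc e) j n ∥) ℕ.* (8 ℕ.^ m ℕ.* 8 ℕ.^ m)  ≡⟨ eq D ∥ A (suc e) j n ∥ (8 ℕ.^ m) ⟩
        4 ℕ.* (D ℕ.* (8 ℕ.^ m ℕ.* 8 ℕ.^ m ℕ.* ∥ A (suc e) j n ∥))
          ≡⟨ cong (λ x → 4 ℕ.* (D ℕ.* x)) (trans (∥∥-⊗ (ιₙ (8 ℕ.^ m)) (A (suc e) j n)) (cong (ℕ._* ∥ A (suc e) j n ∥) (∥ι∥ (+ (8 ℕ.^ m))))) ⟨
        4 ℕ.* (D ℕ.* ∥ ιₙ (8 ℕ.^ m) ⊗ A (suc e) j n ∥)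
          ≤⟨ ℕ.*-monoʳ-≤ 4 (ℕ.*-monoʳ-≤ D (A-bound 16D≤Q e j n n+e+j≡m)) ⟩
        4 ℕ.* (D ℕ.* Y)                    <⟨ hA ⟩
        8 ℕ.^ m ℕ.* 8 ℕ.^ m ℕ.* Q ℕ.^ q    ≡⟨ ℕ.*-comm (8 ℕ.^ m ℕ.* 8 ℕ.^ m) (Q ℕ.^ q) ⟩
        Q ℕ.^ q ℕ.* (8 ℕ.^ m ℕ.* 8 ℕ.^ m)  ∎)
        where
        eq : ∀ D a x → 4 ℕ.* (D ℕ.* a) ℕ.* (x ℕ.* x) ≡ 4 ℕ.* (D ℕ.* (x ℕ.* x ℕ.* a))
        eq = ℕ-Solver.solve-∀

    no-unit : ∀ e n {m} → n ℕ.+ e ℕ.+ suc e ≡ m →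
      (let c = multichoose (suc e ℕ.+ suc e) n in 4 ℕ.* (c ℕ.* c) < 20 ℕ.^ suc e) →
      (let c = multichoose (suc e ℕ.+ e) (suc n) in 4 ℕ.* (c ℕ.* c) < 20 ℕ.^ e) →
      4 ℕ.* (D ℕ.* ((9 ℕ.^ m ℕ.* 2 ℕ.^ (e ℕ.+ suc e)) ℕ.* (9 ℕ.^ m ℕ.* 2 ℕ.^ (e ℕ.+ suc e)) ℕ.* Q ℕ.^ e)) <
        8 ℕ.^ m ℕ.* 8 ℕ.^ m ℕ.* Q ℕ.^ (n ℕ.+ suc e) →
      ∣ U (n ℕ.+ suc e) ∣ ≢ 1
    -- The indices (e + 1, e + 1, n) and (e + 1, e, n + 1) both have n + j = q; in the second, the
    -- power of β exceeds q by one, hence δ = 1.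
    no-unit e n {m} n+e+1+e≡m h₁ h₀ hA ∣Uq∣≡1 = G-nonvanishing e n
      (gap e (suc e) n 0 refl (sym (ℕ.+-identityʳ (n ℕ.+ suc e))) n+e+1+e≡m ∣Uq∣≡1 hL₁ hA)
      (gap e e (suc n) 1 (sym (ℕ.+-suc n e)) (sym (ℕ.+-comm (n ℕ.+ suc e) 1)) (trans (sym (ℕ.+-suc (n ℕ.+ e) e)) n+e+1+e≡m) ∣Uq∣≡1 hL₀ hA₀)
      where
      open ℕ.≤-Reasoning
      D^≤Q^ : ∀ i → 20 ℕ.^ i ℕ.* D ℕ.^ (i ℕ.+ i) ≤ Q ℕ.^ i
      D^≤Q^ i = subst (_≤ Q ℕ.^ i) (trans (^-distribʳ-* i 20 (D ℕ.* D)) (cong (20 ℕ.^ i ℕ.*_)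
        (trans (^-distribʳ-* i D D) (sym (ℕ.^-distribˡ-+-* D i i))))) (ℕ.^-monoˡ-≤ i 20D²≤Q)
      scale : ∀ i c → 4 ℕ.* (c ℕ.* c) < 20 ℕ.^ i → 4 ℕ.* (D ℕ.^ (i ℕ.+ i) ℕ.* (c ℕ.* c)) < Q ℕ.^ i
      scale i c h = begin-strict
        4 ℕ.* (D ℕ.^ (i ℕ.+ i) ℕ.* (c ℕ.* c))   ≡⟨ eq (D ℕ.^ (i ℕ.+ i)) (c ℕ.* c) ⟩
        D ℕ.^ (i ℕ.+ i) ℕ.* (4 ℕ.* (c ℕ.* c))   <⟨ *-monoˡ-<′ (D ℕ.^ (i ℕ.+ i)) (^-pos D (i ℕ.+ i) 0<D) h ⟩
        D ℕ.^ (i ℕ.+ i) ℕ.* 20 ℕ.^ i            ≡⟨ ℕ.*-comm (D ℕ.^ (i ℕ.+ i)) (20 ℕ.^ i) ⟩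
        20 ℕ.^ i ℕ.* D ℕ.^ (i ℕ.+ i)            ≤⟨ D^≤Q^ i ⟩
        Q ℕ.^ i                                 ∎
        where
        eq : ∀ x y → 4 ℕ.* (x ℕ.* y) ≡ x ℕ.* (4 ℕ.* y)
        eq = ℕ-Solver.solve-∀
      c₁ = multichoose (suc e ℕ.+ suc e) n
      c₀ = multichoose (suc e ℕ.+ e) (suc n)
      hL₁ : 4 ℕ.* (D ℕ.^ (e ℕ.+ suc e) ℕ.* (c₁ ℕ.* c₁)) < Q ℕ.^ suc e
      hL₁ = ℕ.≤-<-trans (ℕ.*-monoʳ-≤ 4 (ℕ.*-monoˡ-≤ (c₁ ℕ.* c₁) (ℕ.m≤n*m (D ℕ.^ (e ℕ.+ suc e)) D {{ℕ.>-nonZero 0<D}})))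
        (scale (suc e) c₁ h₁)
      hL₀ : 4 ℕ.* (D ℕ.^ (e ℕ.+ e) ℕ.* (c₀ ℕ.* c₀)) < Q ℕ.^ e
      hL₀ = scale e c₀ h₀
      X X₀ : ℕ
      X = 9 ℕ.^ m ℕ.* 2 ℕ.^ (e ℕ.+ suc e)
      X₀ = 9 ℕ.^ m ℕ.* 2 ℕ.^ (e ℕ.+ e)
      X₀≤X : X₀ ≤ X
      X₀≤X = ℕ.*-monoʳ-≤ (9 ℕ.^ m) (ℕ.^-monoʳ-≤ 2 (ℕ.+-monoʳ-≤ e (ℕ.n≤1+n e)))
      hA₀ : 4 ℕ.* (D ℕ.* (X₀ ℕ.* X₀ ℕ.* Q ℕ.^ e)) < 8 ℕ.^ m ℕ.* 8 ℕ.^ m ℕ.* Q ℕ.^ (n ℕ.+ suc e)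
      hA₀ = ℕ.≤-<-trans (ℕ.*-monoʳ-≤ 4 (ℕ.*-monoʳ-≤ D (ℕ.*-monoˡ-≤ (Q ℕ.^ e) (ℕ.*-mono-≤ X₀≤X X₀≤X)))) hA

    -- The balance e : n = 2 : 1 makes both error terms small: the binomial coefficient grows like (5⁵/4⁴)ᵏ < 20ᵏ.
    -- Here q ≡ 1 modulo 3, and q ≡ 2 modulo 3 in no-unit-2.
    no-unit-1 : ∀ k → 2 ≤ k → ∣ U (k ℕ.+ suc (2 ℕ.* k)) ∣ ≢ 1
    no-unit-1 k 2≤k = no-unit (2 ℕ.* k) k refl
      (square-< {multichoose (suc (2 ℕ.* k) ℕ.+ suc (2 ℕ.* k)) k} {4} {k} 1 (multichoose-< k 1 1 4 {suc (2 ℕ.* k) ℕ.+ suc (2 ℕ.* k)} {k} (eq₁ k) (eq₂ k) (geometric-<₀ k)) (ℕ.≤ᵇ⇒≤ 16 20 tt) (eq₃ k))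
      (square-< {multichoose (suc (2 ℕ.* k) ℕ.+ 2 ℕ.* k) (suc k)} {1} {k} 0 (small k 2≤k) ℕ.≤-refl (sym (ℕ.+-identityʳ (2 ℕ.* k))))
      (subst (4 ℕ.* (D ℕ.* (X ℕ.* X ℕ.* Q ℕ.^ (2 ℕ.* k))) <_) (cong (8 ℕ.^ m ℕ.* 8 ℕ.^ m ℕ.*_) (Q^ k))
        (growth-< k 1 1 {D} {Q} {Q ℕ.^ (2 ℕ.* k)} (eq₄ k) (eq₅ k) 832≤Q 1296D<64Q (^-pos Q (2 ℕ.* k) 0<Q)))
      where
      m = k ℕ.+ 2 ℕ.* k ℕ.+ suc (2 ℕ.* k)
      X = 9 ℕ.^ m ℕ.* 2 ℕ.^ (2 ℕ.* k ℕ.+ suc (2 ℕ.* k))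
      geometric-<₀ : ∀ k → 2 ℕ.* 5 ℕ.^ 1 ℕ.* 3125 ℕ.^ k < 4 ℕ.* 4 ℕ.^ 1 ℕ.* 5120 ℕ.^ k
      geometric-<₀ k = subst (λ k → 10 ℕ.* 3125 ℕ.^ k < 16 ℕ.* 5120 ℕ.^ k) (ℕ.+-identityʳ k)
        (geometric-< {10} {16} 0 k (ℕ.<ᵇ⇒< 10 16 tt))
      -- `geometric-<` can start only at k = 5, as 10 · 3125ᵏ < 5120ᵏ fails before. The claim itself
      -- fails for k = 1, which would be q = 4.
      small : ∀ k → 2 ≤ k → 2 ℕ.* multichoose (suc (2 ℕ.* k) ℕ.+ 2 ℕ.* k) (suc k) < 1 ℕ.* 20 ℕ.^ k
      small 0 ()
      small 1 (ℕ.s≤s ())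
      small 2 _ = ℕ.<ᵇ⇒< (2 ℕ.* multichoose 9 3) (1 ℕ.* 20 ℕ.^ 2) tt
      small 3 _ = ℕ.<ᵇ⇒< (2 ℕ.* multichoose 13 4) (1 ℕ.* 20 ℕ.^ 3) tt
      small 4 _ = ℕ.<ᵇ⇒< (2 ℕ.* multichoose 17 5) (1 ℕ.* 20 ℕ.^ 4) tt
      small (suc (suc (suc (suc (suc k))))) _ = multichoose-< k′ 0 1 1 {suc (2 ℕ.* k′) ℕ.+ 2 ℕ.* k′} {suc k′} (eq₁′ k′) (eq₂′ k′)
        (subst (λ k → 10 ℕ.* 3125 ℕ.^ k < 1 ℕ.* 5120 ℕ.^ k) (ℕ.+-comm k 5)
          (geometric-< {10} {1} 5 k (ℕ.<ᵇ⇒< (10 ℕ.* 3125 ℕ.^ 5) (1 ℕ.* 5120 ℕ.^ 5) tt)))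
        where
        k′ = 5 ℕ.+ k
        eq₁′ : ∀ k → suc (2 ℕ.* k) ℕ.+ 2 ℕ.* k ≡ suc (4 ℕ.* k ℕ.+ 0)
        eq₁′ = ℕ-Solver.solve-∀
        eq₂′ : ∀ k → suc k ℕ.+ (4 ℕ.* k ℕ.+ 0) ≡ 5 ℕ.* k ℕ.+ 1
        eq₂′ = ℕ-Solver.solve-∀
      eq₁ : ∀ k → suc (2 ℕ.* k) ℕ.+ suc (2 ℕ.* k) ≡ suc (4 ℕ.* k ℕ.+ 1)
      eq₁ = ℕ-Solver.solve-∀
      eq₂ : ∀ k → k ℕ.+ (4 ℕ.* k ℕ.+ 1) ≡ 5 ℕ.* k ℕ.+ 1
      eq₂ = ℕ-Solver.solve-∀
      eq₃ : ∀ k → suc (2 ℕ.* k) ≡ 2 ℕ.* k ℕ.+ 1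
      eq₃ = ℕ-Solver.solve-∀
      eq₄ : ∀ k → k ℕ.+ 2 ℕ.* k ℕ.+ suc (2 ℕ.* k) ≡ 5 ℕ.* k ℕ.+ 1
      eq₄ = ℕ-Solver.solve-∀
      eq₅ : ∀ k → 2 ℕ.* k ℕ.+ suc (2 ℕ.* k) ≡ 4 ℕ.* k ℕ.+ 1
      eq₅ = ℕ-Solver.solve-∀
      Q^ : ∀ k → Q ℕ.* Q ℕ.^ k ℕ.* Q ℕ.^ (2 ℕ.* k) ≡ Q ℕ.^ (k ℕ.+ suc (2 ℕ.* k))
      Q^ k = trans (sym (ℕ.^-distribˡ-+-* Q (suc k) (2 ℕ.* k))) (cong (Q ℕ.^_) (sym (ℕ.+-suc k (2 ℕ.* k))))
      1296D<64Q : 4 ℕ.* 81 ℕ.^ 1 ℕ.* 4 ℕ.^ 1 ℕ.* D < 64 ℕ.^ 1 ℕ.* Q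
      1296D<64Q = ℕ.<-≤-trans (ℕ.*-monoˡ-< D {{ℕ.>-nonZero 0<D}} (ℕ.<ᵇ⇒< 1296 33280 tt))
        (subst (_≤ 64 ℕ.* Q) (eq D) (ℕ.*-monoʳ-≤ 64 520D≤Q))
        where
        eq : ∀ D → 64 ℕ.* (520 ℕ.* D) ≡ 33280 ℕ.* D
        eq = ℕ-Solver.solve-∀

    no-unit-2 : ∀ k → 1 ≤ k → ∣ U (k ℕ.+ suc (suc (2 ℕ.* k))) ∣ ≢ 1
    no-unit-2 k 1≤k = no-unit (suc (2 ℕ.* k)) k refl
      (square-< {multichoose (suc (suc (2 ℕ.* k)) ℕ.+ suc (suc (2 ℕ.* k))) k} {20} {k} 2 (multichoose-< k 3 3 20 {suc (suc (2 ℕ.* k)) ℕ.+ suc (suc (2 ℕ.* k))} {k} (eq₁ k) (eq₂ k) (geometric-<₀ k)) ℕ.≤-refl (eq₃ k))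
      (square-< {multichoose (suc (suc (2 ℕ.* k)) ℕ.+ suc (2 ℕ.* k)) (suc k)} {4} {k} 1 (small k 1≤k) (ℕ.≤ᵇ⇒≤ 16 20 tt) (ℕ.+-comm 1 (2 ℕ.* k)))
      (subst (4 ℕ.* (D ℕ.* (X ℕ.* X ℕ.* Q ℕ.^ suc (2 ℕ.* k))) <_) (cong (8 ℕ.^ m ℕ.* 8 ℕ.^ m ℕ.*_) (Q^ k))
        (growth-< k 3 3 {D} {Q} {Q ℕ.^ suc (2 ℕ.* k)} (eq₄ k) (eq₅ k) 832≤Q 136048896D<262144Q (^-pos Q (suc (2 ℕ.* k)) 0<Q)))
      where
      m = k ℕ.+ suc (2 ℕ.* k) ℕ.+ suc (suc (2 ℕ.* k))
      X = 9 ℕ.^ m ℕ.* 2 ℕ.^ (suc (2 ℕ.* k) ℕ.+ suc (suc (2 ℕ.* k)))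
      geometric-<₀ : ∀ k → 2 ℕ.* 5 ℕ.^ 3 ℕ.* 3125 ℕ.^ k < 20 ℕ.* 4 ℕ.^ 3 ℕ.* 5120 ℕ.^ k
      geometric-<₀ k = subst (λ k → 250 ℕ.* 3125 ℕ.^ k < 1280 ℕ.* 5120 ℕ.^ k) (ℕ.+-identityʳ k)
        (geometric-< {250} {1280} 0 k (ℕ.<ᵇ⇒< 250 1280 tt))
      small : ∀ k → 1 ≤ k → 2 ℕ.* multichoose (suc (suc (2 ℕ.* k)) ℕ.+ suc (2 ℕ.* k)) (suc k) < 4 ℕ.* 20 ℕ.^ k
      small 0 ()
      small 1 _ = ℕ.<ᵇ⇒< (2 ℕ.* multichoose 7 2) (4 ℕ.* 20 ℕ.^ 1) tt
      small 2 _ = ℕ.<ᵇ⇒< (2 ℕ.* multichoose 11 3) (4 ℕ.* 20 ℕ.^ 2) tt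
      small (suc (suc (suc k))) _ = multichoose-< k′ 2 3 4 {suc (suc (2 ℕ.* k′)) ℕ.+ suc (2 ℕ.* k′)} {suc k′} (eq₁′ k′) (eq₂′ k′)
        (subst (λ k → 250 ℕ.* 3125 ℕ.^ k < 64 ℕ.* 5120 ℕ.^ k) (ℕ.+-comm k 3)
          (geometric-< {250} {64} 3 k (ℕ.<ᵇ⇒< (250 ℕ.* 3125 ℕ.^ 3) (64 ℕ.* 5120 ℕ.^ 3) tt)))
        where
        k′ = 3 ℕ.+ k
        eq₁′ : ∀ k → suc (suc (2 ℕ.* k)) ℕ.+ suc (2 ℕ.* k) ≡ suc (4 ℕ.* k ℕ.+ 2)
        eq₁′ = ℕ-Solver.solve-∀
        eq₂′ : ∀ k → suc k ℕ.+ (4 ℕ.* k ℕ.+ 2) ≡ 5 ℕ.* k ℕ.+ 3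
        eq₂′ = ℕ-Solver.solve-∀
      eq₁ : ∀ k → suc (suc (2 ℕ.* k)) ℕ.+ suc (suc (2 ℕ.* k)) ≡ suc (4 ℕ.* k ℕ.+ 3)
      eq₁ = ℕ-Solver.solve-∀
      eq₂ : ∀ k → k ℕ.+ (4 ℕ.* k ℕ.+ 3) ≡ 5 ℕ.* k ℕ.+ 3
      eq₂ = ℕ-Solver.solve-∀
      eq₃ : ∀ k → suc (suc (2 ℕ.* k)) ≡ 2 ℕ.* k ℕ.+ 2
      eq₃ = ℕ-Solver.solve-∀
      eq₄ : ∀ k → k ℕ.+ suc (2 ℕ.* k) ℕ.+ suc (suc (2 ℕ.* k)) ≡ 5 ℕ.* k ℕ.+ 3
      eq₄ = ℕ-Solver.solve-∀
      eq₅ : ∀ k → suc (2 ℕ.* k) ℕ.+ suc (suc (2 ℕ.* k)) ≡ 4 ℕ.* k ℕ.+ 3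
      eq₅ = ℕ-Solver.solve-∀
      Q^ : ∀ k → Q ℕ.* Q ℕ.^ k ℕ.* Q ℕ.^ suc (2 ℕ.* k) ≡ Q ℕ.^ (k ℕ.+ suc (suc (2 ℕ.* k)))
      Q^ k = trans (sym (ℕ.^-distribˡ-+-* Q (suc k) (suc (2 ℕ.* k)))) (cong (Q ℕ.^_) (sym (ℕ.+-suc k (suc (2 ℕ.* k)))))
      -- 4 · 81³ · 4³ / 64³ is just below 519; this is the origin of the constant 520.
      136048896D<262144Q : 4 ℕ.* 81 ℕ.^ 3 ℕ.* 4 ℕ.^ 3 ℕ.* D < 64 ℕ.^ 3 ℕ.* Q
      136048896D<262144Q = ℕ.<-≤-trans (ℕ.*-monoˡ-< D {{ℕ.>-nonZero 0<D}} (ℕ.<ᵇ⇒< 136048896 136314880 tt))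
        (subst (_≤ 262144 ℕ.* Q) (sym (ℕ.*-assoc 262144 520 D)) (ℕ.*-monoʳ-≤ 262144 520D≤Q))

-- The sieve

-- Writing the prime as 2 h + 1 makes it odd by construction, so that (ℓ choose 2) = h ℓ.
module Lifting (P Q : ℤ) (h : ℕ) (ℓ-prime : Prime (suc (h ℕ.+ h))) where

  open QuadRing P Q

  ℓ : ℕ
  ℓ = suc (h ℕ.+ h)

  euclid : ∀ i j → + ℓ ℤ∣.∣ i * j → + ℓ ℤ∣.∣ i ⊎ + ℓ ℤ∣.∣ j
  euclid i j ℓ∣ij = [ (λ ℓ∣i → inj₁ (ℤ∣.∣ᵤ⇒∣ ℓ∣i)) , (λ ℓ∣j → inj₂ (ℤ∣.∣ᵤ⇒∣ ℓ∣j)) ]′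
    (euclidsLemma ∣ i ∣ ∣ j ∣ ℓ-prime (subst (ℓ ℕ∣.∣_) (abs-* i j) (ℤ∣.∣⇒∣ᵤ ℓ∣ij)))

  private
    triangular-ℓ : ∀ h → triangular (suc (h ℕ.+ h)) ≡ h ℕ.* suc (h ℕ.+ h)
    triangular-ℓ zero = refl
    triangular-ℓ (suc h) = begin
      triangular (suc (h ℕ.+ suc h)) ℕ.+ suc (h ℕ.+ suc h)
        ≡⟨ cong (λ m → triangular (suc m) ℕ.+ suc m) (ℕ.+-suc h h) ⟩
      triangular (suc (h ℕ.+ h)) ℕ.+ suc (h ℕ.+ h) ℕ.+ suc (suc (h ℕ.+ h))
        ≡⟨ cong (λ x → x ℕ.+ suc (h ℕ.+ h) ℕ.+ suc (suc (h ℕ.+ h))) (triangular-ℓ h) ⟩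
      h ℕ.* suc (h ℕ.+ h) ℕ.+ suc (h ℕ.+ h) ℕ.+ suc (suc (h ℕ.+ h))
        ≡⟨ eq h ⟩
      suc h ℕ.* suc (suc h ℕ.+ suc h) ∎
      where
      open ≡-Reasoning
      eq : ∀ h → h ℕ.* suc (h ℕ.+ h) ℕ.+ suc (h ℕ.+ h) ℕ.+ suc (suc (h ℕ.+ h)) ≡ suc h ℕ.* suc (suc h ℕ.+ suc h)
      eq = ℕ-Solver.solve-∀

  -- A first-order Taylor expansion in `t` on a residue class modulo `r`. As `U` is the α-coordinate
  -- of the powers of α, the derivative is the α-coordinate of α ^ c γ.
  U-expand : ∀ c r t m γ → α ^^ r ≡ ι 1ℤ ⊕ ι m ⊗ γ →
    ∃ λ x → U (c ℕ.+ r ℕ.* t) ≡ U c + m * (+ t * im (α ^^ c ⊗ γ) + m * x)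
  U-expand c r t m γ α^r = im (a ⊗ w) , (begin
    U (c ℕ.+ r ℕ.* t)
      ≡⟨ im-α^^ (c ℕ.+ r ℕ.* t) ⟨
    im (α ^^ (c ℕ.+ r ℕ.* t))
      ≡⟨ cong im (trans (^^-+ α c (r ℕ.* t)) (cong (a ⊗_) (trans (^^-* α r t)
           (trans (cong (_^^ t) α^r) (proj₂ (binomial₁ m γ t)))))) ⟩
    im (a ⊗ (ι 1ℤ ⊕ ι m ⊗ (ιₙ t ⊗ γ ⊕ ι m ⊗ w)))
      ≡⟨ cong im (expand₁ a (ι m) (ιₙ t ⊗ γ ⊕ ι m ⊗ w)) ⟩
    im (a ⊕ ι m ⊗ (a ⊗ (ιₙ t ⊗ γ ⊕ ι m ⊗ w)))
      ≡⟨ cong (λ x → im (a ⊕ ι m ⊗ x)) (expand₂ a (ιₙ t) γ (ι m) w) ⟩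
    im (a ⊕ ι m ⊗ (ιₙ t ⊗ (a ⊗ γ) ⊕ ι m ⊗ (a ⊗ w)))
      ≡⟨ im-⊕ a (ι m ⊗ (ιₙ t ⊗ (a ⊗ γ) ⊕ ι m ⊗ (a ⊗ w))) ⟩
    im a + im (ι m ⊗ (ιₙ t ⊗ (a ⊗ γ) ⊕ ι m ⊗ (a ⊗ w)))
      ≡⟨ cong₂ _+_ (im-α^^ c) (im-ι⊗ m (ιₙ t ⊗ (a ⊗ γ) ⊕ ι m ⊗ (a ⊗ w))) ⟩
    U c + m * im (ιₙ t ⊗ (a ⊗ γ) ⊕ ι m ⊗ (a ⊗ w))
      ≡⟨ cong (λ x → U c + m * x) (im-⊕ (ιₙ t ⊗ (a ⊗ γ)) (ι m ⊗ (a ⊗ w))) ⟩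
    U c + m * (im (ιₙ t ⊗ (a ⊗ γ)) + im (ι m ⊗ (a ⊗ w)))
      ≡⟨ cong₂ (λ x y → U c + m * (x + y)) (im-ι⊗ (+ t) (a ⊗ γ)) (im-ι⊗ m (a ⊗ w)) ⟩
    U c + m * (+ t * im (a ⊗ γ) + m * im (a ⊗ w)) ∎)
    where
    open ≡-Reasoning
    a = α ^^ c
    w = proj₁ (binomial₁ m γ t)

  private
    -- Equality would leave t φ ≡ 0 modulo ℓ with neither factor divisible by ℓ.
    isolated-coprime : ∀ c t r m γ → m ≢ 0ℤ → α ^^ r ≡ ι 1ℤ ⊕ ι (m * + ℓ) ⊗ γ →
      ¬ (+ ℓ ℤ∣.∣ im (α ^^ c ⊗ γ)) → ¬ (ℓ ℕ∣.∣ t) → U (c ℕ.+ r ℕ.* t) ≢ U c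
    isolated-coprime c t r m γ m≢0 α^r ℓ∤φ ℓ∤t U≡ =
      [ (λ ℓ∣t → ℓ∤t (ℤ∣.∣⇒∣ᵤ ℓ∣t)) , ℓ∤φ ]′ (euclid (+ t) φ (ℤ∣.divides (- (m * x)) tφ≡))
      where
      open ≡-Reasoning
      φ = im (α ^^ c ⊗ γ)
      expansion = U-expand c r t (m * + ℓ) γ α^r
      x = proj₁ expansion
      product≡0 : m * + ℓ * (+ t * φ + m * + ℓ * x) ≡ 0ℤ
      product≡0 = trans (eq (U c) (m * + ℓ * (+ t * φ + m * + ℓ * x)))
        (trans (cong (_- U c) (trans (sym (proj₂ expansion)) U≡)) (+-inverseʳ (U c)))
        where
        eq : ∀ u y → y ≡ u + y - u
        eq = ℤ-Solver.solve-∀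
      mℓ≢0 : m * + ℓ ≢ 0ℤ
      mℓ≢0 mℓ≡0 = [ m≢0 , (λ ()) ]′ (i*j≡0⇒i≡0∨j≡0 m mℓ≡0)
      sum≡0 : + t * φ + m * + ℓ * x ≡ 0ℤ
      sum≡0 = [ (λ mℓ≡0 → contradiction mℓ≡0 mℓ≢0) , (λ s≡0 → s≡0) ]′ (i*j≡0⇒i≡0∨j≡0 (m * + ℓ) product≡0)
      tφ≡ : + t * φ ≡ - (m * x) * + ℓ
      tφ≡ = begin
        + t * φ                                          ≡⟨ eq (+ t * φ) m (+ ℓ) x ⟩
        (+ t * φ + m * + ℓ * x) + - (m * x) * + ℓ        ≡⟨ cong (_+ - (m * x) * + ℓ) sum≡0 ⟩
        0ℤ + - (m * x) * + ℓ                             ≡⟨ +-identityˡ (- (m * x) * + ℓ) ⟩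
        - (m * x) * + ℓ                                  ∎
        where
        eq : ∀ y m l x → y ≡ (y + m * l * x) + - (m * x) * l
        eq = ℤ-Solver.solve-∀

    -- Passing to the ℓ-th power gains a factor ℓ in the modulus and changes γ only by a multiple of
    -- ℓ. The derivative keeps its residue, so the argument can be repeated.
    lift : ∀ r m γ → α ^^ r ≡ ι 1ℤ ⊕ ι (m * + ℓ) ⊗ γ →
      ∃ λ γ₁ → α ^^ (r ℕ.* ℓ) ≡ ι 1ℤ ⊕ ι (m * + ℓ * + ℓ) ⊗ (γ ⊕ ιₙ ℓ ⊗ γ₁)
    lift r m γ α^r = γ₁ , (begin
      α ^^ (r ℕ.* ℓ)
        ≡⟨ trans (^^-* α r ℓ) (trans (cong (_^^ ℓ) α^r) (proj₂ expansion)) ⟩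
      ι 1ℤ ⊕ ι (m * + ℓ) ⊗ (ιₙ ℓ ⊗ γ ⊕ ι (m * + ℓ) ⊗ (ιₙ (triangular ℓ) ⊗ (γ ⊗ γ) ⊕ ι (m * + ℓ) ⊗ w))
        ≡⟨ cong₂ (λ x y → ι 1ℤ ⊕ x ⊗ (ιₙ ℓ ⊗ γ ⊕ x ⊗ (y ⊗ (γ ⊗ γ) ⊕ x ⊗ w))) (ι-* m (+ ℓ))
             (trans (cong ιₙ (triangular-ℓ h)) (ιₙ-* h ℓ)) ⟩
      ι 1ℤ ⊕ ι m ⊗ ιₙ ℓ ⊗ (ιₙ ℓ ⊗ γ ⊕ ι m ⊗ ιₙ ℓ ⊗ (ιₙ h ⊗ ιₙ ℓ ⊗ (γ ⊗ γ) ⊕ ι m ⊗ ιₙ ℓ ⊗ w))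
        ≡⟨ lift-factor (+ ℓ) (+ h) m γ w ⟩
      ι 1ℤ ⊕ ι m ⊗ ιₙ ℓ ⊗ ιₙ ℓ ⊗ (γ ⊕ ιₙ ℓ ⊗ γ₁)
        ≡⟨ cong (λ x → ι 1ℤ ⊕ x ⊗ (γ ⊕ ιₙ ℓ ⊗ γ₁)) (trans (ι-* (m * + ℓ) (+ ℓ)) (cong (_⊗ ιₙ ℓ) (ι-* m (+ ℓ)))) ⟨
      ι 1ℤ ⊕ ι (m * + ℓ * + ℓ) ⊗ (γ ⊕ ιₙ ℓ ⊗ γ₁) ∎)
      where
      open ≡-Reasoning
      expansion = binomial₂ (m * + ℓ) γ ℓ
      w = proj₁ expansion
      γ₁ = ι m ⊗ (ιₙ h ⊗ (γ ⊗ γ) ⊕ ι m ⊗ w)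

    ℓ∤lift : ∀ a γ γ₁ → ¬ (+ ℓ ℤ∣.∣ im (a ⊗ γ)) → ¬ (+ ℓ ℤ∣.∣ im (a ⊗ (γ ⊕ ιₙ ℓ ⊗ γ₁)))
    ℓ∤lift a γ γ₁ ℓ∤φ ℓ∣φ′ = ℓ∤φ (subst (+ ℓ ℤ∣.∣_)
      (trans (cong (_- + ℓ * im (a ⊗ γ₁)) φ′≡) (eq (im (a ⊗ γ)) (+ ℓ * im (a ⊗ γ₁))))
      (ℤ∣.∣m∣n⇒∣m-n ℓ∣φ′ (ℤ∣.divides (im (a ⊗ γ₁)) (*-comm (+ ℓ) (im (a ⊗ γ₁))))))
      where
      φ′≡ : im (a ⊗ (γ ⊕ ιₙ ℓ ⊗ γ₁)) ≡ im (a ⊗ γ) + + ℓ * im (a ⊗ γ₁)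
      φ′≡ = trans (cong im (expand₃ a γ (ιₙ ℓ) γ₁)) (trans (im-⊕ (a ⊗ γ) (ιₙ ℓ ⊗ (a ⊗ γ₁)))
        (cong (λ y → im (a ⊗ γ) + y) (im-ι⊗ (+ ℓ) (a ⊗ γ₁))))
      eq : ∀ x y → x + y - y ≡ x
      eq = ℤ-Solver.solve-∀

    -- Descent on t: while ℓ divides t, `lift` moves a factor ℓ from t into the period. Since t is
    -- positive, `isolated-coprime` applies in the end.
    isolated : ∀ c t → Acc _<_ t → ∀ r m γ → m ≢ 0ℤ → α ^^ r ≡ ι 1ℤ ⊕ ι (m * + ℓ) ⊗ γ →
      ¬ (+ ℓ ℤ∣.∣ im (α ^^ c ⊗ γ)) → 0 < t → U (c ℕ.+ r ℕ.* t) ≢ U c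
    isolated c t (acc rec) r m γ m≢0 α^r ℓ∤φ 0<t = by-cases (ℓ ℕ∣.∣? t)
      where
      1<ℓ : 1 < ℓ
      1<ℓ = ℕ.nonTrivial⇒n>1 ℓ {{prime⇒nonTrivial ℓ-prime}}
      mℓ≢0 : m * + ℓ ≢ 0ℤ
      mℓ≢0 mℓ≡0 = [ m≢0 , (λ ()) ]′ (i*j≡0⇒i≡0∨j≡0 m mℓ≡0)
      γ₁ = proj₁ (lift r m γ α^r)
      by-cases : Dec (ℓ ℕ∣.∣ t) → U (c ℕ.+ r ℕ.* t) ≢ U c
      by-cases (no ℓ∤t) = isolated-coprime c t r m γ m≢0 α^r ℓ∤φ ℓ∤t
      by-cases (yes (ℕ∣.divides u t≡uℓ)) U≡ = isolated c u (rec u<t) (r ℕ.* ℓ) (m * + ℓ) (γ ⊕ ιₙ ℓ ⊗ γ₁) mℓ≢0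
        (proj₂ (lift r m γ α^r)) (ℓ∤lift (α ^^ c) γ γ₁ ℓ∤φ) 0<u
        (trans (cong (λ k → U (c ℕ.+ k)) (trans (ℕ.*-assoc r ℓ u) (cong (r ℕ.*_) (trans (ℕ.*-comm ℓ u) (sym t≡uℓ))))) U≡)
        where
        0<u : 0 < u
        0<u = ℕ.n≢0⇒n>0 (λ u≡0 → ℕ.<⇒≢ 0<t (sym (trans t≡uℓ (cong (ℕ._* ℓ) u≡0))))
        u<t : u < t
        u<t = subst (u <_) (sym t≡uℓ) (ℕ.m<m*n u ℓ {{ℕ.>-nonZero 0<u}} 1<ℓ)

  -- U (c + r) - U c is ℓ φ modulo ℓ², so the condition on the derivative φ can be tested on two
  -- terms of the sequence modulo ℓ².
  U-isolated : ∀ c r γ → α ^^ r ≡ ι 1ℤ ⊕ ιₙ ℓ ⊗ γ → ¬ (+ ℓ * + ℓ ℤ∣.∣ U (c ℕ.+ r) - U c) →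
    ∀ t → U (c ℕ.+ r ℕ.* suc t) ≢ U c
  U-isolated c r γ α^r ℓ²∤ t = isolated c (suc t) (<-wellFounded (suc t)) r 1ℤ γ (λ ())
    (trans α^r (cong (λ i → ι 1ℤ ⊕ ι i ⊗ γ) (sym (*-identityˡ (+ ℓ))))) ℓ∤φ ℕ.z<s
    where
    φ = im (α ^^ c ⊗ γ)
    ℓ∤φ : ¬ (+ ℓ ℤ∣.∣ φ)
    ℓ∤φ (ℤ∣.divides k φ≡kℓ) = ℓ²∤ (ℤ∣.divides (k + x) (begin
      U (c ℕ.+ r) - U c                                    ≡⟨ cong (λ n → U (c ℕ.+ n) - U c) (ℕ.*-identityʳ r) ⟨
      U (c ℕ.+ r ℕ.* 1) - U c                              ≡⟨ cong (_- U c) (proj₂ expansion) ⟩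
      U c + + ℓ * (1ℤ * φ + + ℓ * x) - U c                 ≡⟨ cong (λ φ → U c + + ℓ * (1ℤ * φ + + ℓ * x) - U c) φ≡kℓ ⟩
      U c + + ℓ * (1ℤ * (k * + ℓ) + + ℓ * x) - U c         ≡⟨ eq (U c) (+ ℓ) k x ⟩
      (k + x) * (+ ℓ * + ℓ)                                ∎))
      where
      open ≡-Reasoning
      expansion = U-expand c r 1 (+ ℓ) γ α^r
      x = proj₁ expansion
      eq : ∀ u l k x → u + l * (1ℤ * (k * l) + l * x) - u ≡ (k + x) * (l * l)
      eq = ℤ-Solver.solve-∀

  U-periodic : ∀ c r γ → α ^^ r ≡ ι 1ℤ ⊕ ιₙ ℓ ⊗ γ → ∀ t → + ℓ ℤ∣.∣ U (c ℕ.+ r ℕ.* t) - U c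
  U-periodic c r γ α^r t = ℤ∣.divides (+ t * im (α ^^ c ⊗ γ) + + ℓ * x)
    (trans (cong (_- U c) (proj₂ expansion)) (eq (U c) (+ ℓ) (+ t * im (α ^^ c ⊗ γ) + + ℓ * x)))
    where
    expansion = U-expand c r t (+ ℓ) γ α^r
    x = proj₁ expansion
    eq : ∀ u l y → u + l * y - u ≡ y * l
    eq = ℤ-Solver.solve-∀

-- Multiples of 2 and 3 have to be left out, because `U 2 = s` and `U 3 = s² - Q` can be ± 1, for
-- instance when s = 1 and Q = 2. With a period divisible by 6 this is a condition on the residue
-- class.
coprime-6 : ℕ → Bool
coprime-6 c = (c ℕ.% 6 ≡ᵇ 1) ∨ (c ℕ.% 6 ≡ᵇ 5)

-- Residues are taken modulo suc ℓ′ and suc M′, with suc M′ the square of suc ℓ′; M′ * Q stands for - Q.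
module _ (ℓ′ M′ s Q : ℕ) (E : List ℕ) where

  next : ℕ → ℕ → ℕ
  next a b = (s ℕ.* b ℕ.+ M′ ℕ.* Q ℕ.* a) ℕ.% suc M′

  iterate : ℕ → ℕ → ℕ → ℕ
  iterate zero a b = a
  iterate (suc n) a b = iterate n b (next a b)

  -- Adding `ℓ′` subtracts 1 modulo `suc ℓ′`, so the two tests are a ≡ 1 and a ≡ -1.
  ±unit : ℕ → Bool
  ±unit a = ((a ℕ.+ ℓ′) ℕ.% suc ℓ′ ≡ᵇ 0) ∨ ((a ℕ.+ 1) ℕ.% suc ℓ′ ≡ᵇ 0)

  admissible : ℕ → ℕ → Bool
  admissible c a = not (coprime-6 c) ∨ (not (±unit a) ∨ any (_≡ᵇ c) E)

  -- Reached with the terms of index r and r + 1: the first two tests give αʳ ≡ 1 modulo ℓ, and the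
  -- last is the hypothesis of `U-isolated` for every index in `E`.
  final : ℕ → ℕ → Bool
  final a b = (a ℕ.% suc ℓ′ ≡ᵇ 0) ∧ (((b ℕ.+ ℓ′) ℕ.% suc ℓ′ ≡ᵇ 0) ∧
    all (λ e → not ((iterate e a b ℕ.+ M′ ℕ.* iterate e 0 1) ℕ.% suc M′ ≡ᵇ 0)) E)

  walk : ℕ → ℕ → ℕ → ℕ → Bool
  walk zero c a b = final a b
  walk (suc k) c a b = admissible c a ∧ walk k (suc c) b (next a b)

-- One walk modulo ℓ² = 4 h (h + 1) + 1 serves both purposes: reduced modulo ℓ, its terms reveal
-- units and the period, while the full residues decide isolation.
sieve : ℕ → ℕ → ℕ → ℕ → List ℕ → Bool
sieve h k s Q E = walk (h ℕ.+ h) (4 ℕ.* h ℕ.* suc h) s Q E (suc k ℕ.* 6) 0 0 1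

private
  T-∧⁻ : ∀ {x y} → T (x ∧ y) → T x × T y
  T-∧⁻ = Equivalence.to T-∧

  T-∨⁻ : ∀ {x y} → T (x ∨ y) → T x ⊎ T y
  T-∨⁻ = Equivalence.to T-∨

  T-∨⁺ : ∀ {x y} → T x ⊎ T y → T (x ∨ y)
  T-∨⁺ = Equivalence.from T-∨

  ∣⇒T : ∀ {m n} → suc n ℕ∣.∣ m → T (m ℕ.% suc n ≡ᵇ 0)
  ∣⇒T {m} {n} n∣m = ℕ.≡⇒≡ᵇ (m ℕ.% suc n) 0 (ℕ∣.n∣m⇒m%n≡0 m (suc n) n∣m)

  T⇒∣ : ∀ {m n} → T (m ℕ.% suc n ≡ᵇ 0) → suc n ℕ∣.∣ m
  T⇒∣ {m} {n} t = ℕ∣.m%n≡0⇒n∣m m (suc n) (ℕ.≡ᵇ⇒≡ (m ℕ.% suc n) 0 t)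

  ∣+ : ∀ {k i j} → k ℤ∣.∣ i → k ℤ∣.∣ j → k ℤ∣.∣ i + j
  ∣+ {k} (ℤ∣.divides x refl) (ℤ∣.divides y refl) = ℤ∣.divides (x + y) (sym (*-distribʳ-+ k x y))

  ∣* : ∀ {k i} j → k ℤ∣.∣ i → k ℤ∣.∣ j * i
  ∣* {k} j (ℤ∣.divides x refl) = ℤ∣.divides (j * x) (sym (*-assoc j x k))

module SieveSoundness (h k s Q : ℕ) (E : List ℕ) (ℓ-prime : Prime (suc (h ℕ.+ h))) where

  open QuadRing (+ s) (+ Q) using (U; O; α; _^^_; ι; ιₙ; _⊕_; _⊗_; α^^; ι-*)
  open Lifting (+ s) (+ Q) h ℓ-prime

  private
    M′ = 4 ℕ.* h ℕ.* suc h
    M = suc M′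

    M≡ℓ² : + M ≡ + ℓ * + ℓ
    M≡ℓ² = trans (cong +_ (eq h)) (pos-* ℓ ℓ)
      where
      eq : ∀ h → suc (4 ℕ.* h ℕ.* suc h) ≡ suc (h ℕ.+ h) ℕ.* suc (h ℕ.+ h)
      eq = ℕ-Solver.solve-∀

    infix 4 _≋_
    _≋_ : ℕ → ℤ → Set
    a ≋ x = + M ℤ∣.∣ + a - x

    ℓ∣M : + ℓ ℤ∣.∣ + M
    ℓ∣M = ℤ∣.divides (+ ℓ) M≡ℓ²

    %≋ : ∀ m x → m ≋ x → m ℕ.% M ≋ x
    %≋ m x (ℤ∣.divides y m-x≡yM) = ℤ∣.divides (y - + (m ℕ./ M)) (begin
      + (m ℕ.% M) - x
        ≡⟨ eq₁ (+ (m ℕ.% M)) (+ (m ℕ./ M)) (+ M) x ⟩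
      + (m ℕ.% M) + + (m ℕ./ M) * + M - x - + (m ℕ./ M) * + M
        ≡⟨ cong (λ z → + (m ℕ.% M) + z - x - + (m ℕ./ M) * + M) (pos-* (m ℕ./ M) M) ⟨
      + (m ℕ.% M ℕ.+ m ℕ./ M ℕ.* M) - x - + (m ℕ./ M) * + M
        ≡⟨ cong (λ z → + z - x - + (m ℕ./ M) * + M) (ℕ.m≡m%n+[m/n]*n m M) ⟨
      + m - x - + (m ℕ./ M) * + M
        ≡⟨ cong (_- + (m ℕ./ M) * + M) m-x≡yM ⟩
      y * + M - + (m ℕ./ M) * + M
        ≡⟨ eq₂ y (+ (m ℕ./ M)) (+ M) ⟩
      (y - + (m ℕ./ M)) * + M ∎)
      where
      open ≡-Reasoning
      eq₁ : ∀ a b c x → a - x ≡ a + b * c - x - b * c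
      eq₁ = ℤ-Solver.solve-∀
      eq₂ : ∀ a b c → a * c - b * c ≡ (a - b) * c
      eq₂ = ℤ-Solver.solve-∀

    next≋ : ∀ a b x y → a ≋ x → b ≋ y → next (h ℕ.+ h) M′ s Q E a b ≋ + s * y - + Q * x
    next≋ a b x y a≋x b≋y = %≋ (s ℕ.* b ℕ.+ M′ ℕ.* Q ℕ.* a) (+ s * y - + Q * x)
      (subst (+ M ℤ∣.∣_) (sym eq) (∣+ (∣+ (∣* (+ s) b≋y) (∣* (- + Q) a≋x)) (ℤ∣.divides (+ Q * + a) refl)))
      where
      eq′ : ∀ s b m q a x y → s * b + m * q * a - (s * y - q * x) ≡
        s * (b - y) + - q * (a - x) + q * a * (1ℤ + m)
      eq′ = ℤ-Solver.solve-∀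
      eq : + (s ℕ.* b ℕ.+ M′ ℕ.* Q ℕ.* a) - (+ s * y - + Q * x) ≡
        + s * (+ b - y) + - + Q * (+ a - x) + + Q * + a * + M
      eq = trans (cong₂ (λ u v → u + v - (+ s * y - + Q * x)) (pos-* s b)
        (trans (pos-* (M′ ℕ.* Q) a) (cong (_* + a) (pos-* M′ Q)))) (eq′ (+ s) (+ b) (+ M′) (+ Q) (+ a) x y)

    iterate≋ : ∀ e n a b → a ≋ U n → b ≋ U (suc n) → iterate (h ℕ.+ h) M′ s Q E e a b ≋ U (e ℕ.+ n)
    iterate≋ zero n a b a≋ b≋ = a≋
    iterate≋ (suc e) n a b a≋ b≋ = subst (λ m → iterate (h ℕ.+ h) M′ s Q E (suc e) a b ≋ U m) (ℕ.+-suc e n)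
      (iterate≋ e (suc n) b (next (h ℕ.+ h) M′ s Q E a b) b≋ (next≋ a b (U n) (U (suc n)) a≋ b≋))

    Good : ℕ → Set
    Good c = T (coprime-6 c) → ¬ (+ ℓ ℤ∣.∣ U c - 1ℤ) × ¬ (+ ℓ ℤ∣.∣ U c + 1ℤ) ⊎ c ∈ E

    ℓ∣shift : ∀ a x y → a ≋ x → + ℓ ℤ∣.∣ x + y → + ℓ ℤ∣.∣ + a + y
    ℓ∣shift a x y a≋x ℓ∣x+y = subst (+ ℓ ℤ∣.∣_) (eq (+ a) x y) (∣+ (ℤ∣.∣-trans ℓ∣M a≋x) ℓ∣x+y)
      where
      eq : ∀ a x y → a - x + (x + y) ≡ a + y
      eq = ℤ-Solver.solve-∀

    ℓ∣shift⁻ : ∀ a x y → a ≋ x → + ℓ ℤ∣.∣ + a + y → + ℓ ℤ∣.∣ x + y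
    ℓ∣shift⁻ a x y a≋x ℓ∣a+y = subst (+ ℓ ℤ∣.∣_) (eq (+ a) x y) (ℤ∣.∣m∣n⇒∣m-n ℓ∣a+y (ℤ∣.∣-trans ℓ∣M a≋x))
      where
      eq : ∀ a x y → a + y - (a - x) ≡ x + y
      eq = ℤ-Solver.solve-∀

    pred-shift : ∀ a → + (a ℕ.+ (h ℕ.+ h)) ≡ + a + -1ℤ + + ℓ
    pred-shift a = eq (+ a) (+ (h ℕ.+ h))
      where
      eq : ∀ a x → a + x ≡ a + -1ℤ + (1ℤ + x)
      eq = ℤ-Solver.solve-∀

    admissible-sound : ∀ c a → a ≋ U c → T (admissible (h ℕ.+ h) M′ s Q E c a) → Good c
    admissible-sound c a a≋ t coprime = [ (λ n → contradiction coprime (T-not⁻ {coprime-6 c} n)) , [ units , listed ]′ ∘ T-∨⁻ {not (±unit (h ℕ.+ h) M′ s Q E a)} ]′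
      (T-∨⁻ {not (coprime-6 c)} t)
      where
      units : T (not (±unit (h ℕ.+ h) M′ s Q E a)) → ¬ (+ ℓ ℤ∣.∣ U c - 1ℤ) × ¬ (+ ℓ ℤ∣.∣ U c + 1ℤ) ⊎ c ∈ E
      units n = inj₁
        ( (λ ℓ∣ → T-not⁻ {±unit (h ℕ.+ h) M′ s Q E a} n (T-∨⁺ (inj₁ (∣⇒T (ℤ∣.∣⇒∣ᵤ (subst (+ ℓ ℤ∣.∣_) (sym (pred-shift a))
            (∣+ (ℓ∣shift a (U c) -1ℤ a≋ ℓ∣) ℤ∣.∣-refl)))))))
        , (λ ℓ∣ → T-not⁻ {±unit (h ℕ.+ h) M′ s Q E a} n (T-∨⁺ {(a ℕ.+ (h ℕ.+ h)) ℕ.% ℓ ≡ᵇ 0} (inj₂ (∣⇒T (ℤ∣.∣⇒∣ᵤ (ℓ∣shift a (U c) 1ℤ a≋ ℓ∣)))))) )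
      listed : T (any (_≡ᵇ c) E) → ¬ (+ ℓ ℤ∣.∣ U c - 1ℤ) × ¬ (+ ℓ ℤ∣.∣ U c + 1ℤ) ⊎ c ∈ E
      listed t = inj₂ (Any.map (λ {e} t → sym (ℕ.≡ᵇ⇒≡ e c t)) (any⁻ (_≡ᵇ c) E t))

    walk-sound : ∀ n c a b → a ≋ U c → b ≋ U (suc c) → T (walk (h ℕ.+ h) M′ s Q E n c a b) →
      (∀ i → i < n → Good (i ℕ.+ c)) ×
      ∃₂ λ a b → a ≋ U (n ℕ.+ c) × b ≋ U (suc n ℕ.+ c) × T (final (h ℕ.+ h) M′ s Q E a b)
    walk-sound zero c a b a≋ b≋ t = (λ i ()) , a , b , a≋ , b≋ , t
    walk-sound (suc n) c a b a≋ b≋ t = good , a′ , b′ ,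
      subst (λ m → a′ ≋ U m) (ℕ.+-suc n c) a′≋ , subst (λ m → b′ ≋ U m) (cong suc (ℕ.+-suc n c)) b′≋ , t′
      where
      split = T-∧⁻ {admissible (h ℕ.+ h) M′ s Q E c a} t
      rest = walk-sound n (suc c) b (next (h ℕ.+ h) M′ s Q E a b) b≋ (next≋ a b (U c) (U (suc c)) a≋ b≋) (proj₂ split)
      a′ = proj₁ (proj₂ rest)
      b′ = proj₁ (proj₂ (proj₂ rest))
      a′≋ = proj₁ (proj₂ (proj₂ (proj₂ rest)))
      b′≋ = proj₁ (proj₂ (proj₂ (proj₂ (proj₂ rest))))
      t′ = proj₂ (proj₂ (proj₂ (proj₂ (proj₂ rest))))
      good : ∀ i → i < suc n → Good (i ℕ.+ c)
      good zero _ = admissible-sound c a a≋ (proj₁ split)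
      good (suc i) (ℕ.s≤s i<n) = subst Good (ℕ.+-suc i c) (proj₁ rest i i<n)

    zero≋ : 0 ≋ U 0
    zero≋ = ℤ∣.divides 0ℤ refl

    one≋ : 1 ≋ U 1
    one≋ = ℤ∣.divides 0ℤ refl

    r = suc k ℕ.* 6

  -- Let c be the remainder of q modulo r. It is again prime to 6, and `U c` is ± 1 modulo ℓ, so c
  -- is listed in `E`. Then `U q = U c` holds exactly, and isolation leaves only q = c.
  sieve-sound : T (sieve h k s Q E) → All (λ e → ∣ U e ∣ ≡ 1) E →
    ∀ q → T (coprime-6 q) → ∣ U q ∣ ≡ 1 → q ∈ E
  sieve-sound t units q coprime ∣Uq∣≡1 = [ (λ p → ⊥-elim (not-unit (proj₁ p) (proj₂ p))) , isolated-at ]′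
    (good c c<r (subst (λ x → T ((x ≡ᵇ 1) ∨ (x ≡ᵇ 5))) (sym c%6≡q%6) coprime))
    where
    walked = walk-sound r 0 0 1 zero≋ one≋ t
    c = q ℕ.% r
    u = q ℕ./ r
    a = proj₁ (proj₂ walked)
    b = proj₁ (proj₂ (proj₂ walked))
    a≋ : a ≋ U r
    a≋ = subst (λ m → a ≋ U m) (ℕ.+-identityʳ r) (proj₁ (proj₂ (proj₂ (proj₂ walked))))
    b≋ : b ≋ U (suc r)
    b≋ = subst (λ m → b ≋ U m) (ℕ.+-identityʳ (suc r)) (proj₁ (proj₂ (proj₂ (proj₂ (proj₂ walked)))))
    fin = T-∧⁻ {a ℕ.% ℓ ≡ᵇ 0} (proj₂ (proj₂ (proj₂ (proj₂ (proj₂ walked)))))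
    fin′ = T-∧⁻ {(b ℕ.+ (h ℕ.+ h)) ℕ.% ℓ ≡ᵇ 0} (proj₂ fin)
    good : ∀ i → i < r → Good i
    good i i<r = subst Good (ℕ.+-identityʳ i) (proj₁ walked i i<r)
    c<r : c < r
    c<r = ℕ.m%n<n q r
    c%6≡q%6 : c ℕ.% 6 ≡ q ℕ.% 6
    c%6≡q%6 = ℕ.m∣n⇒o%n%m≡o%m 6 r q (ℕ∣.n∣m*n (suc k))
    q≡ : q ≡ c ℕ.+ r ℕ.* u
    q≡ = trans (ℕ.m≡m%n+[m/n]*n q r) (cong (c ℕ.+_) (ℕ.*-comm u r))

    ℓ∣Ur : + ℓ ℤ∣.∣ U r
    ℓ∣Ur = subst (+ ℓ ℤ∣.∣_) (+-identityʳ (U r)) (ℓ∣shift⁻ a (U r) 0ℤ a≋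
      (subst (+ ℓ ℤ∣.∣_) (sym (+-identityʳ (+ a))) (ℤ∣.∣ᵤ⇒∣ (T⇒∣ {a} {h ℕ.+ h} (proj₁ fin)))))
    ℓ∣U[1+r]-1 : + ℓ ℤ∣.∣ U (suc r) + -1ℤ
    ℓ∣U[1+r]-1 = ℓ∣shift⁻ b (U (suc r)) -1ℤ b≋ (subst (+ ℓ ℤ∣.∣_)
      (trans (cong (_- + ℓ) (pred-shift b)) (eq (+ b + -1ℤ) (+ ℓ)))
      (ℤ∣.∣m∣n⇒∣m-n {i = + ℓ} {m = + (b ℕ.+ (h ℕ.+ h))} {n = + ℓ} (ℤ∣.∣ᵤ⇒∣ (T⇒∣ {b ℕ.+ (h ℕ.+ h)} {h ℕ.+ h} (proj₁ fin′))) ℤ∣.∣-refl))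
      where
      eq : ∀ x l → x + l - l ≡ x
      eq = ℤ-Solver.solve-∀

    period : ∃ λ γ → α ^^ r ≡ ι 1ℤ ⊕ ιₙ ℓ ⊗ γ
    period = from-divides ℓ∣Ur ℓ∣U[1+r]-1
      where
      from-divides : + ℓ ℤ∣.∣ U r → + ℓ ℤ∣.∣ U (suc r) + -1ℤ → ∃ λ γ → α ^^ r ≡ ι 1ℤ ⊕ ιₙ ℓ ⊗ γ
      -- The recurrence turns the constant term - Q U (r - 1) of αʳ into U (r + 1) - s U r, which is
      -- 1 + ℓ (x - s y).
      from-divides (ℤ∣.divides y Ur≡) (ℤ∣.divides x U[1+r]≡) = ((x - + s * y) +α y) ,
        trans (α^^ (ℕ.pred r)) (cong₂ _+α_
          (begin
            - (+ Q * V)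
              ≡⟨ eq₁ (+ s) (+ Q) (U r) V ⟩
            (+ s * U r - + Q * V + -1ℤ) + 1ℤ - + s * U r
              ≡⟨ cong₂ (λ i j → i + 1ℤ - + s * j) U[1+r]≡ Ur≡ ⟩
            x * + ℓ + 1ℤ - + s * (y * + ℓ)
              ≡⟨ eq₂ (+ s) (+ Q) (+ ℓ) x y ⟩
            1ℤ + (+ ℓ * (x - + s * y) - 0ℤ * y * + Q) ∎)
          (trans Ur≡ (eq₃ (+ s) (+ ℓ) x y)))
        where
        open ≡-Reasoning
        V = U (ℕ.pred r)
        eq₁ : ∀ s q u v → - (q * v) ≡ (s * u - q * v + -1ℤ) + 1ℤ - s * u
        eq₁ = ℤ-Solver.solve-∀
        eq₂ : ∀ s q l x y → x * l + 1ℤ - s * (y * l) ≡ 1ℤ + (l * (x - s * y) - 0ℤ * y * q)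
        eq₂ = ℤ-Solver.solve-∀
        eq₃ : ∀ s l x y → y * l ≡ 0ℤ + (l * y + 0ℤ * (x - s * y) + 0ℤ * y * s)
        eq₃ = ℤ-Solver.solve-∀
    γ = proj₁ period
    α^r = proj₂ period

    ℓ∣Uq-Uc : + ℓ ℤ∣.∣ U q - U c
    ℓ∣Uq-Uc = subst (λ m → + ℓ ℤ∣.∣ U m - U c) (sym q≡) (U-periodic c r γ α^r u)

    not-unit : ¬ (+ ℓ ℤ∣.∣ U c - 1ℤ) → ¬ (+ ℓ ℤ∣.∣ U c + 1ℤ) → ⊥
    not-unit ∤₁ ∤₂ = [ (λ Uq≡ → ∤₁ (flip Uq≡)) , (λ Uq≡ → ∤₂ (flip Uq≡)) ]′ (∣i∣≡1⇒i≡±1 (U q) ∣Uq∣≡1)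
      where
      flip : ∀ {ε} → U q ≡ ε → + ℓ ℤ∣.∣ U c - ε
      flip refl = subst (+ ℓ ℤ∣.∣_) (eq (U q) (U c)) (∣* -1ℤ ℓ∣Uq-Uc)
        where
        eq : ∀ x y → -1ℤ * (x - y) ≡ y - x
        eq = ℤ-Solver.solve-∀

    ℓ∤2 : ¬ (ℓ ℕ∣.∣ 2)
    ℓ∤2 ℓ∣2 = odd h (ℕ.nonTrivial⇒n>1 ℓ {{prime⇒nonTrivial ℓ-prime}}) (ℕ∣.∣⇒≤ ℓ∣2)
      where
      odd : ∀ h → 1 < suc (h ℕ.+ h) → suc (h ℕ.+ h) ≤ 2 → ⊥
      odd zero (ℕ.s≤s ()) _
      odd (suc h) _ (ℕ.s≤s (ℕ.s≤s h+1+h≤0)) = ℕ.m+1+n≢0 h (ℕ.n≤0⇒n≡0 h+1+h≤0)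

    isolated-at : c ∈ E → q ∈ E
    isolated-at c∈E = at u refl
      where
      -- Both are ± 1 and they agree modulo ℓ; they are equal because ℓ does not divide 2.
      Uq≡Uc : U q ≡ U c
      Uq≡Uc = same (∣i∣≡1⇒i≡±1 (U q) ∣Uq∣≡1) (∣i∣≡1⇒i≡±1 (U c) (All.lookup units c∈E))
        where
        same : U q ≡ 1ℤ ⊎ U q ≡ -1ℤ → U c ≡ 1ℤ ⊎ U c ≡ -1ℤ → U q ≡ U c
        same (inj₁ x) (inj₁ y) = trans x (sym y)
        same (inj₂ x) (inj₂ y) = trans x (sym y)
        same (inj₁ x) (inj₂ y) = contradiction (ℤ∣.∣⇒∣ᵤ (subst (+ ℓ ℤ∣.∣_) (cong₂ _-_ x y) ℓ∣Uq-Uc)) ℓ∤2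
        same (inj₂ x) (inj₁ y) = contradiction (ℤ∣.∣⇒∣ᵤ (subst (+ ℓ ℤ∣.∣_) (cong₂ _-_ x y) ℓ∣Uq-Uc)) ℓ∤2
      ℓ²∤ : ¬ (+ ℓ * + ℓ ℤ∣.∣ U (c ℕ.+ r) - U c)
      ℓ²∤ ℓ²∣ = T-not⁻ (All.lookup (all⁺ _ E (proj₂ fin′)) c∈E)
        (∣⇒T (ℤ∣.∣⇒∣ᵤ (subst (+ M ℤ∣.∣_) (sym eq)
          (∣+ (∣+ (∣+ (iterate≋ c r a b a≋ b≋) (∣* -1ℤ x≋)) (subst (ℤ∣._∣ U (c ℕ.+ r) - U c) (sym M≡ℓ²) ℓ²∣))
            (ℤ∣.divides (+ x) refl)))))
        where
        y = iterate (h ℕ.+ h) M′ s Q E c a b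
        x = iterate (h ℕ.+ h) M′ s Q E c 0 1
        x≋ : x ≋ U c
        x≋ = subst (λ m → x ≋ U m) (ℕ.+-identityʳ c) (iterate≋ c 0 0 1 zero≋ one≋)
        eq′ : ∀ y x m v w → y + m * x ≡ (y - v) + -1ℤ * (x - w) + (v - w) + x * (1ℤ + m)
        eq′ = ℤ-Solver.solve-∀
        eq : + (y ℕ.+ M′ ℕ.* x) ≡ (+ y - U (c ℕ.+ r)) + -1ℤ * (+ x - U c) + (U (c ℕ.+ r) - U c) + + x * + M
        eq = trans (cong (λ z → + y + z) (pos-* M′ x)) (eq′ (+ y) (+ x) (+ M′) (U (c ℕ.+ r)) (U c))
      at : ∀ v → u ≡ v → q ∈ E
      at zero u≡0 = subst (_∈ E) (sym (trans q≡ (trans (cong (λ v → c ℕ.+ r ℕ.* v) u≡0)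
        (trans (cong (c ℕ.+_) (ℕ.*-zeroʳ r)) (ℕ.+-identityʳ c))))) c∈E
      at (suc v) u≡1+v = contradiction (trans (cong U (sym (trans q≡ (cong (λ v → c ℕ.+ r ℕ.* v) u≡1+v)))) Uq≡Uc)
        (U-isolated c r γ α^r ℓ²∤ v)

-- Finite tables of primes for the remaining traces

covered : List (ℕ × ℕ) → ℕ → ℕ → ℕ → Bool
covered table D s zero = true
covered table D s (suc n) =
  -- The list `1 ∷ []` admits only the trivial index, and the norm (s² + D) / 4 is determined by the
  -- trace.
  any (λ (h , k) → sieve h k s ((s ℕ.* s ℕ.+ D) ℕ./ 4) (1 ∷ [])) table ∧ covered table D (2 ℕ.+ s) n

-- An entry (h , k) stands for the prime 2h + 1 with period 6(k + 1), which was found by a computer search.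
table₃ : List (ℕ × ℕ)
table₃ = (3 , 0) ∷ (6 , 1) ∷ (9 , 2) ∷ (15 , 4) ∷ (18 , 5) ∷ (33 , 10) ∷ (63 , 20) ∷ []

primes₃ : All (λ (h , k) → Prime (suc (h ℕ.+ h))) table₃
primes₃ = from-yes (All.all? (λ (h , k) → prime? (suc (h ℕ.+ h))) table₃)

table₇ : List (ℕ × ℕ)
table₇ = (18 , 5) ∷ (33 , 10) ∷ (63 , 20) ∷ (75 , 24) ∷ (39 , 0) ∷ (18 , 1) ∷ (75 , 4) ∷ (96 , 31) ∷ (105 , 34) ∷ []

primes₇ : All (λ (h , k) → Prime (suc (h ℕ.+ h))) table₇
primes₇ = from-yes (All.all? (λ (h , k) → prime? (suc (h ℕ.+ h))) table₇)

table₈ : List (ℕ × ℕ)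
table₈ = (9 , 2) ∷ (21 , 6) ∷ (48 , 15) ∷ (69 , 22) ∷ (81 , 26) ∷ (81 , 8) ∷ (36 , 5) ∷ (156 , 51) ∷ []

primes₈ : All (λ (h , k) → Prime (suc (h ℕ.+ h))) table₈
primes₈ = from-yes (All.all? (λ (h , k) → prime? (suc (h ℕ.+ h))) table₈)

table₁₁ : List (ℕ × ℕ)
table₁₁ = (15 , 4) ∷ (33 , 10) ∷ (51 , 16) ∷ (18 , 2) ∷ (15 , 0) ∷ (18 , 0) ∷ (48 , 15) ∷ (78 , 25) ∷ (78 , 12) ∷ (90 , 29) ∷ []

primes₁₁ : All (λ (h , k) → Prime (suc (h ℕ.+ h))) table₁₁
primes₁₁ = from-yes (All.all? (λ (h , k) → prime? (suc (h ℕ.+ h))) table₁₁)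

table₁₉ : List (ℕ × ℕ)
table₁₉ = (3 , 0) ∷ (21 , 6) ∷ (69 , 22) ∷ (78 , 25) ∷ (81 , 26) ∷ (99 , 32) ∷ (114 , 37) ∷ []

primes₁₉ : All (λ (h , k) → Prime (suc (h ℕ.+ h))) table₁₉
primes₁₉ = from-yes (All.all? (λ (h , k) → prime? (suc (h ℕ.+ h))) table₁₉)

table₄₃ : List (ℕ × ℕ)
table₄₃ = (6 , 1) ∷ (15 , 4) ∷ (33 , 10) ∷ (39 , 12) ∷ (51 , 16) ∷ (54 , 17) ∷ (135 , 44) ∷ []

primes₄₃ : All (λ (h , k) → Prime (suc (h ℕ.+ h))) table₄₃
primes₄₃ = from-yes (All.all? (λ (h , k) → prime? (suc (h ℕ.+ h))) table₄₃)

table₆₇ : List (ℕ × ℕ)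
table₆₇ = (9 , 2) ∷ (18 , 5) ∷ (36 , 11) ∷ (51 , 16) ∷ (63 , 20) ∷ (75 , 24) ∷ (78 , 25) ∷ (81 , 26) ∷ (99 , 32) ∷ []

primes₆₇ : All (λ (h , k) → Prime (suc (h ℕ.+ h))) table₆₇
primes₆₇ = from-yes (All.all? (λ (h , k) → prime? (suc (h ℕ.+ h))) table₆₇)

table₁₆₃ : List (ℕ × ℕ)
table₁₆₃ = (21 , 6) ∷ (30 , 9) ∷ (30 , 4) ∷ (48 , 15) ∷ (75 , 24) ∷ (75 , 4) ∷ (99 , 32) ∷ (111 , 36) ∷ (153 , 50) ∷ (183 , 60) ∷ (198 , 10) ∷ (198 , 32) ∷ (198 , 65) ∷ []

primes₁₆₃ : All (λ (h , k) → Prime (suc (h ℕ.+ h))) table₁₆₃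
primes₁₆₃ = from-yes (All.all? (λ (h , k) → prime? (suc (h ℕ.+ h))) table₁₆₃)

-- Class number one

-- A form (A, B, C) of discriminant - D is encoded by A = 2 + i and b = ∣ B ∣; the second test says A ≤ C.
not-reduced : ℕ → ℕ → ℕ → Bool
not-reduced D i b = not ((b ≤ᵇ 2 ℕ.+ i) ∧ ((4 ℕ.* ((2 ℕ.+ i) ℕ.* (2 ℕ.+ i)) ≤ᵇ b ℕ.* b ℕ.+ D) ∧
  ((b ℕ.* b ℕ.+ D) ℕ.% (4 ℕ.* (2 ℕ.+ i)) ≡ᵇ 0)))

-- A reduced form has 3 A² ≤ D ≤ 163, so A ≤ 7 and also ∣ B ∣ ≤ 7; hence the two ranges.
only-principal : ℕ → Bool
only-principal D = all (λ i → all (not-reduced D i) (upTo 8)) (upTo 6)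

module FormReduction (D : ℕ) (0<D : 0 < D) (D≤163 : D ≤ 163) (check : T (only-principal D)) where

  Represents-1 : ℤ → ℤ → ℤ → Set
  Represents-1 A B C = ∃₂ λ a b → A * (a * a) + B * (a * b) + C * (b * b) ≡ 1ℤ

  private
    reduced⇒A≡1 : ∀ A b C → 0 < A → b ≤ A → A ≤ C → 4 ℕ.* (A ℕ.* C) ≡ b ℕ.* b ℕ.+ D → A ≡ 1
    reduced⇒A≡1 0 b C () _ _ _
    reduced⇒A≡1 1 b C _ _ _ _ = refl
    reduced⇒A≡1 A@(suc (suc i)) b C _ b≤A A≤C 4AC≡ = ⊥-elim
      (T-not⁻ (All.lookup (all⁺ (not-reduced D i) (upTo 8) (All.lookup (all⁺ (λ i → all (not-reduced D i) (upTo 8)) (upTo 6) check) (∈-upTo⁺ i<6))) (∈-upTo⁺ (ℕ.≤-<-trans b≤A (ℕ.s≤s (ℕ.s≤s i<6)))))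
        (Equivalence.from T-∧ (ℕ.≤⇒≤ᵇ b≤A , Equivalence.from T-∧
          ( ℕ.≤⇒≤ᵇ (ℕ.≤-trans (ℕ.*-monoʳ-≤ 4 (ℕ.*-monoʳ-≤ A A≤C)) (ℕ.≤-reflexive 4AC≡))
          , ℕ.≡⇒≡ᵇ ((b ℕ.* b ℕ.+ D) ℕ.% (4 ℕ.* A)) 0 (ℕ∣.n∣m⇒m%n≡0 (b ℕ.* b ℕ.+ D) (4 ℕ.* A)
              (ℕ∣.divides C (trans (sym 4AC≡) (eq A C))))))))
      where
      eq : ∀ A C → 4 ℕ.* (A ℕ.* C) ≡ C ℕ.* (4 ℕ.* A)
      eq = ℕ-Solver.solve-∀
      4A²≤ : 4 ℕ.* (A ℕ.* A) ≤ A ℕ.* A ℕ.+ 163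
      4A²≤ = ℕ.≤-trans (ℕ.*-monoʳ-≤ 4 (ℕ.*-monoʳ-≤ A A≤C)) (ℕ.≤-trans (ℕ.≤-reflexive 4AC≡)
        (ℕ.+-mono-≤ (ℕ.*-mono-≤ b≤A b≤A) D≤163))
      i<6 : i < 6
      i<6 = by-cases (i ℕ.<? 6)
        where
        by-cases : Dec (i < 6) → i < 6
        by-cases (yes i<6) = i<6
        by-cases (no i≮6) = contradiction
          (ℕ.+-cancelˡ-≤ (A ℕ.* A) _ _ (subst (_≤ A ℕ.* A ℕ.+ 163) (eq′ (A ℕ.* A)) 4A²≤))
          (ℕ.<⇒≱ (ℕ.≤-trans (ℕ.≤ᵇ⇒≤ 164 192 tt) (ℕ.*-monoʳ-≤ 3 (ℕ.*-mono-≤ 8≤A 8≤A))))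
          where
          8≤A : 8 ≤ A
          8≤A = ℕ.s≤s (ℕ.s≤s (ℕ.≮⇒≥ i≮6))
          eq′ : ∀ x → 4 ℕ.* x ≡ x ℕ.+ 3 ℕ.* x
          eq′ = ℕ-Solver.solve-∀

    centred : ∀ A B → 0 < A → ∃ λ t → ∣ B + + 2 * + A * t ∣ ≤ A
    centred A@(suc _) B _ = by-cases (ρ ℕ.≤? A)
      where
      ρ = B %ℕ (2 ℕ.* A)
      k = B /ℕ (2 ℕ.* A)
      B≡ : B ≡ + ρ + k * (+ 2 * + A)
      B≡ = trans (a≡a%ℕn+[a/ℕn]*n B (2 ℕ.* A)) (cong (λ z → + ρ + k * z) (pos-* 2 A))
      eq₁ : ∀ r k a → r + k * (+ 2 * a) + + 2 * a * - k ≡ r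
      eq₁ = ℤ-Solver.solve-∀
      eq₂ : ∀ r k a → r + k * (+ 2 * a) + + 2 * a * (- k - 1ℤ) ≡ - (+ 2 * a - r)
      eq₂ = ℤ-Solver.solve-∀
      by-cases : Dec (ρ ≤ A) → ∃ λ t → ∣ B + + 2 * + A * t ∣ ≤ A
      by-cases (yes ρ≤A) = - k , subst (λ z → ∣ z ∣ ≤ A)
        (sym (trans (cong (λ z → z + + 2 * + A * - k) B≡) (eq₁ (+ ρ) k (+ A)))) ρ≤A
      by-cases (no ρ≰A) = - k - 1ℤ , subst (_≤ A) (sym abs≡) (ℕ.m≤n+o⇒m∸n≤o (2 ℕ.* A) ρ 2A≤ρ+A)
        where
        2A≤ρ+A : 2 ℕ.* A ≤ ρ ℕ.+ A
        2A≤ρ+A = subst (_≤ ρ ℕ.+ A) (sym (cong (A ℕ.+_) (ℕ.+-identityʳ A))) (ℕ.+-monoˡ-≤ A (ℕ.<⇒≤ (ℕ.≰⇒> ρ≰A)))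
        abs≡ : ∣ B + + 2 * + A * (- k - 1ℤ) ∣ ≡ 2 ℕ.* A ℕ.∸ ρ
        abs≡ = trans (cong ∣_∣ (trans (cong (λ z → z + + 2 * + A * (- k - 1ℤ)) B≡) (eq₂ (+ ρ) k (+ A))))
          (trans (∣-i∣≡∣i∣ (+ 2 * + A - + ρ)) (cong ∣_∣ (trans (cong (_- + ρ) (sym (pos-* 2 A)))
            (trans (m-n≡m⊖n (2 ℕ.* A) ρ) (⊖-≥ (ℕ.<⇒≤ (n%ℕd<d B (2 ℕ.* A))))))))

    -- Gauss reduction: B is centred modulo 2 A, and A is exchanged with C as long as this lowers A;
    -- the reduced form at the end has A = 1. Only a vector of value 1 is carried back through the
    -- substitutions.
    reduce : ∀ A → Acc _<_ A → ∀ B C → 0 < A → + 4 * (+ A * C) ≡ B * B + + D → Represents-1 (+ A) B C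
    reduce A (acc rec) B C 0<A 4AC≡ = by-cases C′ refl
      where
      t = proj₁ (centred A B 0<A)
      B′ = B + + 2 * + A * t
      C′ = + A * (t * t) + B * t + C
      4AC′≡ : + 4 * (+ A * C′) ≡ B′ * B′ + + D
      4AC′≡ = trans (eq₁ (+ A) B C t) (trans (cong (λ z → z + + 4 * (+ A * (+ A * (t * t) + B * t))) 4AC≡) (eq₂ (+ A) B (+ D) t))
        where
        eq₁ : ∀ A B C t → + 4 * (A * (A * (t * t) + B * t + C)) ≡ + 4 * (A * C) + + 4 * (A * (A * (t * t) + B * t))
        eq₁ = ℤ-Solver.solve-∀
        eq₂ : ∀ A B D t → B * B + D + + 4 * (A * (A * (t * t) + B * t)) ≡ (B + + 2 * A * t) * (B + + 2 * A * t) + D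
        eq₂ = ℤ-Solver.solve-∀
      translate : Represents-1 (+ A) B′ C′ → Represents-1 (+ A) B C
      translate (a , b , v≡1) = a + t * b , b , trans (eq (+ A) B C t a b) v≡1
        where
        eq : ∀ A B C t a b → A * ((a + t * b) * (a + t * b)) + B * ((a + t * b) * b) + C * (b * b) ≡
          A * (a * a) + (B + + 2 * A * t) * (a * b) + (A * (t * t) + B * t + C) * (b * b)
        eq = ℤ-Solver.solve-∀
      swap : ∀ {C} → Represents-1 C B′ (+ A) → Represents-1 (+ A) B′ C
      swap {C} (a , b , v≡1) = b , a , trans (eq (+ A) B′ C a b) v≡1
        where
        eq : ∀ A B C a b → A * (b * b) + B * (b * a) + C * (a * a) ≡ C * (a * a) + B * (a * b) + A * (b * b)
        eq = ℤ-Solver.solve-∀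
      b = ∣ B′ ∣
      natural : ∀ n → C′ ≡ + n → 4 ℕ.* (A ℕ.* n) ≡ b ℕ.* b ℕ.+ D
      natural n C′≡n = +-injective (begin
        + (4 ℕ.* (A ℕ.* n))      ≡⟨ trans (pos-* 4 (A ℕ.* n)) (cong (+ 4 *_) (pos-* A n)) ⟩
        + 4 * (+ A * + n)        ≡⟨ cong (λ z → + 4 * (+ A * z)) C′≡n ⟨
        + 4 * (+ A * C′)         ≡⟨ 4AC′≡ ⟩
        B′ * B′ + + D            ≡⟨ cong (_+ + D) (∣i²∣ B′) ⟨
        + (b ℕ.* b ℕ.+ D)        ∎)
        where open ≡-Reasoning
      by-size : ∀ n → C′ ≡ + n → Dec (A ≤ n) → Represents-1 (+ A) B C
      by-size n C′≡n (yes A≤n) = 1ℤ , 0ℤ , trans (eq (+ A) B C) (cong +_ (reduced⇒A≡1 A b n 0<A (proj₂ (centred A B 0<A)) A≤n (natural n C′≡n)))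
        where
        eq : ∀ A B C → A * (1ℤ * 1ℤ) + B * (1ℤ * 0ℤ) + C * (0ℤ * 0ℤ) ≡ A
        eq = ℤ-Solver.solve-∀
      by-size n C′≡n (no A≰n) = translate (swap {C′} (subst (λ z → Represents-1 z B′ (+ A)) (sym C′≡n)
        (reduce n (rec (ℕ.≰⇒> A≰n)) B′ (+ A) 0<n (trans (eq (+ n) (+ A)) (trans (cong (λ z → + 4 * (+ A * z)) (sym C′≡n)) 4AC′≡)))))
        where
        eq : ∀ n A → + 4 * (n * A) ≡ + 4 * (A * n)
        eq = ℤ-Solver.solve-∀
        0<n : 0 < n
        0<n = ℕ.n≢0⇒n>0 (λ n≡0 → ℕ.<⇒≢ 0<D (sym (ℕ.m+n≡0⇒n≡0 (b ℕ.* b)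
          (trans (sym (natural n C′≡n)) (trans (cong (λ m → 4 ℕ.* (A ℕ.* m)) n≡0) (cong (4 ℕ.*_) (ℕ.*-zeroʳ A)))))))
      by-cases : ∀ z → C′ ≡ z → Represents-1 (+ A) B C
      by-cases (+ n) C′≡n = by-size n C′≡n (A ℕ.≤? n)
      by-cases -[1+ n ] C′≡-n = contradiction (begin
        + (b ℕ.* b ℕ.+ D)               ≡⟨ cong (_+ + D) (∣i²∣ B′) ⟩
        B′ * B′ + + D                   ≡⟨ 4AC′≡ ⟨
        + 4 * (+ A * C′)                ≡⟨ cong (λ z → + 4 * (+ A * z)) C′≡-n ⟩
        + 4 * (+ A * - (+ suc n))       ≡⟨ eq (+ A) (+ suc n) ⟩
        - (+ 4 * (+ A * + suc n))       ≡⟨ cong -_ (trans (cong (+ 4 *_) (sym (pos-* A (suc n)))) (sym (pos-* 4 (A ℕ.* suc n)))) ⟩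
        - (+ (4 ℕ.* (A ℕ.* suc n)))     ∎) (positive≢nonpositive (4 ℕ.* (A ℕ.* suc n)) (ℕ.≤-trans 0<D (ℕ.m≤n+m D (b ℕ.* b))))
        where
        open ≡-Reasoning
        eq : ∀ A n → + 4 * (A * - n) ≡ - (+ 4 * (A * n))
        eq = ℤ-Solver.solve-∀

  represents-1 : ∀ A B C → 0 < A → + 4 * (+ A * C) ≡ B * B + + D → Represents-1 (+ A) B C
  represents-1 A = reduce A (<-wellFounded A)

module ClassOne (D : ℕ) (3≤D : 3 ≤ D) (D≤163 : D ≤ 163) (D≢4 : D ≢ 4) (check : T (only-principal D))
  (X : ℤ) (y q′ : ℕ) (0<y : 0 < y) (X²+D≡4yᵠ : X * X + + D ≡ + 4 * + (y ℕ.^ suc q′)) (coprime : Coprime ∣ X ∣ y) where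

  private
    0<D : 0 < D
    0<D = ℕ.≤-trans (ℕ.s≤s ℕ.z≤n) 3≤D
    q = suc q′
    M = y ℕ.^ q

  open Imaginary X M D 0<D X²+D≡4yᵠ

  private
    -- Multiplied by y, this is the norm form of the ideal (y, α) in the basis y, α. Its
    -- discriminant X² - 4 y ^ q is - D, so that it represents 1.
    form : ∃₂ λ a b → + y * (a * a) + X * (a * b) + + (y ℕ.^ q′) * (b * b) ≡ 1ℤ
    form = FormReduction.represents-1 D 0<D D≤163 check y X (+ (y ℕ.^ q′)) 0<y
      (trans (cong (+ 4 *_) (sym (pos-* y (y ℕ.^ q′)))) (sym X²+D≡4yᵠ))
    a = proj₁ form
    b = proj₁ (proj₂ form)
    value≡1 = proj₂ (proj₂ form)
    M≡ : + M ≡ + y * + (y ℕ.^ q′)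
    M≡ = pos-* y (y ℕ.^ q′)

    -- `γ` is the element of (y, α) given by the vector of value 1, and `δ₁` its cofactor: their
    -- product is α times the value of the form.
    γ δ₁ : O
    γ = a * + y +α b
    δ₁ = b * + (y ℕ.^ q′) +α a

    Nm-γ : Nm γ ≡ + y
    Nm-γ = trans (cong (λ m → a * + y * (a * + y) + a * + y * b * X + b * b * m) M≡)
      (trans (eq (+ y) X (+ (y ℕ.^ q′)) a b) (trans (cong (+ y *_) value≡1) (*-identityʳ (+ y))))
      where
      eq : ∀ y X m a b → a * y * (a * y) + a * y * b * X + b * b * (y * m) ≡
        y * (y * (a * a) + X * (a * b) + m * (b * b))
      eq = ℤ-Solver.solve-∀

    γδ₁≡α : γ ⊗ δ₁ ≡ α
    γδ₁≡α = cong₂ _+α_ (trans (cong (λ m → a * + y * (b * + (y ℕ.^ q′)) - b * a * m) M≡) (eq₁ (+ y) (+ (y ℕ.^ q′)) a b))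
      (trans (eq₂ (+ y) X (+ (y ℕ.^ q′)) a b) value≡1)
      where
      eq₁ : ∀ y m a b → a * y * (b * m) - b * a * (y * m) ≡ 0ℤ
      eq₁ = ℤ-Solver.solve-∀
      eq₂ : ∀ y X m a b → a * y * a + b * (b * m) + b * a * X ≡ y * (a * a) + X * (a * b) + m * (b * b)
      eq₂ = ℤ-Solver.solve-∀

    coprime-M : ∀ n → Coprime ∣ X ∣ (y ℕ.^ n)
    coprime-M zero (_ , i∣1) = ℕ∣.∣1⇒≡1 i∣1
    coprime-M (suc n) {i} (i∣X , i∣yyⁿ) = coprime-M n (i∣X , coprime-divisor i⊥y i∣yyⁿ)
      where
      i⊥y : Coprime i y
      i⊥y (j∣i , j∣y) = coprime (ℕ∣.∣-trans j∣i i∣X , j∣y)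

    -- α and β are comaximal because their sum X and their product y ^ q are coprime integers.
    bezout : ∃₂ λ u v → α ⊗ u ⊕ β ⊗ u ⊕ α ⊗ β ⊗ v ≡ ι 1ℤ
    bezout = from-identity (coprime-Bézout (coprime-M q))
      where
      combine : ∀ u v → X * u + + M * v ≡ 1ℤ → α ⊗ ι u ⊕ β ⊗ ι u ⊕ α ⊗ β ⊗ ι v ≡ ι 1ℤ
      combine u v Xu+Mv≡1 = begin
        α ⊗ ι u ⊕ β ⊗ ι u ⊕ α ⊗ β ⊗ ι v     ≡⟨ cong (_⊕ α ⊗ β ⊗ ι v) (factor α β (ι u)) ⟩
        (α ⊕ β) ⊗ ι u ⊕ α ⊗ β ⊗ ι v         ≡⟨ cong₂ (λ x z → x ⊗ ι u ⊕ z ⊗ ι v) α⊕β αβ ⟩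
        ι X ⊗ ι u ⊕ ι (+ M) ⊗ ι v           ≡⟨ cong₂ _⊕_ (ι-* X u) (ι-* (+ M) v) ⟨
        ι (X * u + + M * v)                 ≡⟨ cong ι Xu+Mv≡1 ⟩
        ι 1ℤ                                ∎
        where open ≡-Reasoning
      signed : ∃ λ σ → X * σ ≡ + ∣ X ∣
      signed = sign′ X
        where
        sign′ : ∀ i → ∃ λ σ → i * σ ≡ + ∣ i ∣
        sign′ (+ n) = 1ℤ , *-identityʳ (+ n)
        sign′ -[1+ n ] = -1ℤ , cong (λ m → + suc m) (ℕ.*-identityʳ n)
      σ = proj₁ signed
      cast : ∀ x y m n → 1 ℕ.+ x ℕ.* m ≡ y ℕ.* n → 1ℤ + + x * + m ≡ + y * + n
      cast x y m n h = trans (cong (λ z → 1ℤ + z) (sym (pos-* x m))) (trans (cong +_ h) (pos-* y n))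
      from-identity : Identity 1 ∣ X ∣ M → ∃₂ λ u v → α ⊗ u ⊕ β ⊗ u ⊕ α ⊗ β ⊗ v ≡ ι 1ℤ
      from-identity (+- x z h) = ι (σ * + x) , ι (- + z) , combine (σ * + x) (- + z) (begin
        X * (σ * + x) + + M * - + z         ≡⟨ eq₁ X σ (+ x) (+ M) (+ z) ⟩
        + x * (X * σ) - + z * + M           ≡⟨ cong (λ w → + x * w - + z * + M) (proj₂ signed) ⟩
        + x * + ∣ X ∣ - + z * + M           ≡⟨ cong (_- + z * + M) (cast z x M ∣ X ∣ h) ⟨
        1ℤ + + z * + M - + z * + M          ≡⟨ eq₂ (+ z * + M) ⟩
        1ℤ                                  ∎)
        where
        open ≡-Reasoning
        eq₁ : ∀ X s x M z → X * (s * x) + M * - z ≡ x * (X * s) - z * M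
        eq₁ = ℤ-Solver.solve-∀
        eq₂ : ∀ z → 1ℤ + z - z ≡ 1ℤ
        eq₂ = ℤ-Solver.solve-∀
      from-identity (-+ x z h) = ι (- (σ * + x)) , ι (+ z) , combine (- (σ * + x)) (+ z) (begin
        X * - (σ * + x) + + M * + z         ≡⟨ eq₁ X σ (+ x) (+ M) (+ z) ⟩
        + z * + M - + x * (X * σ)           ≡⟨ cong (λ w → + z * + M - + x * w) (proj₂ signed) ⟩
        + z * + M - + x * + ∣ X ∣           ≡⟨ cong (_- + x * + ∣ X ∣) (cast x z ∣ X ∣ M h) ⟨
        1ℤ + + x * + ∣ X ∣ - + x * + ∣ X ∣  ≡⟨ eq₂ (+ x * + ∣ X ∣) ⟩
        1ℤ                                  ∎)
        where
        open ≡-Reasoning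
        eq₁ : ∀ X s x M z → X * - (s * x) + M * z ≡ z * M - x * (X * s)
        eq₁ = ℤ-Solver.solve-∀
        eq₂ : ∀ z → 1ℤ + z - z ≡ 1ℤ
        eq₂ = ℤ-Solver.solve-∀

    conj-^^ : ∀ x n → conj (x ^^ n) ≡ conj x ^^ n
    conj-^^ x zero = cong (_+α 0ℤ) (eq X)
      where
      eq : ∀ X → 1ℤ + 0ℤ * X ≡ 1ℤ
      eq = ℤ-Solver.solve-∀
    conj-^^ x (suc n) = trans (conj-⊗ x (x ^^ n)) (cong (conj x ⊗_) (conj-^^ x n))

    -- γ divides δ times its conjugate, which is a power of y. Moreover γ divides α, and the
    -- conjugate of δ divides β, so `coprime-divides` shows that γ divides δ. In this way factors γ
    -- are split off one at a time.
    powers : ∀ k j → k ℕ.+ j ≡ q → ∃ λ δ → γ ^^ k ⊗ δ ≡ α × Nm δ ≡ + (y ℕ.^ j)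
    powers zero j refl = α , ⊗-identityˡ α , Nm-α
    powers (suc k) j k+1+j≡q = e , γ^[1+k]e≡α , Nm-e
      where
      IH = powers k (suc j) (trans (ℕ.+-suc k j) k+1+j≡q)
      δ = proj₁ IH
      γᵏδ≡α = proj₁ (proj₂ IH)
      Nm-δ = proj₂ (proj₂ IH)
      δδ̄≡γw : δ ⊗ conj δ ≡ γ ⊗ (conj γ ⊗ ι (+ (y ℕ.^ j)))
      δδ̄≡γw = begin
        δ ⊗ conj δ                              ≡⟨ ⊗-conj δ ⟩
        ι (Nm δ)                                ≡⟨ cong ι (trans Nm-δ (pos-* y (y ℕ.^ j))) ⟩
        ι (+ y * + (y ℕ.^ j))                   ≡⟨ ι-* (+ y) (+ (y ℕ.^ j)) ⟩
        ι (+ y) ⊗ ι (+ (y ℕ.^ j))               ≡⟨ cong (λ n → ι n ⊗ ι (+ (y ℕ.^ j))) Nm-γ ⟨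
        ι (Nm γ) ⊗ ι (+ (y ℕ.^ j))              ≡⟨ cong (_⊗ ι (+ (y ℕ.^ j))) (⊗-conj γ) ⟨
        γ ⊗ conj γ ⊗ ι (+ (y ℕ.^ j))            ≡⟨ ⊗-assoc γ (conj γ) (ι (+ (y ℕ.^ j))) ⟩
        γ ⊗ (conj γ ⊗ ι (+ (y ℕ.^ j)))          ∎
        where open ≡-Reasoning
      β≡ : conj (γ ^^ k) ⊗ conj δ ≡ β
      β≡ = trans (sym (conj-⊗ (γ ^^ k) δ)) (trans (cong conj γᵏδ≡α) conj-α)
      divided : ∃ λ e → δ ≡ γ ⊗ e
      divided = coprime-divides {d₁ = δ₁} {c = conj (γ ^^ k)} {d = δ} {d′ = conj δ} {w = conj γ ⊗ ι (+ (y ℕ.^ j))}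
        {u = proj₁ bezout} {v = proj₁ (proj₂ bezout)} γδ₁≡α β≡ (proj₂ (proj₂ bezout)) δδ̄≡γw
      e = proj₁ divided
      γ^[1+k]e≡α : γ ^^ suc k ⊗ e ≡ α
      γ^[1+k]e≡α = trans (rotate γ (γ ^^ k) e) (trans (cong (γ ^^ k ⊗_) (sym (proj₂ divided))) γᵏδ≡α)
      Nm-e : Nm e ≡ + (y ℕ.^ j)
      Nm-e = *-cancelˡ-≡ (+ y) (Nm e) (+ (y ℕ.^ j)) {{ℕ.>-nonZero 0<y}} (begin
        + y * Nm e              ≡⟨ cong (_* Nm e) Nm-γ ⟨
        Nm γ * Nm e             ≡⟨ Nm-⊗ γ e ⟨
        Nm (γ ⊗ e)              ≡⟨ cong Nm (proj₂ divided) ⟨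
        Nm δ                    ≡⟨ trans Nm-δ (pos-* y (y ℕ.^ j)) ⟩
        + y * + (y ℕ.^ j)       ∎)
        where open ≡-Reasoning

    -- A unit with trace t and α-coordinate d satisfies t² + D d² = 4. As D ≥ 3 and D ≠ 4, the trace
    -- is ± 1 or ± 2, and in the latter case d = 0 and the unit is ± 1.
    unit^6 : ∀ δ → Nm δ ≡ 1ℤ → δ ^^ 6 ≡ ι 1ℤ
    unit^6 δ@(c +α d) Nm≡1 = by-trace ∣ t ∣ refl
      where
      t = + 2 * c + d * X
      t²+Dd²≡4 : ∣ t ∣ ℕ.* ∣ t ∣ ℕ.+ D ℕ.* (∣ d ∣ ℕ.* ∣ d ∣) ≡ 4
      t²+Dd²≡4 = +-injective (begin
        + (∣ t ∣ ℕ.* ∣ t ∣) + + (D ℕ.* (∣ d ∣ ℕ.* ∣ d ∣))  ≡⟨ cong₂ _+_ (∣i²∣ t) (trans (pos-* D (∣ d ∣ ℕ.* ∣ d ∣)) (cong (+ D *_) (∣i²∣ d))) ⟩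
        t * t + + D * (d * d)                              ≡⟨ 4Nm c d ⟨
        + 4 * Nm δ                                         ≡⟨ cong (+ 4 *_) Nm≡1 ⟩
        + 4                                                ∎)
        where open ≡-Reasoning
      δ²≡ : δ ⊗ δ ≡ ι t ⊗ δ ⊖ ι 1ℤ
      δ²≡ = trans (characteristic δ) (cong (λ n → ι t ⊗ δ ⊖ ι n) Nm≡1)
      no-square : ∀ n → D ℕ.* (n ℕ.* n) ≢ 4
      no-square 0 D0≡4 = contradiction (trans (sym (ℕ.*-zeroʳ D)) D0≡4) (λ ())
      no-square 1 D1≡4 = D≢4 (trans (sym (ℕ.*-identityʳ D)) D1≡4)
      no-square n@(suc (suc m)) Dn²≡4 = contradiction (ℕ.≤-trans (ℕ.*-mono-≤ 3≤D (ℕ.*-mono-≤ 2≤n 2≤n)) (ℕ.≤-reflexive Dn²≡4)) (ℕ.<⇒≱ (ℕ.≤ᵇ⇒≤ 5 12 tt))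
        where
        2≤n : 2 ≤ n
        2≤n = ℕ.s≤s (ℕ.s≤s ℕ.z≤n)
      rational : d ≡ 0ℤ → δ ^^ 6 ≡ ι 1ℤ
      rational d≡0 = sixth δ (begin
        (c +α d) ⊗ (c +α d)    ≡⟨ cong (λ d → (c +α d) ⊗ (c +α d)) d≡0 ⟩
        ι c ⊗ ι c              ≡⟨ ι-* c c ⟨
        ι (c * c)              ≡⟨ cong ι (trans (eq X (+ M) c) (trans (cong (λ d → c * c + c * d * X + d * d * + M) (sym d≡0)) Nm≡1)) ⟩
        ι 1ℤ                   ∎)
        where
        open ≡-Reasoning
        eq : ∀ X M c → c * c ≡ c * c + c * 0ℤ * X + 0ℤ * 0ℤ * M
        eq = ℤ-Solver.solve-∀
      by-trace : ∀ n → ∣ t ∣ ≡ n → δ ^^ 6 ≡ ι 1ℤ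
      by-trace 0 ∣t∣≡0 = contradiction (subst (λ n → n ℕ.* n ℕ.+ D ℕ.* (∣ d ∣ ℕ.* ∣ d ∣) ≡ 4) ∣t∣≡0 t²+Dd²≡4) (no-square ∣ d ∣)
      by-trace 1 ∣t∣≡1 = sixth-power δ (ι t) δ²≡ (trans (sym (ι-* t t)) (cong ι (∣i∣≡1⇒i²≡1 t ∣t∣≡1)))
      by-trace 2 ∣t∣≡2 = rational (∣i∣≡0⇒i≡0 (d≡0 ∣ d ∣ (ℕ.+-cancelˡ-≡ 4 _ 0 (subst (λ n → n ℕ.* n ℕ.+ D ℕ.* (∣ d ∣ ℕ.* ∣ d ∣) ≡ 4) ∣t∣≡2 t²+Dd²≡4))))
        where
        d≡0 : ∀ n → D ℕ.* (n ℕ.* n) ≡ 0 → n ≡ 0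
        d≡0 zero _ = refl
        d≡0 (suc n) h = contradiction h (ℕ.>⇒≢ (ℕ.*-mono-< 0<D (ℕ.z<s {n ℕ.+ n ℕ.* suc n})))
      by-trace (suc (suc (suc n))) ∣t∣≡3+n = contradiction
        (ℕ.≤-trans (ℕ.*-mono-≤ 3≤∣t∣ 3≤∣t∣) (ℕ.≤-trans (ℕ.m≤m+n (∣ t ∣ ℕ.* ∣ t ∣) _) (ℕ.≤-reflexive t²+Dd²≡4))) (ℕ.<⇒≱ (ℕ.≤ᵇ⇒≤ 5 9 tt))
        where
        3≤∣t∣ : 3 ≤ ∣ t ∣
        3≤∣t∣ = subst (3 ≤_) (sym ∣t∣≡3+n) (ℕ.s≤s (ℕ.s≤s (ℕ.s≤s ℕ.z≤n)))

  -- By Cayley-Hamilton, the powers of x obey the Lucas recurrence of its own trace and norm. This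
  -- leads from the ring generated by α to the sequence attached to κ.
  im-^^ : ∀ x n → im (x ^^ n) ≡ QuadRing.U (tr x) (Nm x) n * im x
  im-^^ x zero = refl
  im-^^ x (suc zero) = trans (cong im (⊗-identityʳ x)) (sym (*-identityˡ (im x)))
  im-^^ x (suc (suc n)) = begin
    im (x ⊗ (x ⊗ x ^^ n))
      ≡⟨ cong im (power-recurrence x (x ^^ n)) ⟩
    im (ι (tr x) ⊗ x ^^ suc n ⊖ ι (Nm x) ⊗ x ^^ n)
      ≡⟨ im-⊖ (ι (tr x) ⊗ x ^^ suc n) (ι (Nm x) ⊗ x ^^ n) ⟩
    im (ι (tr x) ⊗ x ^^ suc n) - im (ι (Nm x) ⊗ x ^^ n)
      ≡⟨ cong₂ _-_ (trans (im-ι⊗ (tr x) (x ^^ suc n)) (cong (tr x *_) (im-^^ x (suc n))))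
                   (trans (im-ι⊗ (Nm x) (x ^^ n)) (cong (Nm x *_) (im-^^ x n))) ⟩
    tr x * (u₁ * im x) - Nm x * (u₀ * im x)
      ≡⟨ eq (tr x) (Nm x) u₁ u₀ (im x) ⟩
    (tr x * u₁ - Nm x * u₀) * im x ∎
    where
    open ≡-Reasoning
    u₀ = QuadRing.U (tr x) (Nm x) n
    u₁ = QuadRing.U (tr x) (Nm x) (suc n)
    im-⊖ : ∀ x z → im (x ⊖ z) ≡ im x - im z
    im-⊖ (_ +α _) (_ +α _) = refl
    eq : ∀ t n u v x → t * (u * x) - n * (v * x) ≡ (t * u - n * v) * x
    eq = ℤ-Solver.solve-∀

  -- The unit in α = γ ^ q δ is absorbed into γ, because its order divides 6 and q² ≡ 1 modulo 6.
  lucas-unit : ∀ w → q ℕ.* q ≡ suc (6 ℕ.* w) → ∃ λ s → s * s + + D ≡ + 4 * + y × ∣ QuadRing.U s (+ y) q ∣ ≡ 1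
  lucas-unit w q²≡ = tr κ , trace²+D , ∣U∣≡1
    where
    open ≡-Reasoning
    factored = powers q 0 (ℕ.+-identityʳ q)
    δ = proj₁ factored
    Nm-δ : Nm δ ≡ 1ℤ
    Nm-δ = proj₂ (proj₂ factored)
    κ = δ ^^ q ⊗ γ
    δ^[q²]≡δ : (δ ^^ q) ^^ q ≡ δ
    δ^[q²]≡δ = begin
      (δ ^^ q) ^^ q            ≡⟨ ^^-* δ q q ⟨
      δ ^^ (q ℕ.* q)           ≡⟨ cong (δ ^^_) q²≡ ⟩
      δ ⊗ δ ^^ (6 ℕ.* w)       ≡⟨ cong (δ ⊗_) (trans (^^-* δ 6 w) (trans (cong (_^^ w) (unit^6 δ Nm-δ)) (1^^ w))) ⟩
      δ ⊗ ι 1ℤ                 ≡⟨ ⊗-identityʳ δ ⟩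
      δ                        ∎
    κ^q≡α : κ ^^ q ≡ α
    κ^q≡α = begin
      (δ ^^ q ⊗ γ) ^^ q        ≡⟨ ^^-distrib (δ ^^ q) γ q ⟩
      (δ ^^ q) ^^ q ⊗ γ ^^ q   ≡⟨ cong (_⊗ γ ^^ q) δ^[q²]≡δ ⟩
      δ ⊗ γ ^^ q               ≡⟨ ⊗-comm δ (γ ^^ q) ⟩
      γ ^^ q ⊗ δ               ≡⟨ proj₁ (proj₂ factored) ⟩
      α                        ∎
    Nm-δ^ : ∀ n → Nm (δ ^^ n) ≡ 1ℤ
    Nm-δ^ zero = eq X (+ M)
      where
      eq : ∀ X M → 1ℤ * 1ℤ + 1ℤ * 0ℤ * X + 0ℤ * 0ℤ * M ≡ 1ℤ
      eq = ℤ-Solver.solve-∀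
    Nm-δ^ (suc n) = trans (Nm-⊗ δ (δ ^^ n)) (cong₂ _*_ Nm-δ (Nm-δ^ n))
    Nm-κ : Nm κ ≡ + y
    Nm-κ = trans (Nm-⊗ (δ ^^ q) γ) (trans (cong₂ _*_ (Nm-δ^ q) Nm-γ) (*-identityˡ (+ y)))
    product≡1 : ∣ QuadRing.U (tr κ) (+ y) q ∣ ℕ.* ∣ im κ ∣ ≡ 1
    product≡1 = begin
      ∣ QuadRing.U (tr κ) (+ y) q ∣ ℕ.* ∣ im κ ∣    ≡⟨ abs-* (QuadRing.U (tr κ) (+ y) q) (im κ) ⟨
      ∣ QuadRing.U (tr κ) (+ y) q * im κ ∣          ≡⟨ cong (λ n → ∣ QuadRing.U (tr κ) n q * im κ ∣) Nm-κ ⟨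
      ∣ QuadRing.U (tr κ) (Nm κ) q * im κ ∣         ≡⟨ cong ∣_∣ (im-^^ κ q) ⟨
      ∣ im (κ ^^ q) ∣                               ≡⟨ cong (λ x → ∣ im x ∣) κ^q≡α ⟩
      1                                             ∎
    ∣U∣≡1 : ∣ QuadRing.U (tr κ) (+ y) q ∣ ≡ 1
    ∣U∣≡1 = ℕ.m*n≡1⇒m≡1 ∣ QuadRing.U (tr κ) (+ y) q ∣ ∣ im κ ∣ product≡1
    trace²+D : tr κ * tr κ + + D ≡ + 4 * + y
    trace²+D = by-components κ Nm-κ (ℕ.m*n≡1⇒n≡1 ∣ QuadRing.U (tr κ) (+ y) q ∣ ∣ im κ ∣ product≡1)
      where
      by-components : ∀ x → Nm x ≡ + y → ∣ im x ∣ ≡ 1 → tr x * tr x + + D ≡ + 4 * + y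
      by-components x@(c +α d) Nm-x ∣d∣≡1 = trans (cong (λ z → tr x * tr x + z)
        (trans (sym (*-identityʳ (+ D))) (cong (+ D *_) (sym (∣i∣≡1⇒i²≡1 d ∣d∣≡1)))))
        (trans (sym (4Nm c d)) (cong (+ 4 *_) Nm-x))

-- The equation

-- The two terms differ by the sign (- 1) ^ (n + 1); this allows a trace to be replaced by its
-- absolute value.
U-neg : ∀ P Q n → ∣ QuadRing.U (- P) Q n ∣ ≡ ∣ QuadRing.U P Q n ∣
U-neg P Q n = trans (cong ∣_∣ (U-neg′ n)) (trans (abs-* (σ n) (QuadRing.U P Q n))
  (trans (cong (ℕ._* ∣ QuadRing.U P Q n ∣) (∣σ∣ n)) (ℕ.*-identityˡ ∣ QuadRing.U P Q n ∣)))
  where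
  σ : ℕ → ℤ
  σ zero = -1ℤ
  σ (suc n) = - σ n
  ∣σ∣ : ∀ n → ∣ σ n ∣ ≡ 1
  ∣σ∣ zero = refl
  ∣σ∣ (suc n) = trans (∣-i∣≡∣i∣ (σ n)) (∣σ∣ n)
  U-neg′ : ∀ n → QuadRing.U (- P) Q n ≡ σ n * QuadRing.U P Q n
  U-neg′ zero = refl
  U-neg′ (suc zero) = refl
  U-neg′ (suc (suc n)) = trans (cong₂ (λ u v → - P * u - Q * v) (U-neg′ (suc n)) (U-neg′ n))
    (eq P Q (σ n) (QuadRing.U P Q (suc n)) (QuadRing.U P Q n))
    where
    eq : ∀ P Q s u v → - P * (- s * u) - Q * (s * v) ≡ - - s * (P * u - Q * v)
    eq = ℤ-Solver.solve-∀

U-abs : ∀ s Q n → ∣ QuadRing.U (+ ∣ s ∣) Q n ∣ ≡ ∣ QuadRing.U s Q n ∣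
U-abs (+ s) Q n = refl
U-abs -[1+ s ] Q n = U-neg -[1+ s ] Q n

coprime-6⇒ : ∀ q → T (coprime-6 q) → ∃ λ u → q ≡ 1 ℕ.+ u ℕ.* 6 ⊎ q ≡ 5 ℕ.+ u ℕ.* 6
coprime-6⇒ q t = q ℕ./ 6 , residue (q ℕ.% 6) refl t
  where
  residue : ∀ c → q ℕ.% 6 ≡ c → T ((c ≡ᵇ 1) ∨ (c ≡ᵇ 5)) → q ≡ 1 ℕ.+ q ℕ./ 6 ℕ.* 6 ⊎ q ≡ 5 ℕ.+ q ℕ./ 6 ℕ.* 6
  residue 1 h _ = inj₁ (trans (ℕ.m≡m%n+[m/n]*n q 6) (cong (ℕ._+ q ℕ./ 6 ℕ.* 6) h))
  residue 5 h _ = inj₂ (trans (ℕ.m≡m%n+[m/n]*n q 6) (cong (ℕ._+ q ℕ./ 6 ℕ.* 6) h))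

prime⇒coprime-6 : ∀ {q} → Prime q → 3 < q → T (coprime-6 q)
prime⇒coprime-6 {q} q-prime 3<q = residue (q ℕ.% 6) refl (ℕ.m%n<n q 6)
  where
  no-divisor : ∀ d c → 1 < d → d ≤ 3 → q ℕ.% 6 ≡ c → d ℕ∣.∣ c → d ℕ∣.∣ 6 → ⊥
  no-divisor d c 1<d d≤3 h d∣c d∣6 =
    [ (λ d≡1 → ℕ.<⇒≢ 1<d (sym d≡1)) , (λ d≡q → ℕ.<⇒≱ 3<q (subst (_≤ 3) d≡q d≤3)) ]′ (prime⇒irreducible q-prime
      (subst (d ℕ∣.∣_) (sym (trans (ℕ.m≡m%n+[m/n]*n q 6) (cong (ℕ._+ q ℕ./ 6 ℕ.* 6) h)))
        (ℕ∣.∣m∣n⇒∣m+n d∣c (ℕ∣.∣n⇒∣m*n (q ℕ./ 6) d∣6))))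
  2≤3 : 2 ≤ 3
  2≤3 = ℕ.≤ᵇ⇒≤ 2 3 tt
  residue : ∀ c → q ℕ.% 6 ≡ c → c < 6 → T ((c ≡ᵇ 1) ∨ (c ≡ᵇ 5))
  residue 0 h _ = no-divisor 2 0 ℕ.≤-refl 2≤3 h (ℕ∣.divides 0 refl) (ℕ∣.divides 3 refl)
  residue 1 h _ = tt
  residue 2 h _ = no-divisor 2 2 ℕ.≤-refl 2≤3 h (ℕ∣.divides 1 refl) (ℕ∣.divides 3 refl)
  residue 3 h _ = no-divisor 3 3 (ℕ.s≤s (ℕ.s≤s ℕ.z≤n)) ℕ.≤-refl h (ℕ∣.divides 1 refl) (ℕ∣.divides 2 refl)
  residue 4 h _ = no-divisor 2 4 ℕ.≤-refl 2≤3 h (ℕ∣.divides 2 refl) (ℕ∣.divides 3 refl)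
  residue 5 h _ = tt
  residue (suc (suc (suc (suc (suc (suc c)))))) _ (ℕ.s≤s (ℕ.s≤s (ℕ.s≤s (ℕ.s≤s (ℕ.s≤s (ℕ.s≤s ()))))))

square≡1-mod-6 : ∀ q → T (coprime-6 q) → ∃ λ w → q ℕ.* q ≡ suc (6 ℕ.* w)
square≡1-mod-6 q t = by-residue (coprime-6⇒ q t)
  where
  eq₁ : ∀ u → (1 ℕ.+ u ℕ.* 6) ℕ.* (1 ℕ.+ u ℕ.* 6) ≡ suc (6 ℕ.* (2 ℕ.* u ℕ.+ 6 ℕ.* u ℕ.* u))
  eq₁ = ℕ-Solver.solve-∀
  eq₂ : ∀ u → (5 ℕ.+ u ℕ.* 6) ℕ.* (5 ℕ.+ u ℕ.* 6) ≡ suc (6 ℕ.* (4 ℕ.+ 10 ℕ.* u ℕ.+ 6 ℕ.* u ℕ.* u))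
  eq₂ = ℕ-Solver.solve-∀
  by-residue : (∃ λ u → q ≡ 1 ℕ.+ u ℕ.* 6 ⊎ q ≡ 5 ℕ.+ u ℕ.* 6) → ∃ λ w → q ℕ.* q ≡ suc (6 ℕ.* w)
  by-residue (u , inj₁ refl) = 2 ℕ.* u ℕ.+ 6 ℕ.* u ℕ.* u , eq₁ u
  by-residue (u , inj₂ refl) = 4 ℕ.+ 10 ℕ.* u ℕ.+ 6 ℕ.* u ℕ.* u , eq₂ u

parity : ∀ n → ∃ λ k → n ≡ k ℕ.+ k ⊎ n ≡ suc (k ℕ.+ k)
parity zero = 0 , inj₁ refl
parity (suc n) = step (parity n)
  where
  step : (∃ λ k → n ≡ k ℕ.+ k ⊎ n ≡ suc (k ℕ.+ k)) → ∃ λ k → suc n ≡ k ℕ.+ k ⊎ suc n ≡ suc (k ℕ.+ k)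
  step (k , inj₁ h) = k , inj₂ (cong suc h)
  step (k , inj₂ h) = suc k , inj₁ (trans (cong suc h) (cong suc (sym (ℕ.+-suc k k))))

mod-4 : ∀ c k m → c ℕ.+ k ℕ.* 4 ≡ m ℕ.* 4 → c ℕ.% 4 ≡ 0
mod-4 c k m h = trans (sym (ℕ.[m+kn]%n≡m%n c k 4)) (trans (cong (ℕ._% 4) h) (ℕ.m*n%n≡0 m 4))

-- The last three conditions are four times those of LargeNorm, since S² ≤ 4N for the remaining norms N.
numeric : ℕ → ℕ → ℕ → Bool
numeric D start n = (3 ≤ᵇ D) ∧ ((D ≤ᵇ 163) ∧ (only-principal D ∧
  ((80 ℕ.* (D ℕ.* D) ≤ᵇ S ℕ.* S) ∧ ((2080 ℕ.* D ≤ᵇ S ℕ.* S) ∧ (3328 ≤ᵇ S ℕ.* S)))))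
  where S = start ℕ.+ 2 ℕ.* n

module Numeric (D start n : ℕ) (t : T (numeric D start n)) where

  S : ℕ
  S = start ℕ.+ 2 ℕ.* n

  private
    t₁ : T (3 ≤ᵇ D) × T ((D ≤ᵇ 163) ∧ (only-principal D ∧
      ((80 ℕ.* (D ℕ.* D) ≤ᵇ S ℕ.* S) ∧ ((2080 ℕ.* D ≤ᵇ S ℕ.* S) ∧ (3328 ≤ᵇ S ℕ.* S)))))
    t₁ = Equivalence.to T-∧ t
    t₂ : T (D ≤ᵇ 163) × T (only-principal D ∧
      ((80 ℕ.* (D ℕ.* D) ≤ᵇ S ℕ.* S) ∧ ((2080 ℕ.* D ≤ᵇ S ℕ.* S) ∧ (3328 ≤ᵇ S ℕ.* S))))
    t₂ = Equivalence.to T-∧ (proj₂ t₁)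
    t₃ : T (only-principal D) × T ((80 ℕ.* (D ℕ.* D) ≤ᵇ S ℕ.* S) ∧ ((2080 ℕ.* D ≤ᵇ S ℕ.* S) ∧ (3328 ≤ᵇ S ℕ.* S)))
    t₃ = Equivalence.to T-∧ (proj₂ t₂)
    t₄ : T (80 ℕ.* (D ℕ.* D) ≤ᵇ S ℕ.* S) × T ((2080 ℕ.* D ≤ᵇ S ℕ.* S) ∧ (3328 ≤ᵇ S ℕ.* S))
    t₄ = Equivalence.to T-∧ (proj₂ t₃)
    t₅ : T (2080 ℕ.* D ≤ᵇ S ℕ.* S) × T (3328 ≤ᵇ S ℕ.* S)
    t₅ = Equivalence.to T-∧ (proj₂ t₄)

  3≤D : 3 ≤ D
  3≤D = ℕ.≤ᵇ⇒≤ 3 D (proj₁ t₁)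

  0<D : 0 < D
  0<D = ℕ.≤-trans (ℕ.s≤s ℕ.z≤n) 3≤D

  D≤163 : D ≤ 163
  D≤163 = ℕ.≤ᵇ⇒≤ D 163 (proj₁ t₂)

  principal : T (only-principal D)
  principal = proj₁ t₃

  80D²≤S² : 80 ℕ.* (D ℕ.* D) ≤ S ℕ.* S
  80D²≤S² = ℕ.≤ᵇ⇒≤ (80 ℕ.* (D ℕ.* D)) (S ℕ.* S) (proj₁ t₄)

  2080D≤S² : 2080 ℕ.* D ≤ S ℕ.* S
  2080D≤S² = ℕ.≤ᵇ⇒≤ (2080 ℕ.* D) (S ℕ.* S) (proj₁ t₅)

  3328≤S² : 3328 ≤ S ℕ.* S
  3328≤S² = ℕ.≤ᵇ⇒≤ 3328 (S ℕ.* S) (proj₂ t₅)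

-- The sieve handles the traces s = start + 2 i with i < n, and the Padé bound the rest.
module Traces (D start n : ℕ) (numerical : T (numeric D start n)) (table : List (ℕ × ℕ))
  (primes : All (λ (h , k) → Prime (suc (h ℕ.+ h))) table) (sieved : T (covered table D start n)) where

  open Numeric D start n numerical

  private
    sieved-sound : ∀ n start → T (covered table D start n) → ∀ i → i < n → ∀ N q →
      let s = start ℕ.+ 2 ℕ.* i in s ℕ.* s ℕ.+ D ≡ N ℕ.* 4 → T (coprime-6 q) →
      ∣ QuadRing.U (+ s) (+ N) q ∣ ≡ 1 → q ≡ 1
    sieved-sound (suc n) start t (suc i) (ℕ.s≤s i<n) N q s²+D≡4N =
      subst (λ s → s ℕ.* s ℕ.+ D ≡ N ℕ.* 4 → T (coprime-6 q) → ∣ QuadRing.U (+ s) (+ N) q ∣ ≡ 1 → q ≡ 1)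
        (eq start i) (sieved-sound n (2 ℕ.+ start) (proj₂ (Equivalence.to T-∧ t)) i i<n N q) s²+D≡4N
      where
      eq : ∀ s i → 2 ℕ.+ s ℕ.+ 2 ℕ.* i ≡ s ℕ.+ 2 ℕ.* suc i
      eq = ℕ-Solver.solve-∀
    sieved-sound (suc n) start t zero _ N q = subst
      (λ s → s ℕ.* s ℕ.+ D ≡ N ℕ.* 4 → T (coprime-6 q) → ∣ QuadRing.U (+ s) (+ N) q ∣ ≡ 1 → q ≡ 1)
      (sym (ℕ.+-identityʳ start)) (at-start (proj₁ (Equivalence.to T-∧ t)))
      where
      singleton : ∀ {q} → q ∈ 1 ∷ [] → q ≡ 1
      singleton (here q≡1) = q≡1
      search : ∀ {table : List (ℕ × ℕ)} → All (λ (h , k) → Prime (suc (h ℕ.+ h))) table → ∀ N →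
        Any (λ (h , k) → T (sieve h k start N (1 ∷ []))) table →
        T (coprime-6 q) → ∣ QuadRing.U (+ start) (+ N) q ∣ ≡ 1 → q ≡ 1
      search (ℓ-prime ∷ _) N (here {h , k} t) c u = singleton (SieveSoundness.sieve-sound h k start N (1 ∷ []) ℓ-prime t (refl ∷ []) q c u)
      search (_ ∷ ps) N (there t) = search ps N t
      at-start : T (any (λ (h , k) → sieve h k start ((start ℕ.* start ℕ.+ D) ℕ./ 4) (1 ∷ [])) table) → start ℕ.* start ℕ.+ D ≡ N ℕ.* 4 → T (coprime-6 q) → ∣ QuadRing.U (+ start) (+ N) q ∣ ≡ 1 → q ≡ 1
      at-start t s²+D≡4N = search primes N (subst (λ N → Any (λ (h , k) → T (sieve h k start N (1 ∷ []))) table)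
        (trans (cong (ℕ._/ 4) s²+D≡4N) (ℕ.m*n/n≡m N 4)) (any⁻ (λ (h , k) → sieve h k start ((start ℕ.* start ℕ.+ D) ℕ./ 4) (1 ∷ [])) table t))

  no-unit : ∀ i N q → let s = start ℕ.+ 2 ℕ.* i in s ℕ.* s ℕ.+ D ≡ N ℕ.* 4 → T (coprime-6 q) → 3 < q →
    ∣ QuadRing.U (+ s) (+ N) q ∣ ≢ 1
  no-unit i N q s²+D≡4N c 3<q u = by-size (i ℕ.<? n)
    where
    s = start ℕ.+ 2 ℕ.* i
    3≮1 : ¬ (3 < 1)
    3≮1 (ℕ.s≤s ())
    by-size : Dec (i < n) → ⊥
    by-size (yes i<n) = 3≮1 (subst (3 <_) (sieved-sound n start sieved i i<n N q s²+D≡4N c u) 3<q)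
    by-size (no i≮n) = by-residue (coprime-6⇒ q c)
      where
      S≤s : S ≤ s
      S≤s = ℕ.+-monoʳ-≤ start (ℕ.*-monoʳ-≤ 2 (ℕ.≮⇒≥ i≮n))
      bound : ∀ c x → c ℕ.* 4 ℕ.* x ≤ S ℕ.* S → c ℕ.* x ≤ N
      bound c x h = ℕ.*-cancelʳ-≤ (c ℕ.* x) N 4 (subst (_≤ N ℕ.* 4) (eq c x) (ℕ.≤-trans h (ℕ.≤-trans (ℕ.*-mono-≤ S≤s S≤s)
        (ℕ.≤-trans (ℕ.m≤m+n (s ℕ.* s) D) (ℕ.≤-reflexive s²+D≡4N)))))
        where
        eq : ∀ c x → c ℕ.* 4 ℕ.* x ≡ c ℕ.* x ℕ.* 4
        eq = ℕ-Solver.solve-∀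
      discriminant : + s * + s + + D ≡ + 4 * + N
      discriminant = trans (cong (_+ + D) (sym (pos-* s s))) (trans (cong +_ (trans s²+D≡4N (ℕ.*-comm N 4))) (pos-* 4 N))
      832≤N : 832 ≤ N
      832≤N = subst (_≤ N) (ℕ.*-identityʳ 832) (bound 832 1 3328≤S²)
      module Large = Imaginary.LargeNorm (+ s) N D 0<D discriminant (bound 20 (D ℕ.* D) 80D²≤S²) (bound 520 D 2080D≤S²) 832≤N
      -- These are q = 3 k + 1 with k = 2 u and q = 3 k + 2 with k = 2 u + 1, in the forms used by
      -- `no-unit-1` and `no-unit-2`.
      eq₁ : ∀ u → 1 ℕ.+ u ℕ.* 6 ≡ 2 ℕ.* u ℕ.+ suc (2 ℕ.* (2 ℕ.* u))
      eq₁ = ℕ-Solver.solve-∀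
      eq₂ : ∀ u → 5 ℕ.+ u ℕ.* 6 ≡ suc (2 ℕ.* u) ℕ.+ suc (suc (2 ℕ.* suc (2 ℕ.* u)))
      eq₂ = ℕ-Solver.solve-∀
      by-residue : (∃ λ u → q ≡ 1 ℕ.+ u ℕ.* 6 ⊎ q ≡ 5 ℕ.+ u ℕ.* 6) → ⊥
      by-residue (zero , inj₁ q≡) = 3≮1 (subst (3 <_) q≡ 3<q)
      by-residue (suc v , inj₁ q≡) = Large.no-unit-1 (2 ℕ.* suc v) (ℕ.*-monoʳ-≤ 2 (ℕ.s≤s ℕ.z≤n))
        (subst (λ q → ∣ QuadRing.U (+ s) (+ N) q ∣ ≡ 1) (trans q≡ (eq₁ (suc v))) u)
      by-residue (v , inj₂ q≡) = Large.no-unit-2 (suc (2 ℕ.* v)) (ℕ.s≤s ℕ.z≤n)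
        (subst (λ q → ∣ QuadRing.U (+ s) (+ N) q ∣ ≡ 1) (trans q≡ (eq₂ v)) u)

-- The candidates 2 to 12 are enough, because 13² = 169 exceeds 163.
square-free : ℕ → Bool
square-free D = all (λ j → not (D ℕ.% ((2 ℕ.+ j) ℕ.* (2 ℕ.+ j)) ≡ᵇ 0)) (upTo 11)

square-free-sound : ∀ D → 0 < D → D ≤ 163 → T (square-free D) → ∀ i → i ℕ.* i ℕ∣.∣ D → i ≡ 1
square-free-sound D 0<D _ _ zero 0∣D = contradiction (ℕ∣.0∣⇒≡0 0∣D) (ℕ.>⇒≢ 0<D)
square-free-sound D _ _ _ (suc zero) _ = refl
square-free-sound D 0<D D≤163 check i@(suc (suc j)) i²∣D = by-size (j ℕ.<? 11)
  where
  by-size : Dec (j < 11) → i ≡ 1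
  by-size (yes j<11) = ⊥-elim (T-not⁻ (All.lookup (all⁺ (λ j → not (D ℕ.% ((2 ℕ.+ j) ℕ.* (2 ℕ.+ j)) ≡ᵇ 0)) (upTo 11) check) (∈-upTo⁺ j<11))
    (ℕ.≡⇒≡ᵇ (D ℕ.% (i ℕ.* i)) 0 (ℕ∣.n∣m⇒m%n≡0 D (i ℕ.* i) i²∣D)))
  by-size (no j≮11) = contradiction (ℕ.≤-trans (ℕ∣.∣⇒≤ {{ℕ.>-nonZero 0<D}} i²∣D) D≤163)
    (ℕ.<⇒≱ (ℕ.≤-trans (ℕ.≤ᵇ⇒≤ 164 169 tt) (ℕ.*-mono-≤ 13≤i 13≤i)))
    where
    13≤i : 13 ≤ i
    13≤i = ℕ.s≤s (ℕ.s≤s (ℕ.≮⇒≥ j≮11))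

-- The exponent is at least 2, so i² divides both x² and the power of y. For square-free D this
-- makes x and y coprime.
common-square : ∀ {D x y m} → x ℕ.* x ℕ.+ D ≡ 4 ℕ.* (y ℕ.^ suc (suc m)) → ∀ {i} → i ℕ∣.∣ x × i ℕ∣.∣ y → i ℕ.* i ℕ∣.∣ D
common-square {D} {x} {y} {m} h {i} (i∣x , i∣y) = ℕ∣.∣m+n∣m⇒∣n (subst (i ℕ.* i ℕ∣.∣_) (sym h)
  (ℕ∣.∣n⇒∣m*n 4 (subst (i ℕ.* i ℕ∣.∣_) (ℕ.*-assoc y y (y ℕ.^ m)) (ℕ∣.∣m⇒∣m*n (y ℕ.^ m) (ℕ∣.*-pres-∣ i∣y i∣y)))))
  (ℕ∣.*-pres-∣ i∣x i∣x)

-- As 4 divides 8, a common factor 2 needs its own argument: dividing by 4 leaves u² + 2 ≡ 0 modulo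
-- 4, which has no solution.
coprime-8 : ∀ {x y m} → x ℕ.* x ℕ.+ 8 ≡ 4 ℕ.* (y ℕ.^ suc (suc m)) → Coprime x y
coprime-8 {x} {y} {m} h {i} (i∣x , i∣y) = by-size i (common-square {8} {x} {y} {m} h (i∣x , i∣y)) i∣x i∣y
  where
  both-even : 2 ℕ∣.∣ x → 2 ℕ∣.∣ y → ⊥
  both-even (ℕ∣.divides u refl) (ℕ∣.divides v refl) = by-parity (parity u)
    where
    r = (v ℕ.* 2) ℕ.^ m
    h′ : u ℕ.* u ℕ.+ 2 ≡ v ℕ.* v ℕ.* r ℕ.* 4
    h′ = ℕ.*-cancelʳ-≡ (u ℕ.* u ℕ.+ 2) (v ℕ.* v ℕ.* r ℕ.* 4) 4 (trans (eq₁ u) (trans h (eq₂ v r)))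
      where
      eq₁ : ∀ u → (u ℕ.* u ℕ.+ 2) ℕ.* 4 ≡ u ℕ.* 2 ℕ.* (u ℕ.* 2) ℕ.+ 8
      eq₁ = ℕ-Solver.solve-∀
      eq₂ : ∀ v r → 4 ℕ.* (v ℕ.* 2 ℕ.* (v ℕ.* 2 ℕ.* r)) ≡ v ℕ.* v ℕ.* r ℕ.* 4 ℕ.* 4
      eq₂ = ℕ-Solver.solve-∀
    by-parity : (∃ λ k → u ≡ k ℕ.+ k ⊎ u ≡ suc (k ℕ.+ k)) → ⊥
    by-parity (k , inj₁ u≡) = contradiction (mod-4 2 (k ℕ.* k) (v ℕ.* v ℕ.* r) (trans (sym (trans (cong (λ u → u ℕ.* u ℕ.+ 2) u≡) (eq k))) h′)) (λ ())
      where
      eq : ∀ k → (k ℕ.+ k) ℕ.* (k ℕ.+ k) ℕ.+ 2 ≡ 2 ℕ.+ k ℕ.* k ℕ.* 4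
      eq = ℕ-Solver.solve-∀
    by-parity (k , inj₂ u≡) = contradiction (mod-4 3 (k ℕ.* k ℕ.+ k) (v ℕ.* v ℕ.* r) (trans (sym (trans (cong (λ u → u ℕ.* u ℕ.+ 2) u≡) (eq k))) h′)) (λ ())
      where
      eq : ∀ k → suc (k ℕ.+ k) ℕ.* suc (k ℕ.+ k) ℕ.+ 2 ≡ 3 ℕ.+ (k ℕ.* k ℕ.+ k) ℕ.* 4
      eq = ℕ-Solver.solve-∀
  by-size : ∀ i → i ℕ.* i ℕ∣.∣ 8 → i ℕ∣.∣ x → i ℕ∣.∣ y → i ≡ 1
  by-size 0 0∣8 _ _ = contradiction (ℕ∣.0∣⇒≡0 0∣8) (λ ())
  by-size 1 _ _ _ = refl
  by-size 2 _ 2∣x 2∣y = ⊥-elim (both-even 2∣x 2∣y)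
  by-size i@(suc (suc (suc _))) i²∣8 _ _ = contradiction (ℕ∣.∣⇒≤ i²∣8) (ℕ.<⇒≱ (ℕ.*-mono-≤ 3≤i 3≤i))
    where
    3≤i : 3 ≤ i
    3≤i = ℕ.s≤s (ℕ.s≤s (ℕ.s≤s ℕ.z≤n))

record Solution (D : ℕ) (y q : ℕ) : Set where
  constructor solution
  field
    s : ℕ
    s²+D≡4y : s ℕ.* s ℕ.+ D ≡ y ℕ.* 4
    ∣U∣≡1 : ∣ QuadRing.U (+ s) (+ y) q ∣ ≡ 1

to-Lucas : ∀ D → 3 ≤ D → D ≤ 163 → D ≢ 4 → T (only-principal D) →
  (∀ {x y m} → x ℕ.* x ℕ.+ D ≡ 4 ℕ.* (y ℕ.^ suc (suc m)) → Coprime x y) →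
  ∀ X y q → 1 < y → Prime q → 3 < q → X * X + + D ≡ + 4 * + (y ℕ.^ q) → Solution D y q
to-Lucas D 3≤D D≤163 D≢4 check coprime X y q@(suc (suc q″)) 1<y q-prime 3<q h =
  solution ∣ proj₁ lucas ∣ (+-injective (begin
    + (∣ s ∣ ℕ.* ∣ s ∣ ℕ.+ D)      ≡⟨ cong (_+ + D) (∣i²∣ s) ⟩
    s * s + + D                    ≡⟨ proj₁ (proj₂ lucas) ⟩
    + 4 * + y                      ≡⟨ *-comm (+ 4) (+ y) ⟩
    + y * + 4                      ≡⟨ pos-* y 4 ⟨
    + (y ℕ.* 4)                    ∎)) (trans (U-abs s (+ y) q) (proj₂ (proj₂ lucas)))
  where
  open ≡-Reasoning
  hℕ : ∣ X ∣ ℕ.* ∣ X ∣ ℕ.+ D ≡ 4 ℕ.* (y ℕ.^ q)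
  hℕ = +-injective (trans (cong (_+ + D) (∣i²∣ X)) (trans h (sym (pos-* 4 (y ℕ.^ q)))))
  squared = square≡1-mod-6 q (prime⇒coprime-6 q-prime 3<q)
  lucas : ∃ λ s → s * s + + D ≡ + 4 * + y × ∣ QuadRing.U s (+ y) q ∣ ≡ 1
  lucas = ClassOne.lucas-unit D 3≤D D≤163 D≢4 check X y (suc q″) (ℕ.<-trans ℕ.z<s 1<y) h (coprime {∣ X ∣} {y} {q″} hℕ) (proj₁ squared) (proj₂ squared)
  s = proj₁ lucas
to-Lucas _ _ _ _ _ _ _ _ 1 _ _ (ℕ.s≤s ()) _

module Equation (a b x y : ℤ) (q : ℕ) (h : y ^ℤ q ≡ f a b x) where

  X : ℤ
  X = + 2 * x + a

  completed-square : ∀ D → disc a b ≡ - (+ D) → X * X + + D ≡ + 4 * (y ^ℤ q)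
  completed-square D disc≡ = begin
    X * X + + D                          ≡⟨ cong (λ d → X * X + d) (trans (sym (neg-involutive (+ D))) (cong -_ (sym disc≡))) ⟩
    X * X + - (a * a - + 4 * b)          ≡⟨ eq a b x ⟩
    + 4 * (x * x + a * x + b)            ≡⟨ cong (+ 4 *_) h ⟨
    + 4 * (y ^ℤ q)                       ∎
    where
    open ≡-Reasoning
    eq : ∀ a b x → (+ 2 * x + a) * (+ 2 * x + a) + - (a * a - + 4 * b) ≡ + 4 * (x * x + a * x + b)
    eq = ℤ-Solver.solve-∀

pos-^ℤ : ∀ m n → (+ m) ^ℤ n ≡ + (m ℕ.^ n)
pos-^ℤ m zero = refl
pos-^ℤ m (suc n) = trans (cong (+ m *_) (pos-^ℤ m n)) (sym (pos-* m (m ℕ.^ n)))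

neg-^ℤ : ∀ m k → (- (+ m)) ^ℤ suc (k ℕ.+ k) ≡ - (+ (m ℕ.^ suc (k ℕ.+ k)))
neg-^ℤ m zero = trans (*-identityʳ (- (+ m))) (cong (λ n → - (+ n)) (sym (ℕ.*-identityʳ m)))
neg-^ℤ m (suc k) = begin
  - (+ m) * (- (+ m) * ((- (+ m)) ^ℤ (k ℕ.+ suc k)))
    ≡⟨ cong (λ n → - (+ m) * (- (+ m) * ((- (+ m)) ^ℤ n))) (ℕ.+-suc k k) ⟩
  - (+ m) * (- (+ m) * ((- (+ m)) ^ℤ suc (k ℕ.+ k)))
    ≡⟨ cong (λ z → - (+ m) * (- (+ m) * z)) (neg-^ℤ m k) ⟩
  - (+ m) * (- (+ m) * - (+ (m ℕ.^ suc (k ℕ.+ k))))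
    ≡⟨ eq (+ m) (+ (m ℕ.^ suc (k ℕ.+ k))) ⟩
  - (+ m * (+ m * + (m ℕ.^ suc (k ℕ.+ k))))
    ≡⟨ cong -_ (trans (cong (+ m *_) (sym (pos-* m (m ℕ.^ suc (k ℕ.+ k))))) (sym (pos-* m (m ℕ.* m ℕ.^ suc (k ℕ.+ k))))) ⟩
  - (+ (m ℕ.* (m ℕ.* m ℕ.^ suc (k ℕ.+ k))))
    ≡⟨ cong (λ n → - (+ (m ℕ.* (m ℕ.* m ℕ.^ n)))) (ℕ.+-suc k k) ⟨
  - (+ (m ℕ.^ suc (suc k ℕ.+ suc k))) ∎
  where
  open ≡-Reasoning
  eq : ∀ m u → - m * (- m * - u) ≡ - (m * (m * u))
  eq = ℤ-Solver.solve-∀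

coprime-6⇒odd : ∀ q → T (coprime-6 q) → ∃ λ k → q ≡ suc (k ℕ.+ k)
coprime-6⇒odd q t = by-residue (coprime-6⇒ q t)
  where
  eq₁ : ∀ u → 1 ℕ.+ u ℕ.* 6 ≡ suc (3 ℕ.* u ℕ.+ 3 ℕ.* u)
  eq₁ = ℕ-Solver.solve-∀
  eq₂ : ∀ u → 5 ℕ.+ u ℕ.* 6 ≡ suc (2 ℕ.+ 3 ℕ.* u ℕ.+ (2 ℕ.+ 3 ℕ.* u))
  eq₂ = ℕ-Solver.solve-∀
  by-residue : (∃ λ u → q ≡ 1 ℕ.+ u ℕ.* 6 ⊎ q ≡ 5 ℕ.+ u ℕ.* 6) → ∃ λ k → q ≡ suc (k ℕ.+ k)
  by-residue (u , inj₁ q≡) = 3 ℕ.* u , trans q≡ (eq₁ u)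
  by-residue (u , inj₂ q≡) = 2 ℕ.+ 3 ℕ.* u , trans q≡ (eq₂ u)

-- q is odd, so a negative y would make y ^ q negative, whereas X² + D is positive.
natural-base : ∀ X D y q → 0 < D → T (coprime-6 q) → X * X + + D ≡ + 4 * (y ^ℤ q) →
  X * X + + D ≡ + 4 * + (∣ y ∣ ℕ.^ q)
natural-base X D (+ m) q _ _ h = trans h (cong (+ 4 *_) (pos-^ℤ m q))
natural-base X D y@(-[1+ m ]) q 0<D c h = contradiction (begin
  + (∣ X ∣ ℕ.* ∣ X ∣ ℕ.+ D)            ≡⟨ cong (_+ + D) (∣i²∣ X) ⟩
  X * X + + D                          ≡⟨ h ⟩
  + 4 * (y ^ℤ q)                       ≡⟨ cong (+ 4 *_) (trans (cong (y ^ℤ_) q≡) (neg-^ℤ (suc m) k)) ⟩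
  + 4 * - (+ n)                        ≡⟨ eq (+ n) ⟩
  - (+ 4 * + n)                        ≡⟨ cong -_ (pos-* 4 n) ⟨
  - (+ (4 ℕ.* n))                      ∎) (positive≢nonpositive (4 ℕ.* n) (ℕ.≤-trans 0<D (ℕ.m≤n+m D (∣ X ∣ ℕ.* ∣ X ∣))))
  where
  open ≡-Reasoning
  k = proj₁ (coprime-6⇒odd q c)
  q≡ = proj₂ (coprime-6⇒odd q c)
  n = suc m ℕ.^ suc (k ℕ.+ k)
  eq : ∀ n → + 4 * - n ≡ - (+ 4 * n)
  eq = ℤ-Solver.solve-∀

-- s² + D ≡ 0 modulo 4 decides the parity of s. The trace 1 is set apart because exceptional indices
-- occur there.
odd-trace : ∀ {D y q} → D ℕ.% 4 ≢ 0 → (sol : Solution D y q) →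
  Solution.s sol ≡ 1 ⊎ ∃ λ i → Solution.s sol ≡ 3 ℕ.+ 2 ℕ.* i
odd-trace {D} {y} D%4≢0 (solution s s²+D≡4y _) = by-parity (parity s)
  where
  eq₁ : ∀ k D → D ℕ.+ k ℕ.* k ℕ.* 4 ≡ (k ℕ.+ k) ℕ.* (k ℕ.+ k) ℕ.+ D
  eq₁ = ℕ-Solver.solve-∀
  eq₂ : ∀ k → suc (suc k ℕ.+ suc k) ≡ 3 ℕ.+ 2 ℕ.* k
  eq₂ = ℕ-Solver.solve-∀
  by-parity : (∃ λ k → s ≡ k ℕ.+ k ⊎ s ≡ suc (k ℕ.+ k)) → s ≡ 1 ⊎ ∃ λ i → s ≡ 3 ℕ.+ 2 ℕ.* i
  by-parity (k , inj₁ s≡) = contradiction (mod-4 D (k ℕ.* k) y (trans (eq₁ k D) (trans (cong (λ s → s ℕ.* s ℕ.+ D) (sym s≡)) s²+D≡4y))) D%4≢0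
  by-parity (zero , inj₂ s≡) = inj₁ s≡
  by-parity (suc k , inj₂ s≡) = inj₂ (k , trans s≡ (eq₂ k))

even-trace : ∀ {D y q} → suc D ℕ.% 4 ≢ 0 → (sol : Solution D y q) → ∃ λ i → Solution.s sol ≡ 2 ℕ.* i
even-trace {D} {y} 1+D%4≢0 (solution s s²+D≡4y _) = by-parity (parity s)
  where
  eq₁ : ∀ k D → suc D ℕ.+ (k ℕ.* k ℕ.+ k) ℕ.* 4 ≡ suc (k ℕ.+ k) ℕ.* suc (k ℕ.+ k) ℕ.+ D
  eq₁ = ℕ-Solver.solve-∀
  eq₂ : ∀ k → k ℕ.+ k ≡ 2 ℕ.* k
  eq₂ = ℕ-Solver.solve-∀
  by-parity : (∃ λ k → s ≡ k ℕ.+ k ⊎ s ≡ suc (k ℕ.+ k)) → ∃ λ i → s ≡ 2 ℕ.* i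
  by-parity (k , inj₁ s≡) = k , trans s≡ (eq₂ k)
  by-parity (k , inj₂ s≡) = contradiction (mod-4 (suc D) (k ℕ.* k ℕ.+ k) y (trans (eq₁ k D) (trans (cong (λ s → s ℕ.* s ℕ.+ D) (sym s≡)) s²+D≡4y))) 1+D%4≢0

trace≡1 : ∀ D n {table y q} N → 1 ℕ.+ D ≡ N ℕ.* 4 → D ℕ.% 4 ≢ 0 → T (numeric D 3 n) →
  All (λ (h , k) → Prime (suc (h ℕ.+ h))) table → T (covered table D 3 n) →
  T (coprime-6 q) → 3 < q → Solution D y q → y ≡ N × ∣ QuadRing.U 1ℤ (+ N) q ∣ ≡ 1
trace≡1 D n {table} {y} {q} N 1+D≡4N D%4≢0 numerical primes sieved c 3<q sol@(solution s s²+D≡4y ∣U∣≡1) = by-trace (odd-trace D%4≢0 sol)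
  where
  by-trace : s ≡ 1 ⊎ (∃ λ i → s ≡ 3 ℕ.+ 2 ℕ.* i) → y ≡ N × ∣ QuadRing.U 1ℤ (+ N) q ∣ ≡ 1
  by-trace (inj₁ s≡1) = y≡N , subst₂ (λ s y → ∣ QuadRing.U (+ s) (+ y) q ∣ ≡ 1) s≡1 y≡N ∣U∣≡1
    where
    y≡N : y ≡ N
    y≡N = ℕ.*-cancelʳ-≡ y N 4 (trans (sym s²+D≡4y) (trans (cong (λ s → s ℕ.* s ℕ.+ D) s≡1) 1+D≡4N))
  by-trace (inj₂ (i , s≡)) = contradiction (subst (λ s → ∣ QuadRing.U (+ s) (+ y) q ∣ ≡ 1) s≡ ∣U∣≡1)
    (Traces.no-unit D 3 n numerical table primes sieved i y q (subst (λ s → s ℕ.* s ℕ.+ D ≡ y ℕ.* 4) s≡ s²+D≡4y) c 3<q)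

odd-discriminant : ∀ D n N → T (numeric D 3 n) → T (square-free D) → D ℕ.% 4 ≢ 0 → 1 ℕ.+ D ≡ N ℕ.* 4 →
  ∀ {table} → All (λ (h , k) → Prime (suc (h ℕ.+ h))) table → T (covered table D 3 n) →
  ∀ a b x y q → disc a b ≡ - (+ D) → Prime q → 3 < q → 1 < ∣ y ∣ → y ^ℤ q ≡ f a b x →
  ∣ y ∣ ≡ N × ∣ QuadRing.U 1ℤ (+ N) q ∣ ≡ 1
odd-discriminant D n N t sq D%4≢0 1+D≡4N primes sieved a b x y q disc≡ q-prime 3<q 1<y h =
  trace≡1 D n N 1+D≡4N D%4≢0 t primes sieved c 3<q
    (to-Lucas D 3≤D D≤163 (λ D≡4 → D%4≢0 (cong (ℕ._% 4) D≡4)) principal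
      (λ {x} {y} {m} h′ {i} i∣ → square-free-sound D 0<D D≤163 sq i (common-square {D} {x} {y} {m} h′ i∣))
      (Equation.X a b x y q h) ∣ y ∣ q 1<y q-prime 3<q
      (natural-base (Equation.X a b x y q h) D y q 0<D c (Equation.completed-square a b x y q h D disc≡)))
  where
  open Numeric D 3 n t
  c = prime⇒coprime-6 q-prime 3<q

-- At trace 1 the list `E` may contain genuine solutions besides 1, so the outcome is a bound on q
-- and not a contradiction.
sieve-at-1 : ∀ h k N E → T (sieve h k 1 N E) → Prime (suc (h ℕ.+ h)) → All (λ e → ∣ QuadRing.U 1ℤ (+ N) e ∣ ≡ 1) E →
  ∀ {q b} → All (_≤ b) E → Prime q → 3 < q → ∣ QuadRing.U 1ℤ (+ N) q ∣ ≡ 1 → q ≤ b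
sieve-at-1 h k N E t ℓ-prime units {q} E≤b q-prime 3<q u =
  All.lookup E≤b (SieveSoundness.sieve-sound h k 1 N E ℓ-prime t units q (prime⇒coprime-6 q-prime 3<q) u)

≤! : ∀ m n → {T (m ≤ᵇ n)} → m ≤ n
≤! m n {t} = ℕ.≤ᵇ⇒≤ m n t

index-bound : ∀ {δ q₀} → Q₀ δ q₀ → ∀ a b x y q → disc a b ≡ δ → Prime q → 3 < q → 1 < ∣ y ∣ → y ^ℤ q ≡ f a b x →
  q ≤ q₀
index-bound d7 a b x y q disc≡ q-prime 3<q 1<y h =
  -- For norm 2, `U 5 = U 13 = -1`; these belong to 11² + 7 = 2⁷ and 181² + 7 = 2¹⁵.
  sieve-at-1 105 34 2 (1 ∷ 5 ∷ 13 ∷ []) tt (from-yes (prime? 211)) (refl ∷ refl ∷ refl ∷ [])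
    (≤! 1 13 ∷ ≤! 5 13 ∷ ≤! 13 13 ∷ []) q-prime 3<q
    (proj₂ (odd-discriminant 7 99 2 tt tt (λ ()) refl primes₇ tt a b x y q disc≡ q-prime 3<q 1<y h))
index-bound d11 a b x y q disc≡ q-prime 3<q 1<y h =
  -- The index 5 belongs to 31² + 11 = 4 · 3⁵.
  sieve-at-1 51 16 3 (1 ∷ 5 ∷ []) tt (from-yes (prime? 103)) (refl ∷ refl ∷ [])
    (≤! 1 5 ∷ ≤! 5 5 ∷ []) q-prime 3<q
    (proj₂ (odd-discriminant 11 99 3 tt tt (λ ()) refl primes₁₁ tt a b x y q disc≡ q-prime 3<q 1<y h))
index-bound d19 a b x y q disc≡ q-prime 3<q 1<y h =
  -- The index 7 belongs to 559² + 19 = 4 · 5⁷.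
  sieve-at-1 21 6 5 (1 ∷ 7 ∷ []) tt (from-yes (prime? 43)) (refl ∷ refl ∷ [])
    (≤! 1 7 ∷ ≤! 7 7 ∷ []) q-prime 3<q
    (proj₂ (odd-discriminant 19 99 5 tt tt (λ ()) refl primes₁₉ tt a b x y q disc≡ q-prime 3<q 1<y h))
index-bound d43 a b x y q disc≡ q-prime 3<q 1<y h =
  sieve-at-1 6 1 11 (1 ∷ []) tt (from-yes (prime? 13)) (refl ∷ []) (≤! 1 4 ∷ []) q-prime 3<q
    (proj₂ (odd-discriminant 43 192 11 tt tt (λ ()) refl primes₄₃ tt a b x y q disc≡ q-prime 3<q 1<y h))
index-bound d67 a b x y q disc≡ q-prime 3<q 1<y h =
  sieve-at-1 18 5 17 (1 ∷ []) tt (from-yes (prime? 37)) (refl ∷ []) (≤! 1 4 ∷ []) q-prime 3<q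
    (proj₂ (odd-discriminant 67 300 17 tt tt (λ ()) refl primes₆₇ tt a b x y q disc≡ q-prime 3<q 1<y h))
index-bound d163 a b x y q disc≡ q-prime 3<q 1<y h =
  sieve-at-1 48 15 41 (1 ∷ []) tt (from-yes (prime? 97)) (refl ∷ []) (≤! 1 4 ∷ []) q-prime 3<q
    -- The 732 odd traces from 3 to 1465 go to the sieve. From S = 1467 on, 80 D² ≤ S² holds, which
    -- is the strictest condition for this D.
    (proj₂ (odd-discriminant 163 732 41 tt tt (λ ()) refl primes₁₆₃ tt a b x y q disc≡ q-prime 3<q 1<y h))

-- The only trace left is 1, and it belongs to y = (1 + 3) / 4 = 1.
no-solution-3 : ∀ a b x y q → disc a b ≡ - (+ 3) → Prime q → 3 < q → 1 < ∣ y ∣ → y ^ℤ q ≢ f a b x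
no-solution-3 a b x y q disc≡ q-prime 3<q 1<y h = ℕ.<⇒≢ 1<y (sym
  (proj₁ (odd-discriminant 3 99 1 tt tt (λ ()) refl primes₃ tt a b x y q disc≡ q-prime 3<q 1<y h)))

-- Here s is even, and the sieve can start at 0 because no trace has an exceptional index.
no-solution-8 : ∀ a b x y q → disc a b ≡ - (+ 8) → Prime q → 3 < q → 1 < ∣ y ∣ → y ^ℤ q ≢ f a b x
no-solution-8 a b x y q disc≡ q-prime 3<q 1<y h =
  Traces.no-unit 8 0 100 tt table₈ primes₈ tt (proj₁ even) ∣ y ∣ q
    (subst (λ s → s ℕ.* s ℕ.+ 8 ≡ ∣ y ∣ ℕ.* 4) (proj₂ even) (Solution.s²+D≡4y sol)) c 3<q
    (subst (λ s → ∣ QuadRing.U (+ s) (+ ∣ y ∣) q ∣ ≡ 1) (proj₂ even) (Solution.∣U∣≡1 sol))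
  where
  open Numeric 8 0 100 tt
  c = prime⇒coprime-6 q-prime 3<q
  X = Equation.X a b x y q h
  sol : Solution 8 ∣ y ∣ q
  sol = to-Lucas 8 3≤D D≤163 (λ ()) principal (λ {x} {y} {m} → coprime-8 {x} {y} {m}) X ∣ y ∣ q 1<y q-prime 3<q
    (natural-base X 8 y q 0<D c (Equation.completed-square a b x y q h 8 disc≡))
  even = even-trace (λ ()) sol

theorem1p2 : ((a b x y : ℤ) (q q₀ : ℕ) → Q₀ (disc a b) q₀ → Prime q → 2 < q →
    1 < ∣ y ∣ → y ^ℤ q ≡ f a b x → q ≤ q₀)
    ×
    ((a b : ℤ) (q : ℕ) → (disc a b ≡ - (+ 3) ⊎ disc a b ≡ - (+ 8)) → Prime q → 3 < q →
    ¬ (∃₂ λ (x y : ℤ) → ((+ 1) ℤ.< y) × (y ^ℤ q ≡ f a b x)))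
theorem1p2 = part-i , part-ii
  where
  3≤ : ∀ {δ q₀} → Q₀ δ q₀ → 3 ≤ q₀
  3≤ d7 = ≤! 3 13
  3≤ d11 = ≤! 3 5
  3≤ d19 = ≤! 3 7
  3≤ d43 = ≤! 3 4
  3≤ d67 = ≤! 3 4
  3≤ d163 = ≤! 3 4
  part-i : (a b x y : ℤ) (q q₀ : ℕ) → Q₀ (disc a b) q₀ → Prime q → 2 < q →
    1 < ∣ y ∣ → y ^ℤ q ≡ f a b x → q ≤ q₀
  part-i a b x y q q₀ d q-prime 2<q 1<y h = by-size (q ℕ.≤? 3)
    where
    by-size : Dec (q ≤ 3) → q ≤ q₀
    by-size (yes q≤3) = ℕ.≤-trans q≤3 (3≤ d)
    by-size (no q≰3) = index-bound d a b x y q refl q-prime (ℕ.≰⇒> q≰3) 1<y h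
  1<∣y∣ : ∀ {y} → + 1 ℤ.< y → 1 < ∣ y ∣
  1<∣y∣ (+<+ 1<y) = 1<y
  part-ii : (a b : ℤ) (q : ℕ) → (disc a b ≡ - (+ 3) ⊎ disc a b ≡ - (+ 8)) → Prime q → 3 < q →
    ¬ (∃₂ λ (x y : ℤ) → ((+ 1) ℤ.< y) × (y ^ℤ q ≡ f a b x))
  part-ii a b q (inj₁ disc≡) q-prime 3<q (x , y , 1<y , h) = no-solution-3 a b x y q disc≡ q-prime 3<q (1<∣y∣ 1<y) h
  part-ii a b q (inj₂ disc≡) q-prime 3<q (x , y , 1<y , h) = no-solution-8 a b x y q disc≡ q-prime 3<q (1<∣y∣ 1<y) h
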